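{- Let $k \geqslant 2$ be a fixed integer. There exists $n_0 = n_0(k)$ such that for every integer $n \geqslant n_0$ and every positive integer $q$ the following hold for the $(1:q)$ Waiter--Client non--2--colourability game played on the edge set $E(K_n^{(k)})$ of the complete $k$--uniform hypergraph $K_n^{(k)}$ on $n$ vertices. (i) If $q \leqslant \binom{\lceil n/2\rceil}{k}\frac{\ln 2}{2((1+\ln 2)n+\ln 2)}$, then Waiter has a strategy that forces Client to build a non--2--colourable hypergraph (that is, Waiter has a winning strategy). (ii) If $q \geqslant 2^{k/2}e^{k/2+1}k\binom{n}{k}/n$, then Client has a strategy that keeps his hypergraph 2--colourable throughout the game (that is, Client has a winning strategy).
   Context: $K_n^{(k)}$ is the hypergraph on $n$ vertices whose edges are all $k$-element subsets of the vertex set. For a set $F\subseteq E(K_n^{(k)})$, the weak chromatic number $\chi(F)$ is the smallest integer $r$ such that $V(K_n^{(k)})$ can be partitioned into $r$ independent sets, where a set of vertices is independent if it contains no edge of $F$ entirely. The hypergraph with vertex set $V(K_n^{(k)})$ and edge set $F$ is 2--colourable if $\chi(F)\leqslant 2$, and non--2--colourable if $\chi(F)>2$. The $(1:q)$ Waiter--Client game $(X,\mathcal{F})$, where $X$ is a finite set (the board), $\mathcal{F}\subseteq 2^X$ is the family of winning sets and $q$ is a positive integer, is the following two--player perfect information game. At the beginning of each round, Waiter offers Client exactly $q+1$ free (that is, previously unclaimed) elements of $X$ of Waiter's choice. Client claims one of these, and the remaining $q$ offered elements are claimed by Waiter. If in the last round only $1\leqslant r<q+1$ free elements remain, Waiter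 claims all of them. The game ends when all elements of $X$ are claimed. Waiter wins if Client has fully claimed some winning set in $\mathcal{F}$; otherwise Client wins. The non--2--colourability game has board $X=E(K_n^{(k)})$ and winning sets $\mathcal{NC}_2=\{F\subseteq E(K_n^{(k)}):\chi(F)>2\}$. Client's hypergraph is the hypergraph with vertex set $V(K_n^{(k)})$ whose edges are those claimed by Client. Here $e$ is the base of the natural logarithm. -}

module Defs where

open import Level using (0ℓ)
open import Data.Nat.Base as ℕ using (ℕ; zero; suc; _!)
import Data.Nat.Properties as ℕ
open import Data.Integer.Base as ℤ using (+_; 1ℤ)
import Data.Integer.Properties as ℤ
open import Data.Rational.Base hiding (round)
open import Data.Rational.Properties
open import Data.Rational.Solver using (module +-*-Solver)
import Data.Rational.Unnormalised.Base as ℚᵘ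
import Data.Rational.Unnormalised.Properties as ℚᵘ
open import Data.Fin.Base using (Fin)
open import Data.Fin.Subset using (Subset; inside; outside) renaming (_∈_ to _∈ₛ_; ∣_∣ to size)
open import Data.Vec.Base using ([]; _∷_)
open import Data.List.Base using (List; []; _∷_; _++_; map; filter; length)
open import Data.List.Membership.Propositional using (_∈_)
open import Data.List.Relation.Binary.Subset.Propositional using (_⊆_)
open import Data.List.Relation.Binary.Permutation.Propositional using (_↭_)
open import Data.Product using (∃; ∃-syntax; _×_; _,_)
open import Data.Sum.Base using (_⊎_; inj₁; inj₂)
open import Data.Unit.Base using (⊤)
open import Data.Empty using (⊥-elim)
open import Relation.Nullary using (¬_; yes; no)
open import Relation.Unary using (Pred)
open import Relation.Binary.PropositionalEquality

open +-*-Solver using (solve; _:=_; _:+_; _:*_; _:-_; con)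

------------------------------------------------------------------------
-- Real numbers: Cauchy sequences of rationals with pointwise operations

Cauchy : (ℕ → ℚ) → Set
Cauchy s = ∀ ε → 0ℚ < ε →
  ∃[ N ] ∀ m n → N ℕ.≤ m → N ℕ.≤ n → ∣ s m - s n ∣ ≤ ε

record ℝ : Set where
  no-eta-equality
  field
    seq    : ℕ → ℚ
    cauchy : Cauchy seq

open ℝ public

infix 4 _≤ᴿ_

_≤ᴿ_ : ℝ → ℝ → Set
x ≤ᴿ y = ∀ ε → 0ℚ < ε → ∃[ N ] ∀ m → N ℕ.≤ m → seq x m ≤ seq y m + ε

record Positiveᴿ (x : ℝ) : Set where
  constructor mkPositive
  field
    bound    : ℚ
    bound>0  : 0ℚ < bound
    from     : ℕ
    isBound  : ∀ m → from ℕ.≤ m → bound ≤ seq x m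

module Arithmetic where

  ½>0 : 0ℚ < ½
  ½>0 = positive⁻¹ ½

  *-pos : ∀ {p q} → 0ℚ < p → 0ℚ < q → 0ℚ < p * q
  *-pos {p} {q} a b =
    positive⁻¹ (p * q) {{pos*pos⇒pos p {{positive a}} q {{positive b}}}}

  *-nn : ∀ {p q} → 0ℚ ≤ p → 0ℚ ≤ q → 0ℚ ≤ p * q
  *-nn {p} {q} a b = nonNegative⁻¹ (p * q)
    {{nonNeg*nonNeg⇒nonNeg p {{nonNegative a}} q {{nonNegative b}}}}

  +-pos : ∀ {p q} → 0ℚ < p → 0ℚ ≤ q → 0ℚ < p + q
  +-pos a b = +-mono-<-≤ a b

  +-nn : ∀ {p q} → 0ℚ ≤ p → 0ℚ ≤ q → 0ℚ ≤ p + q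
  +-nn a b = +-mono-≤ a b

  *-mono : ∀ {p q r s} → 0ℚ ≤ q → 0ℚ ≤ r → p ≤ q → r ≤ s → p * r ≤ q * s
  *-mono {q = q} {r} q≥0 r≥0 p≤q r≤s = ≤-trans
    (*-monoʳ-≤-nonNeg r {{nonNegative r≥0}} p≤q)
    (*-monoˡ-≤-nonNeg q {{nonNegative q≥0}} r≤s)

  p≤∣p∣ : ∀ p → p ≤ ∣ p ∣
  p≤∣p∣ p with ≤-total 0ℚ p
  ... | inj₁ 0≤p = ≤-reflexive (sym (0≤p⇒∣p∣≡p 0≤p))
  ... | inj₂ p≤0 = ≤-trans p≤0 (0≤∣p∣ p)

  ∣p-q∣≡∣q-p∣ : ∀ p q → ∣ p - q ∣ ≡ ∣ q - p ∣
  ∣p-q∣≡∣q-p∣ p q = trans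
    (cong ∣_∣ (solve 2 (λ p q → p :- q := con 0ℚ :- (q :- p)) refl p q))
    (trans (cong ∣_∣ (+-identityˡ (- (q - p)))) (∣-p∣≡∣p∣ (q - p)))

  close⇒≤ : ∀ {p q ε} → ∣ p - q ∣ ≤ ε → p ≤ q + ε
  close⇒≤ {p} {q} {ε} h = begin
    p            ≡⟨ solve 2 (λ p q → p := q :+ (p :- q)) refl p q ⟩
    q + (p - q)  ≤⟨ +-monoʳ-≤ q (≤-trans (p≤∣p∣ (p - q)) h) ⟩
    q + ε        ∎
    where open ≤-Reasoning

  sub-≤ : ∀ {p q ε} → p ≤ q + ε → p - q ≤ ε
  sub-≤ {p} {q} {ε} h = begin
    p - q      ≤⟨ +-monoˡ-≤ (- q) h ⟩
    q + ε - q  ≡⟨ solve 2 (λ q e → q :+ e :- q := e) refl q ε ⟩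
    ε          ∎
    where open ≤-Reasoning

  ≤⇒close : ∀ {p q ε} → p ≤ q + ε → q ≤ p + ε → ∣ p - q ∣ ≤ ε
  ≤⇒close {p} {q} {ε} h₁ h₂ with ∣p∣≡p∨∣p∣≡-p (p - q)
  ... | inj₁ eq = subst (_≤ ε) (sym eq) (sub-≤ h₁)
  ... | inj₂ eq = subst (_≤ ε) (sym (trans eq
          (trans (sym (+-identityˡ (- (p - q))))
          (solve 2 (λ p q → con 0ℚ :- (p :- q) := q :- p) refl p q)))) (sub-≤ h₂)

  ⊔-l : ∀ {a b m} → a ℕ.⊔ b ℕ.≤ m → a ℕ.≤ m
  ⊔-l {a} {b} h = ℕ.≤-trans (ℕ.m≤m⊔n a b) h

  ⊔-r : ∀ {a b m} → a ℕ.⊔ b ℕ.≤ m → b ℕ.≤ m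
  ⊔-r {a} {b} h = ℕ.≤-trans (ℕ.m≤n⊔m a b) h

  half : ∀ ε → ε * ½ + ε * ½ ≡ ε
  half ε = solve 1 (λ e → e :* con ½ :+ e :* con ½ := e) refl ε

  half-pos : ∀ {ε} → 0ℚ < ε → 0ℚ < ε * ½
  half-pos h = *-pos h ½>0

  divide : ∀ {ε B} → 0ℚ < ε → 0ℚ < B → ∃[ δ ] 0ℚ < δ × δ * B ≡ ε
  divide {ε} {B} ε>0 B>0 = ε * 1/ B , *-pos ε>0 (positive⁻¹ (1/ B) {{1/pos⇒pos B}}) ,
    trans (*-assoc ε (1/ B) B) (trans (cong (ε *_) (*-inverseˡ B)) (*-identityʳ ε))
    where
    instance
      B-pos : Positive B
      B-pos = positive B>0
      B-nonZero : NonZero B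
      B-nonZero = pos⇒nonZero B

  bounded : ∀ {s} → Cauchy s →
    ∃[ B ] 0ℚ < B × ∃[ N ] ∀ m → N ℕ.≤ m → ∣ s m ∣ ≤ B
  bounded {s} c with c 1ℚ (positive⁻¹ 1ℚ)
  ... | N , h = 1ℚ + ∣ s N ∣ , +-pos (positive⁻¹ 1ℚ) (0≤∣p∣ (s N)) , N , λ m N≤m → begin
    ∣ s m ∣                ≡⟨ cong ∣_∣ (solve 2 (λ p q → p := (p :- q) :+ q) refl (s m) (s N)) ⟩
    ∣ (s m - s N) + s N ∣  ≤⟨ ∣p+q∣≤∣p∣+∣q∣ (s m - s N) (s N) ⟩
    ∣ s m - s N ∣ + ∣ s N ∣ ≤⟨ +-monoˡ-≤ ∣ s N ∣ (h m N N≤m ℕ.≤-refl) ⟩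
    1ℚ + ∣ s N ∣           ∎
    where open ≤-Reasoning

  cauchy-const : ∀ p → Cauchy (λ _ → p)
  cauchy-const p ε ε>0 = 0 , λ _ _ _ _ → begin
    ∣ p - p ∣  ≡⟨ cong ∣_∣ (+-inverseʳ p) ⟩
    0ℚ         <⟨ ε>0 ⟩
    ε          ∎
    where open ≤-Reasoning

  cauchy-+ : ∀ {s t} → Cauchy s → Cauchy t → Cauchy (λ m → s m + t m)
  cauchy-+ {s} {t} cs ct ε ε>0 with cs (ε * ½) (half-pos ε>0) | ct (ε * ½) (half-pos ε>0)
  ... | M , f | N , g = M ℕ.⊔ N , λ m n m≥ n≥ → begin
    ∣ s m + t m - (s n + t n) ∣       ≡⟨ cong ∣_∣ (solve 4 (λ a b c d →
                                          a :+ b :- (c :+ d) := (a :- c) :+ (b :- d))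
                                          refl (s m) (t m) (s n) (t n)) ⟩
    ∣ (s m - s n) + (t m - t n) ∣     ≤⟨ ∣p+q∣≤∣p∣+∣q∣ (s m - s n) (t m - t n) ⟩
    ∣ s m - s n ∣ + ∣ t m - t n ∣     ≤⟨ +-mono-≤ (f m n (⊔-l m≥) (⊔-l n≥))
                                                 (g m n (⊔-r {M} m≥) (⊔-r {M} n≥)) ⟩
    ε * ½ + ε * ½                     ≡⟨ half ε ⟩
    ε                                 ∎
    where open ≤-Reasoning

  ∣*∣-≤ : ∀ p q {a b} → 0ℚ ≤ a → ∣ p ∣ ≤ a → ∣ q ∣ ≤ b → ∣ p * q ∣ ≤ a * b
  ∣*∣-≤ p q {a} {b} a≥0 p≤a q≤b = subst (_≤ a * b) (sym (∣p*q∣≡∣p∣*∣q∣ p q))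
    (*-mono {∣ p ∣} {a} {∣ q ∣} {b} a≥0 (0≤∣p∣ q) p≤a q≤b)

  *-difference : ∀ a b c d → a * b - c * d ≡ (b - d) * a + (a - c) * d
  *-difference = solve 4 (λ a b c d →
    a :* b :- c :* d := (b :- d) :* a :+ (a :- c) :* d) refl

  cauchy-* : ∀ {s t} → Cauchy s → Cauchy t → Cauchy (λ m → s m * t m)
  cauchy-* {s} {t} cs ct ε ε>0 =
    let
      A , A>0 , M₁ , hA = bounded {s} cs
      B , B>0 , M₂ , hB = bounded {t} ct
      δ , δ>0 , δA      = divide (half-pos ε>0) A>0
      η , η>0 , ηB      = divide (half-pos ε>0) B>0
      M , f             = cs η η>0
      N , g             = ct δ δ>0
    in (M₁ ℕ.⊔ M₂) ℕ.⊔ (M ℕ.⊔ N) , λ m n m≥ n≥ → begin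
    ∣ s m * t m - s n * t n ∣
      ≡⟨ cong ∣_∣ (*-difference (s m) (t m) (s n) (t n)) ⟩
    ∣ (t m - t n) * s m + (s m - s n) * t n ∣
      ≤⟨ ∣p+q∣≤∣p∣+∣q∣ ((t m - t n) * s m) ((s m - s n) * t n) ⟩
    ∣ (t m - t n) * s m ∣ + ∣ (s m - s n) * t n ∣
      ≤⟨ +-mono-≤
           (∣*∣-≤ (t m - t n) (s m) (<⇒≤ δ>0)
             (g m n (⊔-r {M} (⊔-r {M₁ ℕ.⊔ M₂} m≥)) (⊔-r {M} (⊔-r {M₁ ℕ.⊔ M₂} n≥)))
             (hA m (⊔-l (⊔-l m≥))))
           (∣*∣-≤ (s m - s n) (t n) (<⇒≤ η>0)
             (f m n (⊔-l (⊔-r {M₁ ℕ.⊔ M₂} m≥)) (⊔-l (⊔-r {M₁ ℕ.⊔ M₂} n≥)))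
             (hB n (⊔-r {M₁} (⊔-l n≥)))) ⟩
    δ * A + η * B
      ≡⟨ cong₂ _+_ δA ηB ⟩
    ε * ½ + ε * ½
      ≡⟨ half ε ⟩
    ε ∎
    where open ≤-Reasoning

open Arithmetic

-- Total inverse on ℚ; the value at 0 affects only finitely many terms of a
-- sequence that is bounded away from 0.
inv : ℚ → ℚ
inv p with p ≟ 0ℚ
... | yes _   = 0ℚ
... | no p≢0 = (1/ p) {{≢-nonZero p≢0}}

module Inverses where

  inv-inverse : ∀ {p} → 0ℚ < p → inv p * p ≡ 1ℚ
  inv-inverse {p} p>0 with p ≟ 0ℚ
  ... | yes p≡0 = ⊥-elim (<⇒≢ p>0 (sym p≡0))
  ... | no p≢0  = *-inverseˡ p {{≢-nonZero p≢0}}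

  inv-pos : ∀ {p} → 0ℚ < p → 0ℚ < inv p
  inv-pos {p} p>0 with p ≟ 0ℚ
  ... | yes p≡0 = ⊥-elim (<⇒≢ p>0 (sym p≡0))
  ... | no p≢0  = positive⁻¹ ((1/ p) {{≢-nonZero p≢0}}) {{1/pos⇒pos p {{positive p>0}}}}

  inv-anti : ∀ {c p} → 0ℚ < c → c ≤ p → inv p ≤ inv c
  inv-anti {c} {p} c>0 c≤p = begin
    inv p                ≡⟨ sym (*-identityʳ (inv p)) ⟩
    inv p * 1ℚ           ≡⟨ cong (inv p *_) (sym (inv-inverse c>0)) ⟩
    inv p * (inv c * c)  ≤⟨ *-monoˡ-≤-nonNeg (inv p) {{nonNegative ip}}
                              (*-monoˡ-≤-nonNeg (inv c) {{nonNegative ic}} c≤p) ⟩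
    inv p * (inv c * p)  ≡⟨ solve 3 (λ a b p → a :* (b :* p) := b :* (a :* p))
                              refl (inv p) (inv c) p ⟩
    inv c * (inv p * p)  ≡⟨ cong (inv c *_) (inv-inverse p>0) ⟩
    inv c * 1ℚ           ≡⟨ *-identityʳ (inv c) ⟩
    inv c                ∎
    where
    open ≤-Reasoning
    p>0 : 0ℚ < p
    p>0 = <-≤-trans c>0 c≤p
    ip : 0ℚ ≤ inv p
    ip = <⇒≤ (inv-pos p>0)
    ic : 0ℚ ≤ inv c
    ic = <⇒≤ (inv-pos c>0)

  inv-difference : ∀ a b p q → a * (b * q) - b * (a * p) ≡ (q - p) * (a * b)
  inv-difference = solve 4 (λ a b p q →
    a :* (b :* q) :- b :* (a :* p) := (q :- p) :* (a :* b)) refl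

  cauchy-inv : ∀ x → Positiveᴿ x → Cauchy (λ m → inv (seq x m))
  cauchy-inv x (mkPositive c c>0 K hK) ε ε>0 =
    let
      δ , δ>0 , δcc = divide ε>0 (*-pos (inv-pos c>0) (inv-pos c>0))
      N , f         = cauchy x δ δ>0
    in K ℕ.⊔ N , λ m n m≥ n≥ →
    let
      s   = seq x
      c≤m = hK m (⊔-l m≥)
      c≤n = hK n (⊔-l n≥)
      m>0 = <-≤-trans c>0 c≤m
      n>0 = <-≤-trans c>0 c≤n
      im  = <⇒≤ (inv-pos m>0)
      i-n = <⇒≤ (inv-pos n>0)
    in begin
      ∣ inv (s m) - inv (s n) ∣
        ≡⟨ cong ∣_∣ (sym (cong₂ _-_ (*-identityʳ (inv (s m))) (*-identityʳ (inv (s n))))) ⟩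
      ∣ inv (s m) * 1ℚ - inv (s n) * 1ℚ ∣
        ≡⟨ cong₂ (λ u v → ∣ inv (s m) * u - inv (s n) * v ∣)
             (sym (inv-inverse n>0)) (sym (inv-inverse m>0)) ⟩
      ∣ inv (s m) * (inv (s n) * s n) - inv (s n) * (inv (s m) * s m) ∣
        ≡⟨ cong ∣_∣ (inv-difference (inv (s m)) (inv (s n)) (s m) (s n)) ⟩
      ∣ (s n - s m) * (inv (s m) * inv (s n)) ∣
        ≡⟨ ∣p*q∣≡∣p∣*∣q∣ (s n - s m) (inv (s m) * inv (s n)) ⟩
      ∣ s n - s m ∣ * ∣ inv (s m) * inv (s n) ∣
        ≡⟨ cong (∣ s n - s m ∣ *_) (0≤p⇒∣p∣≡p (*-nn im i-n)) ⟩
      ∣ s n - s m ∣ * (inv (s m) * inv (s n))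
        ≤⟨ *-mono (<⇒≤ δ>0) (*-nn im i-n) (f n m (⊔-r {K} n≥) (⊔-r {K} m≥))
             (*-mono (<⇒≤ (inv-pos c>0)) i-n (inv-anti c>0 c≤m) (inv-anti c>0 c≤n)) ⟩
      δ * (inv c * inv c)
        ≡⟨ δcc ⟩
      ε ∎
    where open ≤-Reasoning

open Inverses

infixl 6 _+ᴿ_
infixl 7 _*ᴿ_ _/ᴿ_
infixr 8 _^ᴿ_

fromℕ : ℕ → ℝ
fromℕ n .seq _  = + n / 1
fromℕ n .cauchy = cauchy-const (+ n / 1)

_+ᴿ_ : ℝ → ℝ → ℝ
(x +ᴿ y) .seq m  = seq x m + seq y m
(x +ᴿ y) .cauchy = cauchy-+ {seq x} {seq y} (cauchy x) (cauchy y)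

_*ᴿ_ : ℝ → ℝ → ℝ
(x *ᴿ y) .seq m  = seq x m * seq y m
(x *ᴿ y) .cauchy = cauchy-* {seq x} {seq y} (cauchy x) (cauchy y)

_/ᴿ_ : (x y : ℝ) → {{Positiveᴿ y}} → ℝ
(x /ᴿ y) .seq m          = seq x m * inv (seq y m)
_/ᴿ_ x y {{y>0}} .cauchy = cauchy-* {seq x} (cauchy x) (cauchy-inv y y>0)

_^ᴿ_ : ℝ → ℕ → ℝ
x ^ᴿ zero  = fromℕ 1
x ^ᴿ suc n = x *ᴿ x ^ᴿ n

½^_ : ℕ → ℚ
½^ zero  = 1ℚ
½^ suc m = ½ * ½^ m

module Dyadic where

  /1-suc : ∀ n → + suc n / 1 ≡ 1ℚ + + n / 1
  /1-suc n = toℚᵘ-injective (begin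
    toℚᵘ (+ suc n / 1)                ≈⟨ toℚᵘ-fromℚᵘ (ℚᵘ.mkℚᵘ (+ suc n) 0) ⟩
    ℚᵘ.mkℚᵘ (+ suc n) 0               ≈⟨ ℚᵘ.*≡* (cong (λ z → (1ℤ ℤ.+ z) ℤ.* 1ℤ) (sym (ℤ.*-identityʳ (+ n)))) ⟩
    ℚᵘ.1ℚᵘ ℚᵘ.+ ℚᵘ.mkℚᵘ (+ n) 0       ≈⟨ ℚᵘ.+-congʳ ℚᵘ.1ℚᵘ (ℚᵘ.≃-sym (toℚᵘ-fromℚᵘ (ℚᵘ.mkℚᵘ (+ n) 0))) ⟩
    toℚᵘ 1ℚ ℚᵘ.+ toℚᵘ (+ n / 1)       ≈⟨ ℚᵘ.≃-sym (toℚᵘ-homo-+ 1ℚ (+ n / 1)) ⟩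
    toℚᵘ (1ℚ + + n / 1)               ∎)
    where open ℚᵘ.≃-Reasoning

  /1-nn : ∀ n → 0ℚ ≤ + n / 1
  /1-nn n = nonNegative⁻¹ (+ n / 1) {{normalize-nonNeg n 1}}

  /1-pos : ∀ n → .{{ℕ.NonZero n}} → 0ℚ < + n / 1
  /1-pos n = positive⁻¹ (+ n / 1) {{normalize-pos n 1}}

  /1-mono : ∀ {m n} → m ℕ.≤ n → + m / 1 ≤ + n / 1
  /1-mono {n = n} ℕ.z≤n = /1-nn n
  /1-mono {suc m} {suc n} (ℕ.s≤s h) = subst₂ _≤_ (sym (/1-suc m)) (sym (/1-suc n))
    (+-monoʳ-≤ 1ℚ (/1-mono h))

  1/-anti : ∀ {m n} → .{{_ : ℕ.NonZero m}} → .{{_ : ℕ.NonZero n}} →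
            m ℕ.≤ n → 1ℤ / n ≤ 1ℤ / m
  1/-anti {suc m} {suc n} h = toℚᵘ-cancel-≤
    (ℚᵘ.≤-respˡ-≃ (ℚᵘ.≃-sym (toℚᵘ-fromℚᵘ (ℚᵘ.mkℚᵘ 1ℤ n)))
    (ℚᵘ.≤-respʳ-≃ (ℚᵘ.≃-sym (toℚᵘ-fromℚᵘ (ℚᵘ.mkℚᵘ 1ℤ m)))
    (ℚᵘ.*≤* (ℤ.*-monoˡ-≤-nonNeg 1ℤ (ℤ.+≤+ h)))))

  1/n-pos : ∀ n → .{{_ : ℕ.NonZero n}} → 0ℚ < 1ℤ / n
  1/n-pos n = positive⁻¹ (1ℤ / n) {{normalize-pos 1 n}}

  1/2* : ∀ n → .{{_ : ℕ.NonZero n}} → (1ℤ / (2 ℕ.* n)) {{ℕ.m*n≢0 2 n}} ≡ ½ * (1ℤ / n)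
  1/2* n@(suc k) = toℚᵘ-injective (begin
    toℚᵘ (1ℤ / (2 ℕ.* n))             ≈⟨ toℚᵘ-fromℚᵘ (ℚᵘ.mkℚᵘ 1ℤ _) ⟩
    ℚᵘ.mkℚᵘ 1ℤ 1 ℚᵘ.* ℚᵘ.mkℚᵘ 1ℤ k    ≈⟨ ℚᵘ.*-congˡ {ℚᵘ.mkℚᵘ 1ℤ 1} (ℚᵘ.≃-sym (toℚᵘ-fromℚᵘ (ℚᵘ.mkℚᵘ 1ℤ k))) ⟩
    toℚᵘ ½ ℚᵘ.* toℚᵘ (1ℤ / n)         ≈⟨ ℚᵘ.≃-sym (toℚᵘ-homo-* ½ (1ℤ / n)) ⟩
    toℚᵘ (½ * (1ℤ / n))               ∎)
    where open ℚᵘ.≃-Reasoning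

  ½^-pos : ∀ m → 0ℚ < ½^ m
  ½^-pos zero    = positive⁻¹ 1ℚ
  ½^-pos (suc m) = *-pos ½>0 (½^-pos m)

  ½^-nn : ∀ m → 0ℚ ≤ ½^ m
  ½^-nn m = <⇒≤ (½^-pos m)

  ½^-double : ∀ m → ½^ suc m + ½^ suc m ≡ ½^ m
  ½^-double m = solve 1 (λ h → con ½ :* h :+ con ½ :* h := h) refl (½^ m)

  ½^-step : ∀ m → ½^ suc m ≤ ½^ m
  ½^-step m = begin
    ½^ suc m             ≡⟨ sym (+-identityʳ (½^ suc m)) ⟩
    ½^ suc m + 0ℚ        ≤⟨ +-monoʳ-≤ (½^ suc m) (½^-nn (suc m)) ⟩
    ½^ suc m + ½^ suc m  ≡⟨ ½^-double m ⟩
    ½^ m                 ∎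
    where open ≤-Reasoning

  ½^-≤1 : ∀ m → ½^ m ≤ 1ℚ
  ½^-≤1 zero    = ≤-refl
  ½^-≤1 (suc m) = ≤-trans (½^-step m) (½^-≤1 m)

  ½^-small : ∀ m → + suc m / 1 * ½^ m ≤ 1ℚ
  ½^-small zero    = ≤-refl
  ½^-small (suc m) = begin
    + suc (suc m) / 1 * (½ * ½^ m)        ≡⟨ cong (_* (½ * ½^ m)) (/1-suc (suc m)) ⟩
    (1ℚ + + suc m / 1) * (½ * ½^ m)       ≡⟨ solve 2 (λ a h → (con 1ℚ :+ a) :* (con ½ :* h) :=
                                               con ½ :* (h :+ a :* h)) refl (+ suc m / 1) (½^ m) ⟩
    ½ * (½^ m + + suc m / 1 * ½^ m)       ≤⟨ *-monoˡ-≤-nonNeg ½ (+-mono-≤ (½^-≤1 m) (½^-small m)) ⟩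
    1ℚ                                    ∎
    where open ≤-Reasoning

  archimedean : ∀ ε → 0ℚ < ε → ∃[ N ] 1ℚ ≤ + N / 1 * ε
  archimedean (mkℚ (+ zero) _ _)       (*<* (ℤ.+<+ ()))
  archimedean (mkℚ (ℤ.-[1+ _ ]) _ _)   (*<* ())
  archimedean ε@(mkℚ (ℤ.+[1+ a ]) d _) _ = suc d , toℚᵘ-cancel-≤
    (ℚᵘ.≤-respʳ-≃ (ℚᵘ.≃-sym (toℚᵘ-homo-* (+ suc d / 1) ε))
    (ℚᵘ.≤-respʳ-≃ (ℚᵘ.*-congʳ {toℚᵘ ε} (ℚᵘ.≃-sym (toℚᵘ-fromℚᵘ (ℚᵘ.mkℚᵘ (+ suc d) 0))))
    (ℚᵘ.*≤* (ℤ.+≤+ (begin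
      1 ℕ.* suc (d ℕ.+ 0 ℕ.* suc d)  ≡⟨ ℕ.*-identityˡ _ ⟩
      suc (d ℕ.+ 0)                  ≡⟨ cong suc (ℕ.+-identityʳ d) ⟩
      suc d                          ≤⟨ ℕ.m≤m*n (suc d) (suc a) ⟩
      suc d ℕ.* suc a                ≡⟨ sym (ℕ.*-identityʳ _) ⟩
      suc d ℕ.* suc a ℕ.* 1          ∎)))))
    where open ℕ.≤-Reasoning

  small : ∀ ε → 0ℚ < ε → ∃[ N ] ∀ m → N ℕ.≤ m → ½^ m ≤ ε
  small ε ε>0 with archimedean ε ε>0
  ... | N , h = N , λ m N≤m → begin
    ½^ m                          ≡⟨ sym (*-identityʳ (½^ m)) ⟩
    ½^ m * 1ℚ                     ≤⟨ *-monoˡ-≤-nonNeg (½^ m) {{nonNegative (½^-nn m)}} h ⟩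
    ½^ m * (+ N / 1 * ε)          ≡⟨ solve 3 (λ h n e → h :* (n :* e) := n :* h :* e)
                                       refl (½^ m) (+ N / 1) ε ⟩
    + N / 1 * ½^ m * ε            ≤⟨ *-monoʳ-≤-nonNeg ε {{nonNegative (<⇒≤ ε>0)}}
                                      (*-monoʳ-≤-nonNeg (½^ m) {{nonNegative (½^-nn m)}}
                                        (/1-mono (ℕ.m≤n⇒m≤1+n N≤m))) ⟩
    + suc m / 1 * ½^ m * ε        ≤⟨ *-monoʳ-≤-nonNeg ε {{nonNegative (<⇒≤ ε>0)}} (½^-small m) ⟩
    1ℚ * ε                        ≡⟨ *-identityˡ ε ⟩
    ε                             ∎
    where open ≤-Reasoning

  module Geometric {s : ℕ → ℚ}
    (inc : ∀ m → s m ≤ s (suc m))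
    (dec : ∀ m → s (suc m) ≤ s m + ½^ m) where

    u : ℕ → ℚ
    u m = s m + (½^ m + ½^ m)

    u-dec : ∀ m → u (suc m) ≤ u m
    u-dec m = begin
      s (suc m) + (½^ suc m + ½^ suc m)  ≡⟨ cong (λ z → s (suc m) + z) (½^-double m) ⟩
      s (suc m) + ½^ m                   ≤⟨ +-monoˡ-≤ (½^ m) (dec m) ⟩
      s m + ½^ m + ½^ m                  ≡⟨ +-assoc (s m) (½^ m) (½^ m) ⟩
      u m                                ∎
      where open ≤-Reasoning

    s-mono : ∀ {m n} → m ℕ.≤′ n → s m ≤ s n
    s-mono ℕ.≤′-refl     = ≤-refl
    s-mono (ℕ.≤′-step h) = ≤-trans (s-mono h) (inc _)

    u-anti : ∀ {m n} → m ℕ.≤′ n → u n ≤ u m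
    u-anti ℕ.≤′-refl     = ≤-refl
    u-anti (ℕ.≤′-step h) = ≤-trans (u-dec _) (u-anti h)

    s≤u : ∀ m → s m ≤ u m
    s≤u m = subst (_≤ u m) (+-identityʳ (s m))
      (+-monoʳ-≤ (s m) (+-nn (½^-nn m) (½^-nn m)))

    isCauchy : Cauchy s
    isCauchy ε ε>0 =
      let N , h = small (ε * ½) (half-pos ε>0)
      in N , λ m n m≥ n≥ → ≤⇒close (one N (h N ℕ.≤-refl) m n m≥ n≥)
                                   (one N (h N ℕ.≤-refl) n m n≥ m≥)
      where
      one : ∀ N → ½^ N ≤ ε * ½ → ∀ m n → N ℕ.≤ m → N ℕ.≤ n → s m ≤ s n + ε
      one N h m n m≥ n≥ = begin
        s m                       ≤⟨ s≤u m ⟩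
        u m                       ≤⟨ u-anti {N} {m} (ℕ.≤⇒≤′ m≥) ⟩
        s N + (½^ N + ½^ N)       ≤⟨ +-mono-≤ (s-mono {N} {n} (ℕ.≤⇒≤′ n≥)) (+-mono-≤ h h) ⟩
        s n + (ε * ½ + ε * ½)     ≡⟨ cong (λ z → s n + z) (half ε) ⟩
        s n + ε                   ∎
        where open ≤-Reasoning

open Dyadic

-- ∑[ f ] m is the sum of f i over i < m
∑[_] : (ℕ → ℚ) → ℕ → ℚ
∑[ f ] zero    = 0ℚ
∑[ f ] (suc m) = ∑[ f ] m + f m

module Summation where

  ∑-cauchy : ∀ {f} → (∀ i → 0ℚ ≤ f i) → (∀ i → f i ≤ ½^ i) → Cauchy ∑[ f ]
  ∑-cauchy {f} f≥0 f≤ = Geometric.isCauchy {∑[ f ]}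
    (λ m → subst (_≤ ∑[ f ] m + f m) (+-identityʳ _) (+-monoʳ-≤ (∑[ f ] m) (f≥0 m)))
    (λ m → +-monoʳ-≤ (∑[ f ] m) (f≤ m))

open Summation

-- ln 2 = - ln (1 - 1/2) = ∑ over i ≥ 1 of 1 / (i 2^i)
ln2-term : ℕ → ℚ
ln2-term i = 1ℤ / suc i * ½^ suc i

module Ln2-bounds where

  ln2-term-pos : ∀ i → 0ℚ < ln2-term i
  ln2-term-pos i = *-pos (1/n-pos (suc i)) (½^-pos (suc i))

  ln2-term-≤ : ∀ i → ln2-term i ≤ ½^ i
  ln2-term-≤ i = begin
    1ℤ / suc i * ½^ suc i  ≤⟨ *-mono (nonNegative⁻¹ 1ℚ) (½^-nn (suc i))
                                (1/-anti {1} {suc i} (ℕ.s≤s ℕ.z≤n)) (½^-step i) ⟩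
    1ℚ * ½^ i              ≡⟨ *-identityˡ (½^ i) ⟩
    ½^ i                   ∎
    where open ≤-Reasoning

open Ln2-bounds

ln2 : ℝ
ln2 .seq    = ∑[ ln2-term ]
ln2 .cauchy = ∑-cauchy (λ i → <⇒≤ (ln2-term-pos i)) ln2-term-≤

-- e = ∑ over i ≥ 0 of 1 / i!
e-partial : ℕ → ℚ
e-partial zero    = 1ℚ
e-partial (suc m) = e-partial m + (1ℤ / (suc m !)) {{ℕ._!≢0 (suc m)}}

module Factorial-bounds where

  1/!-≤ : ∀ m → (1ℤ / (suc m !)) {{ℕ._!≢0 (suc m)}} ≤ ½^ m
  1/!-≤ zero    = ≤-refl
  1/!-≤ (suc m) = begin
    (1ℤ / (suc (suc m) !)) {{ℕ._!≢0 (suc (suc m))}}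
      ≤⟨ 1/-anti {2 ℕ.* suc m !} {{i₂}} {{ℕ._!≢0 (suc (suc m))}}
           (ℕ.*-monoˡ-≤ (suc m !) {2} {suc (suc m)} (ℕ.s≤s (ℕ.s≤s ℕ.z≤n))) ⟩
    (1ℤ / (2 ℕ.* suc m !)) {{i₂}}
      ≡⟨ 1/2* (suc m !) {{ℕ._!≢0 (suc m)}} ⟩
    ½ * (1ℤ / (suc m !)) {{ℕ._!≢0 (suc m)}}
      ≤⟨ *-monoˡ-≤-nonNeg ½ (1/!-≤ m) ⟩
    ½ * ½^ m ∎
    where
    open ≤-Reasoning
    i₂ : ℕ.NonZero (2 ℕ.* suc m !)
    i₂ = ℕ.m*n≢0 2 (suc m !) {{_}} {{ℕ._!≢0 (suc m)}}

open Factorial-bounds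

e : ℝ
e .seq    = e-partial
e .cauchy = Geometric.isCauchy {e-partial}
  (λ m → subst (_≤ e-partial (suc m)) (+-identityʳ _)
    (+-monoʳ-≤ (e-partial m) (<⇒≤ (1/n-pos (suc m !) {{ℕ._!≢0 (suc m)}}))))
  (λ m → +-monoʳ-≤ (e-partial m) (1/!-≤ m))

replaceIf²≤ : ℚ → ℚ → ℚ → ℚ
replaceIf²≤ p a c with c * c ≤? p
... | yes _ = c
... | no  _ = a

-- m steps of bisecting the interval [0, 1 + |p|], keeping the lower end point,
-- in search of the largest r ≥ 0 with r² ≤ p; the result is 0 if p ≤ 0.
bisect : ℚ → ℕ → ℚ
bisect p zero    = 0ℚ
bisect p (suc m) =
  replaceIf²≤ p (bisect p m) (bisect p m + (1ℚ + ∣ p ∣) * ½^ suc m)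

module Bisection where

  width : ℚ → ℕ → ℚ
  width p m = (1ℚ + ∣ p ∣) * ½^ m

  1+∣p∣>0 : ∀ p → 0ℚ < 1ℚ + ∣ p ∣
  1+∣p∣>0 p = +-pos (positive⁻¹ 1ℚ) (0≤∣p∣ p)

  width-pos : ∀ p m → 0ℚ < width p m
  width-pos p m = *-pos (1+∣p∣>0 p) (½^-pos m)

  width-double : ∀ p m → width p (suc m) + width p (suc m) ≡ width p m
  width-double p m = trans (sym (*-distribˡ-+ (1ℚ + ∣ p ∣) (½^ suc m) (½^ suc m)))
    (cong ((1ℚ + ∣ p ∣) *_) (½^-double m))

  replace-elim : ∀ {p a c} (P : ℚ → Set) →
    (c * c ≤ p → P c) → (p < c * c → P a) → P (replaceIf²≤ p a c)
  replace-elim {p} {a} {c} P f g with c * c ≤? p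
  ... | yes h = f h
  ... | no  h = g (≰⇒> h)

  bisect-nn : ∀ p m → 0ℚ ≤ bisect p m
  bisect-nn p zero    = ≤-refl
  bisect-nn p (suc m) = replace-elim {p} {bisect p m} {bisect p m + width p (suc m)} (0ℚ ≤_)
    (λ _ → +-nn {bisect p m} {width p (suc m)} (bisect-nn p m) (<⇒≤ (width-pos p (suc m))))
    (λ _ → bisect-nn p m)

  bisect-lower : ∀ p m → bisect p m ≡ 0ℚ ⊎ bisect p m * bisect p m ≤ p
  bisect-lower p zero    = inj₁ refl
  bisect-lower p (suc m) = replace-elim {p} {bisect p m} {bisect p m + width p (suc m)}
    (λ z → z ≡ 0ℚ ⊎ z * z ≤ p) inj₂ (λ _ → bisect-lower p m)

  bisect-upper : ∀ p m →
    p < (bisect p m + width p m) * (bisect p m + width p m)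
  bisect-upper p zero = begin-strict
    p                                              ≤⟨ p≤∣p∣ p ⟩
    ∣ p ∣                                          ≡⟨ solve 1 (λ a → a := con 0ℚ :+ a) refl ∣ p ∣ ⟩
    0ℚ + ∣ p ∣                                     <⟨ +-mono-<-≤ (positive⁻¹ 1ℚ) sq ⟩
    1ℚ + (∣ p ∣ + ∣ p ∣ + ∣ p ∣ * ∣ p ∣)           ≡⟨ solve 1 (λ a →
        con 1ℚ :+ (a :+ a :+ a :* a) :=
        (con 0ℚ :+ (con 1ℚ :+ a) :* con 1ℚ) :* (con 0ℚ :+ (con 1ℚ :+ a) :* con 1ℚ)) refl ∣ p ∣ ⟩
    (0ℚ + width p 0) * (0ℚ + width p 0)            ∎
    where
    open ≤-Reasoning
    sq : ∣ p ∣ ≤ ∣ p ∣ + ∣ p ∣ + ∣ p ∣ * ∣ p ∣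
    sq = begin
      ∣ p ∣                             ≡⟨ solve 1 (λ a → a := a :+ con 0ℚ :+ con 0ℚ) refl ∣ p ∣ ⟩
      ∣ p ∣ + 0ℚ + 0ℚ                   ≤⟨ +-mono-≤ (+-monoʳ-≤ ∣ p ∣ (0≤∣p∣ p)) (*-nn (0≤∣p∣ p) (0≤∣p∣ p)) ⟩
      ∣ p ∣ + ∣ p ∣ + ∣ p ∣ * ∣ p ∣     ∎
  bisect-upper p (suc m) = replace-elim {p} {bisect p m} {bisect p m + width p (suc m)}
    (λ z → p < (z + width p (suc m)) * (z + width p (suc m)))
    (λ _ → subst (λ z → p < z * z)
      (sym (trans (+-assoc (bisect p m) (width p (suc m)) (width p (suc m)))
        (cong (λ z → bisect p m + z) (width-double p m))))
      (bisect-upper p m))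
    (λ h → h)

  cauchy-√ : ∀ {s} → Cauchy s → Cauchy (λ m → bisect (s m) m)
  cauchy-√ {s} cs ε ε>0 =
    let
      B , B>0 , M , hB = bounded {s} cs
      δ , δ>0 , δB     = divide (half-pos ε>0) (+-pos (positive⁻¹ 1ℚ) (<⇒≤ B>0))
      K , hK           = cs (ε * ½ * (ε * ½)) (*-pos (half-pos ε>0) (half-pos ε>0))
      L , hL           = small δ δ>0
      one′ : ∀ m n → M ℕ.⊔ (K ℕ.⊔ L) ℕ.≤ m → M ℕ.⊔ (K ℕ.⊔ L) ℕ.≤ n →
             bisect (s m) m ≤ bisect (s n) n + ε
      one′ = λ m n m≥ n≥ → one {B} {δ} m n B>0 δB
        (hB n (⊔-l n≥)) (hL n (⊔-r {K} (⊔-r {M} n≥)))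
        (hK m n (⊔-l (⊔-r {M} m≥)) (⊔-l (⊔-r {M} n≥)))
    in M ℕ.⊔ (K ℕ.⊔ L) , λ m n m≥ n≥ → ≤⇒close (one′ m n m≥ n≥) (one′ n m n≥ m≥)
    where
    open ≤-Reasoning
    η : ℚ
    η = ε * ½
    η≥0 : 0ℚ ≤ η
    η≥0 = <⇒≤ (half-pos ε>0)
    one : ∀ {B δ} m n → 0ℚ < B → δ * (1ℚ + B) ≡ η → ∣ s n ∣ ≤ B → ½^ n ≤ δ →
          ∣ s m - s n ∣ ≤ η * η → bisect (s m) m ≤ bisect (s n) n + ε
    one {B} {δ} m n B>0 δB hB hL hK with bisect (s m) m ≤? bisect (s n) n + ε
    ... | yes h = h
    ... | no  h with bisect-lower (s m) m
    ...   | inj₁ r≡0 = ⊥-elim (h (begin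
              bisect (s m) m      ≡⟨ r≡0 ⟩
              0ℚ                  ≤⟨ +-nn (bisect-nn (s n) n) (<⇒≤ ε>0) ⟩
              bisect (s n) n + ε  ∎))
    ...   | inj₂ r² = ⊥-elim (<-irrefl refl (begin-strict
              s n + η * η
                <⟨ +-monoˡ-< (η * η) (bisect-upper (s n) n) ⟩
              (b + w) * (b + w) + η * η
                ≤⟨ +-monoˡ-≤ (η * η) (*-mono b+η≥0 b+w≥0 b+w≤b+η b+w≤b+η) ⟩
              (b + η) * (b + η) + η * η
                ≡⟨ sym (+-identityʳ ((b + η) * (b + η) + η * η)) ⟩
              (b + η) * (b + η) + η * η + 0ℚ
                ≤⟨ +-monoʳ-≤ ((b + η) * (b + η) + η * η) (+-nn (*-nn η≥0 b+η≥0) (*-nn η≥0 b+η≥0)) ⟩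
              (b + η) * (b + η) + η * η + (η * (b + η) + η * (b + η))
                ≡⟨ solve 2 (λ b x → (b :+ x) :* (b :+ x) :+ x :* x :+ (x :* (b :+ x) :+ x :* (b :+ x)) :=
                     (b :+ (x :+ x)) :* (b :+ (x :+ x))) refl b η ⟩
              (b + (η + η)) * (b + (η + η))
                ≡⟨ cong (λ z → (b + z) * (b + z)) (half ε) ⟩
              (b + ε) * (b + ε)
                ≤⟨ *-mono (bisect-nn (s m) m) (+-nn (bisect-nn (s n) n) (<⇒≤ ε>0))
                     (<⇒≤ (≰⇒> h)) (<⇒≤ (≰⇒> h)) ⟩
              bisect (s m) m * bisect (s m) m
                ≤⟨ r² ⟩
              s m
                ≤⟨ close⇒≤ hK ⟩
              s n + η * η ∎))
      where
      b w : ℚ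
      b = bisect (s n) n
      w = width (s n) n
      w≤η : w ≤ η
      w≤η = begin
        (1ℚ + ∣ s n ∣) * ½^ n  ≤⟨ *-mono (<⇒≤ (+-pos (positive⁻¹ 1ℚ) (<⇒≤ B>0))) (½^-nn n)
                                    (+-monoʳ-≤ 1ℚ hB) hL ⟩
        (1ℚ + B) * δ           ≡⟨ *-comm (1ℚ + B) δ ⟩
        δ * (1ℚ + B)           ≡⟨ δB ⟩
        η                      ∎
      b+w≤b+η : b + w ≤ b + η
      b+w≤b+η = +-monoʳ-≤ b w≤η
      b+w≥0 : 0ℚ ≤ b + w
      b+w≥0 = +-nn (bisect-nn (s n) n) (<⇒≤ (width-pos (s n) n))
      b+η≥0 : 0ℚ ≤ b + η
      b+η≥0 = +-nn (bisect-nn (s n) n) η≥0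

open Bisection

-- √ x is the square root of max (x, 0)
√ : ℝ → ℝ
√ x .seq m  = bisect (seq x m) m
√ x .cauchy = cauchy-√ {seq x} (cauchy x)

instance

  fromℕ-positive : ∀ {n} → .{{ℕ.NonZero n}} → Positiveᴿ (fromℕ n)
  fromℕ-positive {n} = mkPositive (+ n / 1) (/1-pos n) 0 (λ _ _ → ≤-refl)

  ln2-positive : Positiveᴿ ln2
  ln2-positive = mkPositive ½ ½>0 1 λ { (suc m) _ → lower m }
    where
    lower : ∀ m → ½ ≤ ∑[ ln2-term ] (suc m)
    lower zero    = ≤-refl
    lower (suc m) = subst (_≤ ∑[ ln2-term ] (suc (suc m))) (+-identityʳ ½)
      (+-mono-≤ (lower m) (<⇒≤ (ln2-term-pos (suc m))))

  +-positive : ∀ {x y} → {{Positiveᴿ x}} → {{Positiveᴿ y}} → Positiveᴿ (x +ᴿ y)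
  +-positive {{mkPositive a a>0 M f}} {{mkPositive b b>0 N g}} =
    mkPositive (a + b) (+-mono-< a>0 b>0) (M ℕ.⊔ N)
      (λ m m≥ → +-mono-≤ (f m (⊔-l m≥)) (g m (⊔-r {M} m≥)))

  *-positive : ∀ {x y} → {{Positiveᴿ x}} → {{Positiveᴿ y}} → Positiveᴿ (x *ᴿ y)
  *-positive {{mkPositive a a>0 M f}} {{mkPositive b b>0 N g}} =
    mkPositive (a * b) (*-pos a>0 b>0) (M ℕ.⊔ N)
      (λ m m≥ → *-mono (≤-trans (<⇒≤ a>0) (f m (⊔-l m≥))) (<⇒≤ b>0)
        (f m (⊔-l m≥)) (g m (⊔-r {M} m≥)))

------------------------------------------------------------------------
-- Hypergraphs on the vertex set Fin n.  A set of edges is given by a list,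
-- of which only the membership relation matters.

allSubsets : ∀ n → List (Subset n)
allSubsets zero    = [] ∷ []
allSubsets (suc n) = map (outside ∷_) (allSubsets n) ++ map (inside ∷_) (allSubsets n)

E[K] : ∀ n k → List (Subset n)
E[K] n k = filter (λ A → size A ℕ.≟ k) (allSubsets n)

Independent : ∀ {n} → List (Subset n) → Pred (Fin n) 0ℓ → Set
Independent F I = ∀ {A} → A ∈ F → ¬ (∀ {v} → v ∈ₛ A → I v)

-- Classes of a colouring may be empty; this does not affect the least r.
Colourable : ∀ {n} → List (Subset n) → ℕ → Set
Colourable {n} F r =
  ∃ λ (φ : Fin n → Fin r) → ∀ i → Independent F (λ v → φ v ≡ i)

IsChromaticNumber : ∀ {n} → List (Subset n) → ℕ → Set
IsChromaticNumber F r = Colourable F r × (∀ s → Colourable F s → r ℕ.≤ s)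

TwoColourable : ∀ {n} → List (Subset n) → Set
TwoColourable F = ∃[ r ] IsChromaticNumber F r × r ℕ.≤ 2

NonTwoColourable : ∀ {n} → List (Subset n) → Set
NonTwoColourable F = ∃[ r ] IsChromaticNumber F r × r ℕ.> 2

NC₂ : ∀ n k → List (Subset n) → Set
NC₂ n k F = F ⊆ E[K] n k × NonTwoColourable F

------------------------------------------------------------------------
-- The (1:q) Waiter–Client game.  The board is a list without repetitions.

module WaiterClient {X : Set} (board : List X) (q : ℕ) where

  record Offer (free : List X) : Set where
    field
      offered remaining : List X
      quantity          : length offered ≡ suc q
      split             : free ↭ offered ++ remaining

  open Offer public

  -- Partial plays, indexed by the free elements and by Client's elements;
  -- Waiter owns all other elements of the board.
  data History : (free client : List X) → Set where
    start : History board []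
    round : ∀ {free client} → History free client →
            (o : Offer free) → ∀ {x} → x ∈ offered o →
            History (remaining o) (x ∷ client)
    last  : ∀ {free client} → History free client →
            1 ℕ.≤ length free → length free ℕ.< suc q →
            History [] client

  WaiterStrategy : Set
  WaiterStrategy = ∀ {free client} → History free client →
                   suc q ℕ.≤ length free → Offer free

  ClientStrategy : Set
  ClientStrategy = ∀ {free client} → History free client →
                   (o : Offer free) → ∃[ x ] x ∈ offered o

  WaiterFollows : WaiterStrategy → ∀ {free client} → History free client → Set
  WaiterFollows σ start         = ⊤
  WaiterFollows σ (round h o _) = WaiterFollows σ h × ∃[ enough ] o ≡ σ h enough
  WaiterFollows σ (last h _ _)  = WaiterFollows σ h

  ClientFollows : ClientStrategy → ∀ {free client} → History free client → Set
  ClientFollows τ start               = ⊤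
  ClientFollows τ (round h o {x} x∈o) = ClientFollows τ h × (x , x∈o) ≡ τ h o
  ClientFollows τ (last h _ _)        = ClientFollows τ h

  HasWinningSet : (List X → Set) → List X → Set
  HasWinningSet 𝓕 client = ∃[ F ] 𝓕 F × F ⊆ client

  WinningForWaiter : (List X → Set) → WaiterStrategy → Set
  WinningForWaiter 𝓕 σ = ∀ {client} (h : History [] client) →
    WaiterFollows σ h → HasWinningSet 𝓕 client

  WinningForClient : (List X → Set) → ClientStrategy → Set
  WinningForClient 𝓕 τ = ∀ {client} (h : History [] client) →
    ClientFollows τ h → ¬ HasWinningSet 𝓕 client

open WaiterClient public

ForcesNonTwoColourable : ∀ n k q → WaiterStrategy (E[K] n k) q → Set
ForcesNonTwoColourable n k q σ =
  ∀ {client} (h : History (E[K] n k) q [] client) →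
  WaiterFollows (E[K] n k) q σ h → NonTwoColourable client

KeepsTwoColourable : ∀ n k q → ClientStrategy (E[K] n k) q → Set
KeepsTwoColourable n k q τ =
  ∀ {free client} (h : History (E[K] n k) q free client) →
  ClientFollows (E[K] n k) q τ h → TwoColourable client

{-# OPTIONS --safe #-}

-- Waiter.  If every set of at least n/2 vertices contains an edge of Client,
-- then so does a colour class of every 2-colouring.  Give a vertex set S that
-- contains no edge of Client the weight λ^(-j), where λ = 1 + 1/(3q) and j is
-- the number of free edges inside S.  If Waiter offers q + 1 edges whose degrees
-- (total weights of the sets S around them) agree up to a factor 2, then the
-- weight lost through Client's edge compensates the growth caused by the q edges
-- of Waiter.  Such edges exist unless the sum of all degrees is at most 2q times
-- the total weight; but a small total weight forces more than 2q free edges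
-- inside every remaining S.  The hypothesis gives 2q(2n + 1) ≤ C(⌈n/2⌉, k),
-- which makes the initial total weight small enough.
--
-- Client.  By a theorem of Seymour, a hypergraph in which every t ≥ 1 edges
-- cover more than t vertices is 2-colourable.  So Client only has to avoid t
-- edges inside a set of t vertices, which he does by always minimising the
-- expected number of such configurations under random play.  Initially this
-- number is at most
-- ∑ C(n, t) C(C(t, k), t) / (q + 1)^t, and C(m, t) ≤ m^t / t! ≤ (3m / t)^t
-- together with 18 C(n, k) ≤ q n bounds the t-th term by 2^(-t).

module Submission where

-- Client picks the edge, so Waiter must be safe against the answer of least degree; this is why the
-- offered degrees may differ only by a bounded factor, and that factor 2 fixes the other constants.
-- If Waiter's q edges have degree at most B and Client's has degree at least B/2, the total weight
-- cannot grow, provided that losing m edges multiplies a weight by at most 1 + m/(2q). The choice λ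
-- = 1 + 1/(3q) meets this for all m ≤ q and still has λ^(4q) > 2. Hence 4q further edges per vertex
-- pay for the at most 2^n sets S, which explains the bound 2q + 4qn. On Client's side the obstacle
-- is that non-2-colourability is not given by a countable list of small configurations over which
-- an expectation could be taken. Seymour's theorem supplies configurations with as many edges as
-- vertices, few enough for a first-moment estimate. Both potentials are scaled by a power of their
-- base and so are natural numbers. Real numbers enter only through the two thresholds, each of
-- which is evaluated at one sufficiently late index of the Cauchy sequences.

-- Finite sums over lists, and elements of comparable value.

module Sums where

  open import Data.Nat.Base
  open import Data.Nat.Properties
  open import Data.Nat.Tactic.RingSolver using (solve-∀)
  open import Data.List.Base using (List; []; _∷_; _++_; map; filter; length; take; drop)
  open import Data.List.Properties using (length-take; take++drop≡id; ++-assoc)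
  open import Data.List.Membership.Propositional using (_∈_)
  open import Data.List.Relation.Unary.Any using (here; there)
  open import Data.List.Relation.Binary.Permutation.Propositional as Perm using (_↭_; prep; ↭-sym; ↭-trans; ↭-refl)
  open import Data.List.Relation.Binary.Permutation.Propositional.Properties using (shift; ++-comm; ++⁺ʳ)
  open import Data.List.Membership.Propositional.Properties using (∈-filter⁻; ∈-∃++)
  open import Data.Product using (∃-syntax; _,_; proj₁; proj₂)
  open import Data.Sum.Base as Sum using (_⊎_; inj₁; inj₂)
  open import Function using (_∘_)
  open import Relation.Nullary using (yes; no; Dec)
  open import Relation.Nullary.Decidable using (¬?)
  open import Relation.Unary using (Decidable)
  open import Relation.Binary.PropositionalEquality

  private variable
    A B : Set

  ∑ : (A → ℕ) → List A → ℕ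
  ∑ f []       = 0
  ∑ f (x ∷ xs) = f x + ∑ f xs

  ∑-mono : ∀ {f g : A → ℕ} xs → (∀ {x} → x ∈ xs → f x ≤ g x) → ∑ f xs ≤ ∑ g xs
  ∑-mono []       _ = z≤n
  ∑-mono (x ∷ xs) h = +-mono-≤ (h (here refl)) (∑-mono xs (h ∘ there))

  ∑-cong : ∀ {f g : A → ℕ} xs → (∀ {x} → x ∈ xs → f x ≡ g x) → ∑ f xs ≡ ∑ g xs
  ∑-cong []       _ = refl
  ∑-cong (x ∷ xs) h = cong₂ _+_ (h (here refl)) (∑-cong xs (h ∘ there))

  ∑-+ : ∀ (f g : A → ℕ) xs → ∑ (λ x → f x + g x) xs ≡ ∑ f xs + ∑ g xs
  ∑-+ f g []       = refl
  ∑-+ f g (x ∷ xs) = trans (cong (f x + g x +_) (∑-+ f g xs)) (interchange (f x) (g x) _ _)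
    where
    interchange : ∀ a b c d → a + b + (c + d) ≡ a + c + (b + d)
    interchange = solve-∀

  ∑-*ˡ : ∀ c (f : A → ℕ) xs → ∑ (λ x → c * f x) xs ≡ c * ∑ f xs
  ∑-*ˡ c f []       = sym (*-zeroʳ c)
  ∑-*ˡ c f (x ∷ xs) = trans (cong (c * f x +_) (∑-*ˡ c f xs)) (sym (*-distribˡ-+ c (f x) _))

  ∑-*ʳ : ∀ c (f : A → ℕ) xs → ∑ (λ x → f x * c) xs ≡ ∑ f xs * c
  ∑-*ʳ c f []       = refl
  ∑-*ʳ c f (x ∷ xs) = trans (cong (f x * c +_) (∑-*ʳ c f xs)) (sym (*-distribʳ-+ c (f x) _))

  ∑-zero : ∀ (xs : List A) → ∑ (λ _ → 0) xs ≡ 0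
  ∑-zero []       = refl
  ∑-zero (_ ∷ xs) = ∑-zero xs

  ∑-swap : ∀ (f : A → B → ℕ) xs ys → ∑ (λ x → ∑ (f x) ys) xs ≡ ∑ (λ y → ∑ (λ x → f x y) xs) ys
  ∑-swap f []       ys = sym (∑-zero ys)
  ∑-swap f (x ∷ xs) ys = trans (cong (∑ (f x) ys +_) (∑-swap f xs ys)) (sym (∑-+ (f x) _ ys))

  ∑-++ : ∀ (f : A → ℕ) xs ys → ∑ f (xs ++ ys) ≡ ∑ f xs + ∑ f ys
  ∑-++ f []       ys = refl
  ∑-++ f (x ∷ xs) ys = trans (cong (f x +_) (∑-++ f xs ys)) (sym (+-assoc (f x) _ _))

  ∑-↭ : ∀ (f : A → ℕ) {xs ys} → xs ↭ ys → ∑ f xs ≡ ∑ f ys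
  ∑-↭ f Perm.refl              = refl
  ∑-↭ f (Perm.prep x p)        = cong (f x +_) (∑-↭ f p)
  ∑-↭ f (Perm.swap x y p)      = trans (cong (λ z → f x + (f y + z)) (∑-↭ f p)) (exchange (f x) (f y) _)
    where
    exchange : ∀ a b c → a + (b + c) ≡ b + (a + c)
    exchange = solve-∀
  ∑-↭ f (Perm.trans p q)       = trans (∑-↭ f p) (∑-↭ f q)

  ∑-bound : ∀ {f : A → ℕ} {b} xs → (∀ {x} → x ∈ xs → f x ≤ b) → ∑ f xs ≤ length xs * b
  ∑-bound []       _ = z≤n
  ∑-bound (x ∷ xs) h = +-mono-≤ (h (here refl)) (∑-bound xs (h ∘ there))

  term≤∑ : ∀ (f : A → ℕ) {x xs} → x ∈ xs → f x ≤ ∑ f xs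
  term≤∑ f (here refl)          = m≤m+n (f _) _
  term≤∑ f (there {x = y} x∈xs) = ≤-trans (term≤∑ f x∈xs) (m≤n+m _ (f y))

  ∑-map : ∀ (f : B → ℕ) (g : A → B) xs → ∑ f (map g xs) ≡ ∑ (f ∘ g) xs
  ∑-map f g []       = refl
  ∑-map f g (x ∷ xs) = cong (f (g x) +_) (∑-map f g xs)

  length≡∑ : ∀ (xs : List A) → length xs ≡ ∑ (λ _ → 1) xs
  length≡∑ []       = refl
  length≡∑ (_ ∷ xs) = cong suc (length≡∑ xs)

  ∈⇒↭ : ∀ {x : A} {xs} → x ∈ xs → ∃[ ys ] xs ↭ x ∷ ys
  ∈⇒↭ x∈xs with ∈-∃++ x∈xs
  ... | us , vs , refl = us ++ vs , shift _ us vs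

  filter-complement-↭ : ∀ {P : A → Set} (P? : Decidable P) xs →
    xs ↭ filter P? xs ++ filter (¬? ∘ P?) xs
  filter-complement-↭ P? []       = ↭-refl
  filter-complement-↭ P? (x ∷ xs) with P? x
  ... | yes _ = prep x (filter-complement-↭ P? xs)
  ... | no  _ = ↭-trans (prep x (filter-complement-↭ P? xs)) (↭-sym (shift x (filter P? xs) _))

  ∈-take : ∀ n {x : A} xs → x ∈ take n xs → x ∈ xs
  ∈-take (suc n) (_ ∷ _)  (here eq)  = here eq
  ∈-take (suc n) (_ ∷ xs) (there x∈) = there (∈-take n xs x∈)

  -- Comparability up to a factor 2 is expressed through a common `bound`, since the round estimate
  -- needs a single number above all degrees of Waiter's elements and at most twice the degree of
  -- Client's.
  record Balanced (d : A → ℕ) (m : ℕ) (xs : List A) : Set where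
    field
      chosen others : List A
      size-chosen   : length chosen ≡ m
      arrangement   : xs ↭ chosen ++ others
      bound         : ℕ
      ≤bound        : ∀ {x} → x ∈ chosen → d x ≤ bound
      bound≤double  : ∀ {x} → x ∈ chosen → bound ≤ 2 * d x

  open Balanced

  2*<⇒≤half : ∀ d b → 2 * d < b → d ≤ ⌊ b /2⌋
  2*<⇒≤half d b h = subst (_≤ ⌊ b /2⌋)
    (trans (cong ⌊_/2⌋ (cong (d +_) (+-identityʳ d))) (sym (n≡⌊n+n/2⌋ d))) (⌊n/2⌋-mono (<⇒≤ h))

  2*half≤ : ∀ b → 2 * ⌊ b /2⌋ ≤ b
  2*half≤ b = ≤-trans
    (+-monoʳ-≤ ⌊ b /2⌋ (≤-trans (≤-reflexive (+-identityʳ _)) (⌊n/2⌋≤⌈n/2⌉ b)))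
    (≤-reflexive (⌊n/2⌋+⌈n/2⌉≡n b))

  -- If no dyadic range of values contains more than q elements, then the sum is
  -- dominated by the geometric series q b + q b / 2 + ….
  balanced⊎small-∑ : ∀ (d : A → ℕ) q fuel b xs → b ≤ fuel → (∀ {x} → x ∈ xs → d x ≤ b) →
    Balanced d (suc q) xs ⊎ ∑ d xs ≤ 2 * q * b
  balanced⊎small-∑ d q fuel zero xs _ d≤b =
    inj₂ (subst (∑ d xs ≤_) (trans (*-zeroʳ (length xs)) (sym (*-zeroʳ (2 * q)))) (∑-bound xs d≤b))
  balanced⊎small-∑ {A} d q (suc fuel) b@(suc b′) xs (s≤s b≤fuel) d≤b = split (suc q ≤? length hi)
    where
    open ≤-Reasoning
    big? : Decidable (λ (x : A) → b ≤ 2 * d x)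
    big? x = b ≤? 2 * d x
    hi lo : List A
    hi = filter big? xs
    lo = filter (¬? ∘ big?) xs
    xs↭hi++lo : xs ↭ hi ++ lo
    xs↭hi++lo = filter-complement-↭ big? xs
    hi⊆xs : ∀ {x} → x ∈ hi → x ∈ xs
    hi⊆xs x∈ = proj₁ (∈-filter⁻ big? {xs = xs} x∈)
    from-hi : suc q ≤ length hi → Balanced d (suc q) xs
    from-hi q<hi = record
      { chosen       = take (suc q) hi
      ; others       = drop (suc q) hi ++ lo
      ; size-chosen  = trans (length-take (suc q) hi) (m≤n⇒m⊓n≡m q<hi)
      ; arrangement  = subst (xs ↭_)
          (trans (cong (_++ lo) (sym (take++drop≡id (suc q) hi))) (++-assoc (take (suc q) hi) _ lo))
          xs↭hi++lo
      ; bound        = b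
      ; ≤bound       = λ x∈ → d≤b (hi⊆xs (∈-take (suc q) hi x∈))
      ; bound≤double = λ x∈ → proj₂ (∈-filter⁻ big? {xs = xs} (∈-take (suc q) hi x∈))
      }
    from-lo : Balanced d (suc q) lo → Balanced d (suc q) xs
    from-lo β = record
      { chosen       = chosen β
      ; others       = others β ++ hi
      ; size-chosen  = size-chosen β
      ; arrangement  = ↭-trans xs↭hi++lo (↭-trans (++-comm hi lo)
          (subst (lo ++ hi ↭_) (++-assoc (chosen β) _ _) (++⁺ʳ hi (arrangement β))))
      ; bound        = bound β
      ; ≤bound       = ≤bound β
      ; bound≤double = bound≤double β
      }
    regroup : ∀ q b h → q * b + 2 * q * h ≡ q * (b + 2 * h)
    regroup = solve-∀
    double : ∀ q b → q * (b + b) ≡ 2 * q * b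
    double = solve-∀
    small-∑ : length hi ≤ q → ∑ d lo ≤ 2 * q * ⌊ b /2⌋ → ∑ d xs ≤ 2 * q * b
    small-∑ hi≤q small = begin
      ∑ d xs                          ≡⟨ ∑-↭ d xs↭hi++lo ⟩
      ∑ d (hi ++ lo)                  ≡⟨ ∑-++ d hi lo ⟩
      ∑ d hi + ∑ d lo                 ≤⟨ +-mono-≤ (≤-trans (∑-bound hi (d≤b ∘ hi⊆xs)) (*-monoˡ-≤ b hi≤q)) small ⟩
      q * b + 2 * q * ⌊ b /2⌋         ≡⟨ regroup q b ⌊ b /2⌋ ⟩
      q * (b + 2 * ⌊ b /2⌋)           ≤⟨ *-monoʳ-≤ q (+-monoʳ-≤ b (2*half≤ b)) ⟩
      q * (b + b)                     ≡⟨ double q b ⟩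
      2 * q * b                       ∎
    split : Dec (suc q ≤ length hi) → Balanced d (suc q) xs ⊎ ∑ d xs ≤ 2 * q * b
    split (yes q<hi) = inj₁ (from-hi q<hi)
    split (no  q≮hi) = Sum.map from-lo (small-∑ (≤-pred (≰⇒> q≮hi)))
      (balanced⊎small-∑ d q fuel ⌊ b /2⌋ lo (≤-trans (s≤s⁻¹ (⌊n/2⌋<n b′)) b≤fuel)
        (λ x∈ → 2*<⇒≤half (d _) b (≰⇒> (proj₂ (∈-filter⁻ (¬? ∘ big?) {xs = xs} x∈)))))

-- Waiter's potential: forcing Client to hit every set of a family.

module WaiterGame where

  open import Data.Bool.Base using (Bool; true; false; if_then_else_)
  open import Data.Nat.Base
  open import Data.Nat.Properties
  open import Data.Nat.Tactic.RingSolver using (solve-∀)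
  open import Data.List.Base using (List; []; _∷_; _++_; length; take; drop)
  open import Data.List.Properties using (length-take; take++drop≡id; length-++)
  open import Data.List.Membership.Propositional using (_∈_)
  open import Data.List.Relation.Unary.Any using (here; there)
  open import Data.List.Relation.Binary.Permutation.Propositional using (_↭_; ↭-reflexive; ↭-sym; ↭-trans)
  open import Data.List.Relation.Binary.Permutation.Propositional.Properties using (++⁺ʳ; ↭-length; ∈-resp-↭)
  open import Data.Product using (∃-syntax; _×_; _,_; proj₂)
  open import Data.Sum.Base using (_⊎_; inj₁; inj₂)
  open import Function using (_∘_)
  open import Relation.Nullary using (yes; no; contradiction)
  open import Relation.Binary.PropositionalEquality
  open import Defs
  open Sums

  -- (1 + 1 / 3q)^m ≤ 1 + m / 2q bounds the factor by which the weight of a set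
  -- grows when Waiter claims m of its elements.
  truncated-binomial : ∀ q m → 1 ≤ q → m ≤ q →
    2 * q * suc (3 * q) ^ m ≤ (2 * q + m) * (3 * q) ^ m
  truncated-binomial q zero    1≤q _ = ≤-reflexive (cong (_* 1) (sym (+-identityʳ (2 * q))))
  truncated-binomial q (suc m) 1≤q m<q = begin
    2 * q * (b * b ^ m)              ≡⟨ x∙yz≈y∙xz (2 * q) b (b ^ m) ⟩
    b * (2 * q * b ^ m)              ≤⟨ *-monoʳ-≤ b (truncated-binomial q m 1≤q (<⇒≤ m<q)) ⟩
    b * ((2 * q + m) * c ^ m)        ≡⟨ *-assoc b (2 * q + m) (c ^ m) ⟨
    b * (2 * q + m) * c ^ m          ≤⟨ *-monoˡ-≤ (c ^ m) step ⟩
    (2 * q + suc m) * c * c ^ m      ≡⟨ *-assoc (2 * q + suc m) c (c ^ m) ⟩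
    (2 * q + suc m) * (c * c ^ m)    ∎
    where
    open ≤-Reasoning
    b c : ℕ
    b = suc (3 * q)
    c = 3 * q
    x∙yz≈y∙xz : ∀ x y z → x * (y * z) ≡ y * (x * z)
    x∙yz≈y∙xz = solve-∀
    expand₁ : ∀ q m → suc (3 * q) * (2 * q + m) ≡ 3 * q * (2 * q + m) + (2 * q + m)
    expand₁ = solve-∀
    expand₂ : ∀ q m → 3 * q * (2 * q + m) + (2 * q + q) ≡ (2 * q + suc m) * (3 * q)
    expand₂ = solve-∀
    step : b * (2 * q + m) ≤ (2 * q + suc m) * c
    step = begin
      b * (2 * q + m)                    ≡⟨ expand₁ q m ⟩
      3 * q * (2 * q + m) + (2 * q + m)  ≤⟨ +-monoʳ-≤ (3 * q * (2 * q + m)) (+-monoʳ-≤ (2 * q) (<⇒≤ m<q)) ⟩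
      3 * q * (2 * q + m) + (2 * q + q)  ≡⟨ expand₂ q m ⟩
      (2 * q + suc m) * c                ∎

  -- The first two terms of the binomial expansion of the right-hand side, in a form free of
  -- division.
  bernoulli : ∀ c n → c ^ n * (c + suc n) ≤ suc c ^ suc n
  bernoulli c zero    = ≤-reflexive (p c)
    where
    p : ∀ c → 1 * (c + 1) ≡ suc c * 1
    p = solve-∀
  bernoulli c (suc n) = begin
    c * c ^ n * (c + suc (suc n))            ≡⟨ p₁ c (c ^ n) n ⟩
    c ^ n * (c * c + c * n + 2 * c)          ≤⟨ *-monoʳ-≤ (c ^ n) (m≤m+n _ (suc n)) ⟩
    c ^ n * (c * c + c * n + 2 * c + suc n)  ≡⟨ p₂ c (c ^ n) n ⟩
    suc c * (c ^ n * (c + suc n))            ≤⟨ *-monoʳ-≤ (suc c) (bernoulli c n) ⟩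
    suc c * suc c ^ suc n                    ∎
    where
    open ≤-Reasoning
    p₁ : ∀ c x n → c * x * (c + suc (suc n)) ≡ x * (c * c + c * n + 2 * c)
    p₁ = solve-∀
    p₂ : ∀ c x n → x * (c * c + c * n + 2 * c + suc n) ≡ suc c * (x * (c + suc n))
    p₂ = solve-∀

  indicator : Bool → ℕ
  indicator b = if b then 1 else 0

  -- The elements of I name the sets that Client is forced to hit; R i x decides
  -- whether x lies in the set i.  A set not yet hit with j free elements has
  -- weight (3q / (3q + 1))^j, scaled by (3q + 1)^M to make it an integer.
  module Transversal {X I : Set} (R : I → X → Bool) (family : List I)
                     (board : List X) (q : ℕ) (1≤q : 1 ≤ q) where

    M b c : ℕ
    M = length board
    b = suc (3 * q)
    c = 3 * q

    c>0 : 1 ≤ c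
    c>0 = ≤-trans 1≤q (m≤m+n q _)

    instance
      c≢0 : NonZero c
      c≢0 = >-nonZero c>0

    w : ℕ → ℕ
    w j = b ^ (M ∸ j) * c ^ j

    w>0 : ∀ j → 1 ≤ w j
    w>0 j = *-mono-≤ (m^n>0 b (M ∸ j)) (m^n>0 c j)

    split-M : ∀ j m → j + m ≤ M → M ∸ j ≡ m + (M ∸ (j + m))
    split-M j m h = begin
      M ∸ j                      ≡⟨ m+[n∸m]≡n {m} {M ∸ j} (m+n≤o⇒n≤o∸m j h) ⟨
      m + (M ∸ j ∸ m)            ≡⟨ cong (m +_) (∸-+-assoc M j m) ⟩
      m + (M ∸ (j + m))          ∎
      where
      open ≡-Reasoning
      m+n≤o⇒n≤o∸m : ∀ a {b d} → a + b ≤ d → b ≤ d ∸ a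
      m+n≤o⇒n≤o∸m a {b} {d} h = m+n≤o⇒m≤o∸n b (subst (_≤ d) (+-comm a b) h)

    -- The growth factor is bounded linearly in `m` so that, summed over the family, the total
    -- increase becomes a sum of degrees.
    w-step : ∀ j m → m ≤ q → j + m ≤ M → 2 * q * w j ≤ (2 * q + m) * w (j + m)
    w-step j m m≤q h = begin
      2 * q * (b ^ (M ∸ j) * c ^ j)           ≡⟨ cong (λ z → 2 * q * (b ^ z * c ^ j)) (split-M j m h) ⟩
      2 * q * (b ^ (m + s) * c ^ j)           ≡⟨ cong (λ z → 2 * q * (z * c ^ j)) (^-distribˡ-+-* b m s) ⟩
      2 * q * (b ^ m * b ^ s * c ^ j)         ≡⟨ p₁ (2 * q) (b ^ m) (b ^ s) (c ^ j) ⟩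
      2 * q * b ^ m * (b ^ s * c ^ j)         ≤⟨ *-monoˡ-≤ (b ^ s * c ^ j) (truncated-binomial q m 1≤q m≤q) ⟩
      (2 * q + m) * c ^ m * (b ^ s * c ^ j)   ≡⟨ p₂ (2 * q + m) (c ^ m) (b ^ s) (c ^ j) ⟩
      (2 * q + m) * (b ^ s * (c ^ j * c ^ m)) ≡⟨ cong (λ z → (2 * q + m) * (b ^ s * z)) (^-distribˡ-+-* c j m) ⟨
      (2 * q + m) * w (j + m)                 ∎
      where
      open ≤-Reasoning
      s : ℕ
      s = M ∸ (j + m)
      p₁ : ∀ a x y z → a * (x * y * z) ≡ a * x * (y * z)
      p₁ = solve-∀
      p₂ : ∀ a x y z → a * x * (y * z) ≡ a * (y * (z * x))
      p₂ = solve-∀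

    w-anti : ∀ {i j} → i ≤ j → j ≤ M → w j ≤ w i
    w-anti {i} {j} i≤j j≤M with m≤n⇒∃[o]m+o≡n i≤j
    ... | m , refl = begin
      b ^ s * c ^ (i + m)         ≡⟨ cong (b ^ s *_) (^-distribˡ-+-* c i m) ⟩
      b ^ s * (c ^ i * c ^ m)     ≤⟨ *-monoʳ-≤ (b ^ s) (*-monoʳ-≤ (c ^ i) (^-monoˡ-≤ m (n≤1+n c))) ⟩
      b ^ s * (c ^ i * b ^ m)     ≡⟨ p (b ^ s) (c ^ i) (b ^ m) ⟩
      b ^ m * b ^ s * c ^ i       ≡⟨ cong (_* c ^ i) (^-distribˡ-+-* b m s) ⟨
      b ^ (m + s) * c ^ i         ≡⟨ cong (λ z → b ^ z * c ^ i) (split-M i m j≤M) ⟨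
      w i                         ∎
      where
      open ≤-Reasoning
      s : ℕ
      s = M ∸ (i + m)
      p : ∀ x y z → x * (y * z) ≡ z * x * y
      p = solve-∀

    count : List X → I → ℕ
    count xs i = ∑ (indicator ∘ R i) xs

    count≤length : ∀ xs i → count xs i ≤ length xs
    count≤length xs i = subst (count xs i ≤_) (*-identityʳ (length xs))
      (∑-bound xs (λ {x} _ → indicator≤1 (R i x)))
      where
      indicator≤1 : ∀ β → indicator β ≤ 1
      indicator≤1 true  = ≤-refl
      indicator≤1 false = z≤n

    live : List X → I → ℕ
    live []       i = 1
    live (x ∷ xs) i = if R i x then 0 else live xs i

    dead⇒hit : ∀ xs i → live xs i ≡ 0 → ∃[ x ] x ∈ xs × R i x ≡ true
    dead⇒hit (x ∷ xs) i eq with R i x in Rix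
    ... | true  = x , here refl , Rix
    ... | false with dead⇒hit xs i eq
    ...   | y , y∈xs , Riy = y , there y∈xs , Riy

    weight : (free client : List X) → I → ℕ
    weight free client i = live client i * w (count free i)

    Φ : (free client : List X) → ℕ
    Φ free client = ∑ (weight free client) family

    degree : (free client : List X) → X → ℕ
    degree free client x = ∑ (λ i → indicator (R i x) * weight free client i) family

    degree≤Φ : ∀ free client x → degree free client x ≤ Φ free client
    degree≤Φ free client x = ∑-mono family (λ {i} _ → *-indicator (R i x) (weight free client i))
      where
      *-indicator : ∀ β n → indicator β * n ≤ n
      *-indicator true  n = ≤-reflexive (+-identityʳ n)
      *-indicator false n = z≤n

    -- Double counting of the pairs of an element of `xs` and a set around it.
    ∑-degree : ∀ free client xs →
      ∑ (degree free client) xs ≡ ∑ (λ i → count xs i * weight free client i) family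
    ∑-degree free client xs = trans
      (∑-swap (λ x i → indicator (R i x) * weight free client i) xs family)
      (∑-cong family (λ {i} _ → ∑-*ʳ (weight free client i) (indicator ∘ R i) xs))

    -- If `x` lies in the set, its new weight is 0, which pays for the second term on the left.
    -- Otherwise the set loses only its elements in `O′`, and `w-step` applies. The loss stands on
    -- the left to avoid subtraction.
    round-set : ∀ {free client x O′ rem} → free ↭ x ∷ O′ ++ rem → length O′ ≤ q → length free ≤ M →
      ∀ i → 2 * q * weight rem (x ∷ client) i + 2 * q * (indicator (R i x) * weight free client i)
            ≤ 2 * q * weight free client i + count O′ i * weight free client i
    round-set {free} {client} {x} {O′} {rem} p O′≤q free≤M i with R i x in Rix
    ... | true  = begin
      2 * q * 0 + 2 * q * (1 * W)   ≡⟨ cong₂ _+_ (*-zeroʳ (2 * q)) (cong (2 * q *_) (*-identityˡ W)) ⟩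
      2 * q * W                     ≤⟨ m≤m+n (2 * q * W) _ ⟩
      2 * q * W + count O′ i * W    ∎
      where
      open ≤-Reasoning
      W : ℕ
      W = weight free client i
    ... | false = begin
      2 * q * (l * w (count rem i)) + 2 * q * 0    ≡⟨ p₁ (2 * q) l (w (count rem i)) ⟩
      l * (2 * q * w (count rem i))                ≤⟨ *-monoʳ-≤ l (w-step (count rem i) m
                                                        (≤-trans (count≤length O′ i) O′≤q)
                                                        (subst (_≤ M) count-free (≤-trans (count≤length free i) free≤M))) ⟩
      l * ((2 * q + m) * w (count rem i + m))      ≡⟨ cong (λ z → l * ((2 * q + m) * w z)) count-free ⟨
      l * ((2 * q + m) * w (count free i))         ≡⟨ p₂ (2 * q) m l (w (count free i)) ⟩
      2 * q * W + m * W                            ∎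
      where
      open ≤-Reasoning
      W l m : ℕ
      W = weight free client i
      l = live client i
      m = count O′ i
      count-free : count free i ≡ count rem i + m
      count-free = trans (∑-↭ (indicator ∘ R i) p) (trans
        (cong (λ β → indicator β + count (O′ ++ rem) i) Rix)
        (trans (∑-++ (indicator ∘ R i) O′ rem) (+-comm m (count rem i))))
      p₁ : ∀ a l v → a * (l * v) + a * 0 ≡ l * (a * v)
      p₁ = solve-∀
      p₂ : ∀ a m l v → l * ((a + m) * v) ≡ a * (l * v) + m * (l * v)
      p₂ = solve-∀

    -- Summing `round-set` over the family, the increase is at most the sum of the q degrees of
    -- Waiter's elements, hence at most q B ≤ 2q d(x), and this is exactly the decrease caused by
    -- Client's element.
    balanced-round : ∀ {free client O rem x B} → free ↭ O ++ rem → length O ≡ suc q → length free ≤ M →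
      x ∈ O → (∀ {y} → y ∈ O → degree free client y ≤ B) → B ≤ 2 * degree free client x →
      Φ rem (x ∷ client) ≤ Φ free client
    balanced-round {free} {client} {O} {rem} {x} {B} p |O| free≤M x∈O ≤B B≤ with ∈⇒↭ x∈O
    ... | O′ , π = *-cancelˡ-≤ (2 * q) {{m*n≢0 2 q {{_}} {{>-nonZero 1≤q}}}}
          (+-cancelʳ-≤ (2 * q * d x) _ _ (begin
      2 * q * Φ rem (x ∷ client) + 2 * q * d x
        ≡⟨ cong₂ _+_ (∑-*ˡ (2 * q) (weight rem (x ∷ client)) family) (∑-*ˡ (2 * q) (λ i → indicator (R i x) * W i) family) ⟨
      ∑ (λ i → 2 * q * weight rem (x ∷ client) i) family + ∑ (λ i → 2 * q * (indicator (R i x) * W i)) family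
        ≡⟨ ∑-+ (λ i → 2 * q * weight rem (x ∷ client) i) (λ i → 2 * q * (indicator (R i x) * W i)) family ⟨
      ∑ (λ i → 2 * q * weight rem (x ∷ client) i + 2 * q * (indicator (R i x) * W i)) family
        ≤⟨ ∑-mono family (λ {i} _ → round-set {free} {client} {x} {O′} {rem}
             (↭-trans p (++⁺ʳ rem π)) (≤-reflexive |O′|) free≤M i) ⟩
      ∑ (λ i → 2 * q * W i + count O′ i * W i) family
        ≡⟨ ∑-+ (λ i → 2 * q * W i) (λ i → count O′ i * W i) family ⟩
      ∑ (λ i → 2 * q * W i) family + ∑ (λ i → count O′ i * W i) family
        ≡⟨ cong₂ _+_ (∑-*ˡ (2 * q) W family) (sym (∑-degree free client O′)) ⟩
      2 * q * Φ free client + ∑ d O′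
        ≤⟨ +-monoʳ-≤ (2 * q * Φ free client) (∑-bound O′ (λ y∈ → ≤B (∈-resp-↭ (↭-sym π) (there y∈)))) ⟩
      2 * q * Φ free client + length O′ * B
        ≡⟨ cong (λ z → 2 * q * Φ free client + z * B) |O′| ⟩
      2 * q * Φ free client + q * B
        ≤⟨ +-monoʳ-≤ (2 * q * Φ free client) (*-monoʳ-≤ q B≤) ⟩
      2 * q * Φ free client + q * (2 * d x)
        ≡⟨ cong (2 * q * Φ free client +_) (p₁ q (d x)) ⟩
      2 * q * Φ free client + 2 * q * d x ∎))
      where
      open ≤-Reasoning
      W : I → ℕ
      W = weight free client
      d : X → ℕ
      d = degree free client
      |O′| : length O′ ≡ q
      |O′| = suc-injective (trans (sym (↭-length π)) |O|)
      p₁ : ∀ q z → q * (2 * z) ≡ 2 * q * z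
      p₁ = solve-∀

    -- Below the threshold of Winning, the second alternative forces Φ = 0.
    choice : ∀ free client → Balanced (degree free client) (suc q) free
               ⊎ ∑ (degree free client) free ≤ 2 * q * Φ free client
    choice free client = balanced⊎small-∑ (degree free client) q (Φ free client) (Φ free client) free
      ≤-refl (λ {x} _ → degree≤Φ free client x)

    toOffer : ∀ {free client} → suc q ≤ length free →
      Balanced (degree free client) (suc q) free
        ⊎ ∑ (degree free client) free ≤ 2 * q * Φ free client → Offer board q free
    toOffer _ (inj₁ β) = record
      { offered   = Balanced.chosen β
      ; remaining = Balanced.others β
      ; quantity  = Balanced.size-chosen β
      ; split     = Balanced.arrangement β
      }
    -- A default offer: under the invariant of `Winning` all sets are hit by the time this case
    -- arises, so any q + 1 free elements serve.
    toOffer {free} enough (inj₂ _) = record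
      { offered   = take (suc q) free
      ; remaining = drop (suc q) free
      ; quantity  = trans (length-take (suc q) free) (m≤n⇒m⊓n≡m enough)
      ; split     = ↭-reflexive (sym (take++drop≡id (suc q) free))
      }

    strategy : WaiterStrategy board q
    strategy {free} {client} _ enough = toOffer {free} {client} enough (choice free client)

    module Winning (2q≤M : 2 * q ≤ M) (Φ-initial : Φ board [] < w (2 * q)) where

      -- Since `w` is decreasing, a single unhit set with at most 2q free elements would already
      -- weigh at least `w (2 * q)`. This is what the threshold is chosen for.
      few⇒dead : ∀ {free client} → Φ free client < w (2 * q) → ∀ {i} → i ∈ family →
        count free i ≤ 2 * q → live client i ≡ 0
      few⇒dead {free} {client} Φ<w {i} i∈ few with live client i in eq
      ... | zero  = refl
      ... | suc l = contradiction
        (begin-strict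
          w (2 * q)                 ≤⟨ w-anti few 2q≤M ⟩
          w (count free i)          ≤⟨ m≤m+n _ _ ⟩
          suc l * w (count free i)  ≡⟨ cong (_* w (count free i)) eq ⟨
          weight free client i      ≤⟨ term≤∑ (weight free client) i∈ ⟩
          Φ free client             <⟨ Φ<w ⟩
          w (2 * q)                 ∎) (<-irrefl refl)
        where open ≤-Reasoning

      -- By `few⇒dead` every unhit set has at least 2q + 1 free elements, so the degrees sum to at
      -- least (2q + 1) Φ; an upper bound of 2q Φ leaves only Φ = 0.
      small-∑⇒Φ≡0 : ∀ {free client} → Φ free client < w (2 * q) →
        ∑ (degree free client) free ≤ 2 * q * Φ free client → Φ free client ≡ 0
      small-∑⇒Φ≡0 {free} {client} Φ<w small = n≤0⇒n≡0 (+-cancelʳ-≤ (2 * q * Φ free client) _ _ (begin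
        suc (2 * q) * Φ free client                        ≡⟨ ∑-*ˡ (suc (2 * q)) (weight free client) family ⟨
        ∑ (λ i → suc (2 * q) * weight free client i) family ≤⟨ ∑-mono family many ⟩
        ∑ (λ i → count free i * weight free client i) family ≡⟨ ∑-degree free client free ⟨
        ∑ (degree free client) free                        ≤⟨ small ⟩
        2 * q * Φ free client                              ∎))
        where
        open ≤-Reasoning
        many : ∀ {i} → i ∈ family → suc (2 * q) * weight free client i ≤ count free i * weight free client i
        many {i} i∈ with count free i ≤? 2 * q
        ... | no  many = *-monoˡ-≤ (weight free client i) (≰⇒> many)
        ... | yes few  = ≤-trans (≤-reflexive (trans
                (cong (λ l → suc (2 * q) * (l * w (count free i))) (few⇒dead {free} {client} Φ<w i∈ few))
                (*-zeroʳ (suc (2 * q))))) z≤n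

      live-∷ : ∀ x client i → live (x ∷ client) i ≤ live client i
      live-∷ x client i with R i x
      ... | true  = z≤n
      ... | false = ≤-refl

      all-dead : ∀ free client → (∀ {i} → i ∈ family → live client i ≡ 0) → Φ free client ≡ 0
      all-dead free client dead = trans
        (∑-cong family (λ {i} i∈ → cong (_* w (count free i)) (dead i∈))) (∑-zero family)

      Φ≡0⇒dead : ∀ free client → Φ free client ≡ 0 → ∀ {i} → i ∈ family → live client i ≡ 0
      Φ≡0⇒dead free client Φ≡0 {i} i∈ = n≤0⇒n≡0 (begin
        live client i          ≤⟨ m≤m*n (live client i) (w (count free i)) {{>-nonZero (w>0 (count free i))}} ⟩
        weight free client i   ≤⟨ term≤∑ (weight free client) i∈ ⟩
        Φ free client          ≡⟨ Φ≡0 ⟩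
        0                      ∎)
        where open ≤-Reasoning

      Φ<-round : ∀ {free client} (enough : suc q ≤ length free) → length free ≤ M → Φ free client < w (2 * q) →
        ∀ ch → (let o = toOffer {free} {client} enough ch) →
        ∀ {x} → x ∈ offered o → Φ (remaining o) (x ∷ client) < w (2 * q)
      Φ<-round {free} {client} enough free≤M Φ<w (inj₁ β) x∈ = ≤-<-trans
        (balanced-round {free} {client} (Balanced.arrangement β) (Balanced.size-chosen β) free≤M x∈
          (Balanced.≤bound β) (Balanced.bound≤double β x∈)) Φ<w
      Φ<-round {free} {client} enough free≤M Φ<w (inj₂ small) {x} _ = subst (_< w (2 * q))
        (sym (all-dead (drop (suc q) free) (x ∷ client) (λ {i} i∈ → n≤0⇒n≡0 (≤-trans (live-∷ x client i)
          (≤-reflexive (Φ≡0⇒dead free client (small-∑⇒Φ≡0 {free} {client} Φ<w small) i∈))))))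
        (w>0 (2 * q))

      invariant : ∀ {free client} (h : History board q free client) → WaiterFollows board q strategy h →
        length free ≤ M × Φ free client < w (2 * q)
      invariant start _ = ≤-refl , Φ-initial
      invariant (round {free} {client} h o x∈) (fol , enough , refl)
        with invariant h fol
      ... | free≤M , Φ<w = ≤-trans
              (m≤n+m (length (remaining o)) (length (offered o)))
              (subst (_≤ M) (trans (↭-length (split o)) (length-++ (offered o) {remaining o})) free≤M)
            , Φ<-round {free} {client} enough free≤M Φ<w (choice free client) x∈
      -- Before Waiter takes the remainder at most q ≤ 2q elements are free, so all sets have been
      -- hit by then and Waiter's final claim does no harm.
      invariant (last {free} {client} h _ free<) fol with invariant h fol
      ... | _ , Φ<w = z≤n , subst (_< w (2 * q)) (sym (all-dead [] client (λ {i} i∈ →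
              few⇒dead {free} {client} Φ<w i∈
                (≤-trans (count≤length free i) (≤-trans (≤-pred free<) (m≤m+n q _))))))
              (w>0 (2 * q))

      hits-all : ∀ {client} (h : History board q [] client) → WaiterFollows board q strategy h →
        ∀ {i} → i ∈ family → ∃[ x ] x ∈ client × R i x ≡ true
      hits-all {client} h fol {i} i∈ = dead⇒hit client i
        (few⇒dead {[]} {client} (proj₂ (invariant h fol)) i∈ z≤n)

-- Counting subsets, chromatic numbers and 2-colourings.

module Hypergraphs where

  open import Data.Bool.Base using (Bool; true; false)
  open import Data.Nat.Base
  open import Data.Nat.Properties
  open import Data.Nat.Combinatorics using (_C_; nCk+nC[k+1]≡[n+1]C[k+1])
  open import Data.Fin.Base as Fin using (Fin; zero; suc; finToFun; funToFin; inject≤)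
  import Data.Fin.Properties as Fin
  open import Data.Fin.Subset as Subset using (Subset; inside; outside) renaming (_∈_ to _∈ₛ_; _⊆_ to _⊆ₛ_; ∣_∣ to size)
  open import Data.Fin.Subset.Properties as Subset using (_⊆?_)
  open import Data.Vec.Base as Vec using ([]; _∷_)
  open import Data.Vec.Properties using (lookup∘tabulate; []=⇒lookup; lookup⇒[]=)
  open import Data.List.Base using (List; []; _∷_; _++_; map; filter; length)
  open import Data.List.Properties using (length-map; length-++)
  open import Data.List.Membership.Propositional using (_∈_)
  open import Data.List.Membership.Propositional.Properties using (∈-map⁺; ∈-map⁻; ∈-++⁺ˡ; ∈-++⁺ʳ; ∈-filter⁺; ∈-filter⁻)
  open import Data.List.Relation.Binary.Subset.Propositional using (_⊆_)
  open import Data.List.Relation.Unary.Any using (here; there)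
  open import Data.List.Relation.Unary.All as All using (All; []; _∷_)
  open import Data.List.Relation.Unary.Unique.Propositional using (Unique; []; _∷_)
  import Data.List.Relation.Unary.Unique.Propositional.Properties as Unique
  open import Data.List.Relation.Binary.Permutation.Propositional using (↭-sym)
  open import Data.List.Relation.Binary.Permutation.Propositional.Properties using (∈-resp-↭)
  open import Data.Product using (∃; ∃-syntax; _×_; _,_; proj₁; proj₂)
  open import Data.Sum.Base using (_⊎_; inj₁; inj₂)
  open import Function using (_∘_; id)
  open import Relation.Nullary using (¬_; yes; no; Dec; does; contradiction; ¬?; _→-dec_)
  open import Relation.Nullary.Decidable using (map′)
  open import Relation.Unary using (Decidable)
  open import Relation.Binary.PropositionalEquality
  open import Defs
  open Sums
  open WaiterGame

  ∑-filter : ∀ {A : Set} {P : A → Set} (P? : Decidable P) (f : A → ℕ) xs →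
    ∑ f (filter P? xs) ≡ ∑ (λ x → indicator (does (P? x)) * f x) xs
  ∑-filter P? f []       = refl
  ∑-filter P? f (x ∷ xs) with does (P? x)
  ... | true  = cong₂ _+_ (sym (*-identityˡ (f x))) (∑-filter P? f xs)
  ... | false = ∑-filter P? f xs

  C-monoˡ : ∀ k {m n} → m ≤′ n → m C k ≤ n C k
  C-monoˡ k ≤′-refl = ≤-refl
  C-monoˡ k {m} (≤′-step {n} h) = ≤-trans (C-monoˡ k h) (step k n)
    where
    step : ∀ k n → n C k ≤ suc n C k
    step zero    n = ≤-refl
    step (suc k) n = subst (n C suc k ≤_) (nCk+nC[k+1]≡[n+1]C[k+1] n k) (m≤n+m _ (n C k))

  -- Splitting the subsets by the first vertex turns the induction into Pascal's rule; if that
  -- vertex is outside `S`, the subsets through it contribute nothing.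
  count-subsets : ∀ {n} (S : Subset n) k →
    ∑ (λ A → indicator (does (size A ≟ k)) * indicator (does (A ⊆? S))) (allSubsets n) ≡ size S C k
  count-subsets [] zero    = refl
  count-subsets [] (suc k) = refl
  count-subsets {suc n} (s ∷ S) k = begin
    ∑ f (map (outside ∷_) (allSubsets n) ++ map (inside ∷_) (allSubsets n))
      ≡⟨ ∑-++ f (map (outside ∷_) (allSubsets n)) _ ⟩
    ∑ f (map (outside ∷_) (allSubsets n)) + ∑ f (map (inside ∷_) (allSubsets n))
      ≡⟨ cong₂ _+_ (∑-map f (outside ∷_) (allSubsets n)) (∑-map f (inside ∷_) (allSubsets n)) ⟩
    ∑ (f ∘ (outside ∷_)) (allSubsets n) + ∑ (f ∘ (inside ∷_)) (allSubsets n)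
      ≡⟨ cong (_+ ∑ (f ∘ (inside ∷_)) (allSubsets n)) (count-subsets S k) ⟩
    size S C k + ∑ (f ∘ (inside ∷_)) (allSubsets n)
      ≡⟨ containing-zero s k ⟩
    size (s ∷ S) C k ∎
    where
    open ≡-Reasoning
    f : Subset (suc n) → ℕ
    f A = indicator (does (size A ≟ k)) * indicator (does (A ⊆? (s ∷ S)))
    containing-zero : ∀ s k → size S C k +
      ∑ (λ A → indicator (does (suc (size A) ≟ k)) * indicator (does ((inside ∷ A) ⊆? (s ∷ S)))) (allSubsets n)
      ≡ size (s ∷ S) C k
    containing-zero outside k = trans (cong (size S C k +_) (trans
      (∑-cong (allSubsets n) (λ {A} _ → *-zeroʳ (indicator (does (suc (size A) ≟ k))))) (∑-zero (allSubsets n))))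
      (+-identityʳ _)
    containing-zero inside zero = cong (1 +_) (∑-zero (allSubsets n))
    containing-zero inside (suc k) = trans (cong (size S C suc k +_) (count-subsets S k))
      (trans (+-comm (size S C suc k) _) (nCk+nC[k+1]≡[n+1]C[k+1] (size S) k))

  count-edges-inside : ∀ {n} (S : Subset n) k → ∑ (λ A → indicator (does (A ⊆? S))) (E[K] n k) ≡ size S C k
  count-edges-inside {n} S k = trans (∑-filter (λ A → size A ≟ k) _ (allSubsets n)) (count-subsets S k)

  length-allSubsets : ∀ n → length (allSubsets n) ≡ 2 ^ n
  length-allSubsets zero    = refl
  length-allSubsets (suc n) = trans (length-++ (map (outside ∷_) (allSubsets n)))
    (cong₂ _+_ (trans (length-map _ (allSubsets n)) (length-allSubsets n))
      (trans (trans (length-map _ (allSubsets n)) (length-allSubsets n)) (sym (+-identityʳ _))))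

  ∈-allSubsets : ∀ {n} (A : Subset n) → A ∈ allSubsets n
  ∈-allSubsets []            = here refl
  ∈-allSubsets (outside ∷ A) = ∈-++⁺ˡ (∈-map⁺ (outside ∷_) (∈-allSubsets A))
  ∈-allSubsets (inside ∷ A)  = ∈-++⁺ʳ _ (∈-map⁺ (inside ∷_) (∈-allSubsets A))

  allSubsets-unique : ∀ n → Unique (allSubsets n)
  allSubsets-unique zero    = [] ∷ []
  allSubsets-unique (suc n) = Unique.++⁺
    (Unique.map⁺ ∷-injective (allSubsets-unique n)) (Unique.map⁺ ∷-injective (allSubsets-unique n))
    λ { (p , r) → disjoint p r }
    where
    ∷-injective : ∀ {s} {A B : Subset n} → s Vec.∷ A ≡ s Vec.∷ B → A ≡ B
    ∷-injective refl = refl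
    disjoint : ∀ {A} → A ∈ map (outside ∷_) (allSubsets n) → ¬ A ∈ map (inside ∷_) (allSubsets n)
    disjoint p r with ∈-map⁻ (outside ∷_) p | ∈-map⁻ (inside ∷_) r
    ... | _ , _ , refl | _ , _ , ()

  ∈-E[K]⁺ : ∀ {n} (A : Subset n) → A ∈ E[K] n (size A)
  ∈-E[K]⁺ A = ∈-filter⁺ (λ B → size B ≟ size A) (∈-allSubsets A) refl

  ∈-E[K]⁻ : ∀ {n k} {A : Subset n} → A ∈ E[K] n k → size A ≡ k
  ∈-E[K]⁻ {n} {k} A∈ = proj₂ (∈-filter⁻ (λ B → size B ≟ k) {xs = allSubsets n} A∈)

  E[K]-unique : ∀ n k → Unique (E[K] n k)
  E[K]-unique n k = Unique.filter⁺ (λ A → size A ≟ k) (allSubsets-unique n)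

  Proper : ∀ {n r} → List (Subset n) → (Fin n → Fin r) → Set
  Proper F φ = ∀ i → Independent F (λ v → φ v ≡ i)

  proper? : ∀ {n r} (F : List (Subset n)) (φ : Fin n → Fin r) → Dec (Proper F φ)
  proper? F φ = Fin.all? λ i → map′
    (λ all {A} A∈ mono → All.lookup all A∈ (λ v v∈A → mono {v} v∈A))
    (λ ind → All.tabulate (λ A∈ mono → ind A∈ (λ {v} → mono v)))
    (All.all? (λ A → ¬? (Fin.all? λ v → (v Subset.∈? A) →-dec (φ v Fin.≟ i))) F)

  proper-cong : ∀ {n r} {F : List (Subset n)} {φ ψ : Fin n → Fin r} → φ ≗ ψ → Proper F φ → Proper F ψ
  proper-cong eq prop i A∈ mono = prop i A∈ (λ {v} v∈A → trans (eq v) (mono v∈A))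

  -- A chromatic number has to be exhibited, so its existence needs a decidable search. Colourings
  -- are enumerated by `Fin (r ^ n)`; the round trip is only a pointwise identity, whence
  -- `proper-cong`.
  colourable? : ∀ {n} (F : List (Subset n)) r → Dec (Colourable F r)
  colourable? {n} F r = map′
    (λ { (i , p) → finToFun i , p })
    (λ { (φ , p) → funToFin φ , proper-cong (λ v → sym (Fin.finToFun-funToFin φ v)) p })
    (Fin.any? {n = r ^ n} (λ i → proper? F (finToFun i)))

  least : ∀ {P : ℕ → Set} → Decidable P → ∀ m → P m → ∃[ r ] P r × (∀ s → P s → r ≤ s)
  least P? m Pm with P? 0
  ... | yes P0 = 0 , P0 , λ _ _ → z≤n
  least P? zero    Pm | no ¬P0 = contradiction Pm ¬P0
  least P? (suc m) Pm | no ¬P0 with least (P? ∘ suc) m Pm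
  ... | r , Pr , min = suc r , Pr , λ { zero P0 → contradiction P0 ¬P0 ; (suc s) Ps → s≤s (min s Ps) }

  chromaticNumber : ∀ {n} {F : List (Subset n)} {m} → Colourable F m → ∃ (IsChromaticNumber F)
  chromaticNumber {F = F} {m} = least (colourable? F) m

  -- Colour `i` of the larger palette need not come from the smaller one; a vertex of the
  -- monochromatic edge names the old colour.
  colourable-mono : ∀ {n} {F : List (Subset n)} {r s} → (∀ {A} → A ∈ F → Subset.Nonempty A) →
    r ≤ s → Colourable F r → Colourable F s
  colourable-mono nonempty r≤s (φ , prop) = (λ v → inject≤ (φ v) r≤s) , λ i A∈ mono →
    let u , u∈A = nonempty A∈
    in prop (φ u) A∈ (λ v∈A → Fin.inject≤-injective r≤s r≤s _ _ (trans (mono v∈A) (sym (mono u∈A))))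

  size>0⇒nonempty : ∀ {n} (A : Subset n) → 1 ≤ size A → Subset.Nonempty A
  size>0⇒nonempty {n} A 1≤ with Subset.nonempty? A
  ... | yes ne   = ne
  ... | no empty = contradiction (subst (1 ≤_) (trans (cong size (Subset.Empty-unique empty)) (Subset.∣⊥∣≡0 n)) 1≤) λ ()

  -- Giving every vertex its own colour provides the upper end of the search for the chromatic
  -- number.
  discrete-colourable : ∀ {n} {F : List (Subset n)} → (∀ {A} → A ∈ F → 2 ≤ size A) → Colourable F n
  discrete-colourable 2≤ = id , λ i {A} A∈ mono → contradiction (≤-trans (2≤ A∈) (begin
    size A             ≤⟨ Subset.p⊆q⇒∣p∣≤∣q∣ {p = A} {q = Subset.⁅ i ⁆}
                            (λ {v} v∈A → subst (_∈ₛ Subset.⁅ i ⁆) (sym (mono v∈A)) (Subset.x∈⁅x⁆ i)) ⟩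
    size Subset.⁅ i ⁆  ≡⟨ Subset.∣⁅x⁆∣≡1 i ⟩
    1                  ∎)) λ { (s≤s ()) }
    where open ≤-Reasoning

  nonTwoColourable : ∀ {n} {F : List (Subset n)} → (∀ {A} → A ∈ F → 2 ≤ size A) →
    ¬ Colourable F 2 → NonTwoColourable F
  nonTwoColourable {F = F} 2≤ ¬2 with chromaticNumber (discrete-colourable 2≤)
  ... | r , isχ with r ≤? 2
  ...   | yes r≤2 = contradiction (colourable-mono
            (λ {A} A∈ → size>0⇒nonempty A (≤-trans (n≤1+n 1) (2≤ A∈))) r≤2 (proj₁ isχ)) ¬2
  ...   | no  r≰2 = r , isχ , ≰⇒> r≰2

  twoColourable : ∀ {n} {F : List (Subset n)} → Colourable F 2 → TwoColourable F
  twoColourable c₂ with chromaticNumber c₂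
  ... | r , isχ = r , isχ , proj₂ isχ 2 c₂

  colourable-anti : ∀ {n} {F G : List (Subset n)} {r} → F ⊆ G → Colourable G r → Colourable F r
  colourable-anti F⊆G (φ , prop) = φ , λ i A∈ → prop i (F⊆G A∈)

  twoColourable⇒noWinningSet : ∀ {n k} {G : List (Subset n)} → Colourable G 2 →
    ¬ (∃[ F ] NC₂ n k F × F ⊆ G)
  twoColourable⇒noWinningSet c₂ (F , (_ , r , (_ , min) , r>2) , F⊆G) =
    <⇒≱ r>2 (min 2 (colourable-anti F⊆G c₂))

  ∈-tabulate⁻ : ∀ {n} (f : Fin n → Bool) {v} → v ∈ₛ Vec.tabulate f → f v ≡ true
  ∈-tabulate⁻ f {v} v∈ = trans (sym (lookup∘tabulate f v)) ([]=⇒lookup v∈)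

  ∈-tabulate⁺ : ∀ {n} (f : Fin n → Bool) {v} → f v ≡ true → v ∈ₛ Vec.tabulate f
  ∈-tabulate⁺ f {v} fv = lookup⇒[]= v _ (trans (lookup∘tabulate f v) fv)

  big-class : ∀ {n} (S : Subset n) → ⌈ n /2⌉ ≤ size S ⊎ ⌈ n /2⌉ ≤ size (Subset.∁ S)
  big-class {n} S with size S ≤? ⌊ n /2⌋
  ... | yes s≤ = inj₂ (begin
      ⌈ n /2⌉                        ≡⟨ m+n∸m≡n ⌊ n /2⌋ ⌈ n /2⌉ ⟨
      ⌊ n /2⌋ + ⌈ n /2⌉ ∸ ⌊ n /2⌋    ≡⟨ cong (_∸ ⌊ n /2⌋) (⌊n/2⌋+⌈n/2⌉≡n n) ⟩
      n ∸ ⌊ n /2⌋                    ≤⟨ ∸-monoʳ-≤ n s≤ ⟩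
      n ∸ size S                     ≡⟨ Subset.∣∁p∣≡n∸∣p∣ S ⟨
      size (Subset.∁ S)              ∎)
    where open ≤-Reasoning
  -- By definition `⌈ n /2⌉` is `⌊ suc n /2⌋`, which is at most `suc ⌊ n /2⌋`.
  ... | no  s≰ = inj₁ (≤-trans (⌊n/2⌋-mono (n≤1+n (suc n))) (≰⇒> s≰))

  halves-hit⇒¬2-colourable : ∀ {n} {F : List (Subset n)} →
    (∀ S → ⌈ n /2⌉ ≤ size S → ∃[ A ] A ∈ F × A ⊆ₛ S) → ¬ Colourable F 2
  halves-hit⇒¬2-colourable {n} {F} hit (φ , prop) with big-class (Vec.tabulate (λ v → does (φ v Fin.≟ zero)))
  ... | inj₁ big with hit _ big
  ...   | A , A∈F , A⊆S = prop zero A∈F λ v∈A → is-zero (∈-tabulate⁻ _ (A⊆S v∈A))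
    where
    is-zero : ∀ {i : Fin 2} → does (i Fin.≟ zero) ≡ true → i ≡ zero
    is-zero {zero} _ = refl
  halves-hit⇒¬2-colourable {n} {F} hit (φ , prop) | inj₂ big with hit _ big
  ...   | A , A∈F , A⊆S = prop (suc zero) A∈F λ {v} v∈A →
            is-one (λ eq → Subset.x∈∁p⇒x∉p (A⊆S v∈A) (∈-tabulate⁺ _ (cong (λ i → does (i Fin.≟ zero)) eq)))
    where
    is-one : ∀ {i : Fin 2} → i ≢ zero → i ≡ suc zero
    is-one {zero}     i≢0 = contradiction refl i≢0
    is-one {suc zero} _   = refl

  client⊆board : ∀ {X : Set} {board : List X} {q free client} → History board q free client →
    free ⊆ board × client ⊆ board
  client⊆board start         = id , λ ()
  client⊆board (last h _ _)  = (λ ()) , proj₂ (client⊆board h)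
  client⊆board (round h o x∈) with client⊆board h
  ... | free⊆ , client⊆ = (λ y∈ → free⊆ (∈-resp-↭ (↭-sym (split o)) (∈-++⁺ʳ (offered o) y∈)))
                        , λ { (here refl) → free⊆ (∈-resp-↭ (↭-sym (split o)) (∈-++⁺ˡ x∈))
                            ; (there y∈)  → client⊆ y∈ }

-- The initial weight, and Waiter's win under the integer threshold.

module WaiterWins where

  open import Data.Bool.Base using (Bool; true)
  open import Data.Nat.Base
  open import Data.Nat.Properties
  open import Data.Nat.Combinatorics using (_C_)
  open import Data.Nat.Tactic.RingSolver using (solve-∀)
  open import Data.Fin.Subset using (Subset) renaming (_⊆_ to _⊆ₛ_; ∣_∣ to size)
  open import Data.Fin.Subset.Properties as Subset using (_⊆?_)
  open import Data.List.Base using (List; []; filter; length)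
  open import Data.List.Properties using (length-filter)
  open import Data.List.Membership.Propositional using (_∈_)
  open import Data.List.Membership.Propositional.Properties using (∈-filter⁺; ∈-filter⁻)
  open import Data.Product using (Σ-syntax; _×_; _,_; proj₂)
  open import Function using (id)
  open import Relation.Nullary using (yes; no; Dec; does)
  open import Relation.Binary.PropositionalEquality
  open import Defs
  open Sums
  open WaiterGame
  open Hypergraphs

  *-distrib-^ : ∀ a b n → a ^ n * b ^ n ≡ (a * b) ^ n
  *-distrib-^ a b zero    = refl
  *-distrib-^ a b (suc n) = trans (interchange a b (a ^ n) (b ^ n)) (cong (a * b *_) (*-distrib-^ a b n))
    where
    interchange : ∀ a b x y → a * x * (b * y) ≡ a * b * (x * y)
    interchange = solve-∀

  ^4 : ∀ x → x ^ 4 ≡ x * (x * (x * x))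
  ^4 x = cong (λ z → x * (x * (x * z))) (*-identityʳ x)

  -- Bernoulli's inequality gives λ^q ≥ 4/3, and (4/3)^4 = 256/81 > 162/81 = 2.
  double-^4q : ∀ q → 1 ≤ q → 2 * (3 * q) ^ (q * 4) < suc (3 * q) ^ (q * 4)
  double-^4q q@(suc q′) 1≤q = *-cancelˡ-< 81 _ _ (begin-strict
    81 * (2 * c ^ (q * 4))                ≡⟨ cong (λ z → 81 * (2 * z)) (trans (sym (^-*-assoc c q 4)) (^4 u)) ⟩
    81 * (2 * (u * (u * (u * u))))        ≡⟨ *-assoc 81 2 (u * (u * (u * u))) ⟨
    162 * (u * (u * (u * u)))             <⟨ *-monoˡ-< (u * (u * (u * u))) {{>-nonZero u⁴>0}} (m≤m+n 163 93) ⟩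
    256 * (u * (u * (u * u)))             ≡⟨ p₁ u ⟩
    (4 * u) * ((4 * u) * ((4 * u) * (4 * u))) ≤⟨ *-mono-≤ 4u≤3v (*-mono-≤ 4u≤3v (*-mono-≤ 4u≤3v 4u≤3v)) ⟩
    (3 * v) * ((3 * v) * ((3 * v) * (3 * v))) ≡⟨ p₂ v ⟩
    81 * (v * (v * (v * v)))              ≡⟨ cong (81 *_) (trans (sym (^4 v)) (^-*-assoc b q 4)) ⟩
    81 * b ^ (q * 4)                      ∎)
    where
    open ≤-Reasoning
    b c u v : ℕ
    c = 3 * q
    b = suc c
    u = c ^ q
    v = b ^ q
    instance
      q≢0 : NonZero q
      q≢0 = >-nonZero 1≤q
      c≢0 : NonZero c
      c≢0 = m*n≢0 3 q
    u>0 : 1 ≤ u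
    u>0 = m^n>0 c q
    u⁴>0 : 1 ≤ u * (u * (u * u))
    u⁴>0 = *-mono-≤ u>0 (*-mono-≤ u>0 (*-mono-≤ u>0 u>0))
    p₁ : ∀ u → 256 * (u * (u * (u * u))) ≡ (4 * u) * ((4 * u) * ((4 * u) * (4 * u)))
    p₁ = solve-∀
    p₂ : ∀ u → (3 * u) * ((3 * u) * ((3 * u) * (3 * u))) ≡ 81 * (u * (u * (u * u)))
    p₂ = solve-∀
    l : ∀ u q → q * (4 * u) ≡ u * (3 * q + q)
    l = solve-∀
    r : ∀ v q → 3 * q * v ≡ q * (3 * v)
    r = solve-∀
    4u≤3v : 4 * u ≤ 3 * v
    4u≤3v = *-cancelˡ-≤ q (begin
      q * (4 * u)               ≡⟨ l u q ⟩
      c * c ^ q′ * (c + q)      ≡⟨ *-assoc c (c ^ q′) (c + q) ⟩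
      c * (c ^ q′ * (c + q))    ≤⟨ *-monoʳ-≤ c (bernoulli c q′) ⟩
      c * v                     ≡⟨ r v q ⟩
      q * (3 * v)               ∎)

  module Initial {X I : Set} (R : I → X → Bool) (family : List I) (board : List X)
    (q : ℕ) (1≤q : 1 ≤ q) (n : ℕ) (1≤n : 1 ≤ n) where

    open Transversal R family board q 1≤q

    -- Each set has 4qn elements beyond the 2q of the threshold. By `double-^4q` every block of 4q
    -- of them more than halves its weight, so n blocks outweigh the at most 2^n sets.
    Φ-initial : length family ≤ 2 ^ n → 2 * q + q * 4 * n ≤ M →
      (∀ {i} → i ∈ family → 2 * q + q * 4 * n ≤ count board i) → Φ board [] < w (2 * q)
    Φ-initial |𝓐| a≤M a≤ = begin-strict
      Φ board []                          ≤⟨ ∑-bound family (λ {i} i∈ → ≤-trans (≤-reflexive (+-identityʳ _))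
                                               (w-anti (a≤ i∈) (count≤length board i))) ⟩
      length family * w (2 * q + t)       ≤⟨ *-monoˡ-≤ (w (2 * q + t)) |𝓐| ⟩
      2 ^ n * (b ^ s * c ^ (2 * q + t))   ≡⟨ cong (λ z → 2 ^ n * (b ^ s * z)) (^-distribˡ-+-* c (2 * q) t) ⟩
      2 ^ n * (b ^ s * (c ^ (2 * q) * c ^ t)) ≡⟨ p (2 ^ n) (b ^ s) (c ^ (2 * q)) (c ^ t) ⟩
      2 ^ n * c ^ t * (b ^ s * c ^ (2 * q))   <⟨ *-monoˡ-< (b ^ s * c ^ (2 * q))
                                                  {{m*n≢0 (b ^ s) (c ^ (2 * q)) {{m^n≢0 b s}} {{m^n≢0 c (2 * q)}}}} key ⟩
      b ^ t * (b ^ s * c ^ (2 * q))       ≡⟨ *-assoc (b ^ t) (b ^ s) _ ⟨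
      b ^ t * b ^ s * c ^ (2 * q)         ≡⟨ cong (_* c ^ (2 * q)) (^-distribˡ-+-* b t s) ⟨
      b ^ (t + s) * c ^ (2 * q)           ≡⟨ cong (λ z → b ^ z * c ^ (2 * q)) (split-M (2 * q) t a≤M) ⟨
      w (2 * q)                           ∎
      where
      open ≤-Reasoning
      t s : ℕ
      t = q * 4 * n
      s = M ∸ (2 * q + t)
      p : ∀ a x y z → a * (x * (y * z)) ≡ a * z * (x * y)
      p = solve-∀
      key : 2 ^ n * c ^ t < b ^ t
      key = begin-strict
        2 ^ n * c ^ t                ≡⟨ cong (2 ^ n *_) (^-*-assoc c (q * 4) n) ⟨
        2 ^ n * (c ^ (q * 4)) ^ n    ≡⟨ *-distrib-^ 2 (c ^ (q * 4)) n ⟩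
        (2 * c ^ (q * 4)) ^ n        <⟨ ^-monoˡ-< n {{>-nonZero 1≤n}} (double-^4q q 1≤q) ⟩
        (b ^ (q * 4)) ^ n            ≡⟨ ^-*-assoc b (q * 4) n ⟩
        b ^ t                        ∎

  waiter-wins : ∀ n k q → 2 ≤ k → 1 ≤ n → 1 ≤ q → 2 * q + q * 4 * n ≤ ⌈ n /2⌉ C k →
    Σ[ σ ∈ WaiterStrategy (E[K] n k) q ] ForcesNonTwoColourable n k q σ
      × WinningForWaiter (E[K] n k) q (NC₂ n k) σ
  waiter-wins n k q 2≤k 1≤n 1≤q a≤ = strategy , forces , λ {client} h fol →
    client , (proj₂ (client⊆board h) , forces h fol) , id
    where
    R : Subset n → Subset n → Bool
    R S A = does (A ⊆? S)
    big? : ∀ (S : Subset n) → Dec (⌈ n /2⌉ ≤ size S)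
    big? S = ⌈ n /2⌉ ≤? size S
    family : List (Subset n)
    family = filter big? (allSubsets n)
    open Transversal R family (E[K] n k) q 1≤q
    a≤count : ∀ {S} → ⌈ n /2⌉ ≤ size S → 2 * q + q * 4 * n ≤ count (E[K] n k) S
    a≤count {S} big = ≤-trans a≤ (subst (⌈ n /2⌉ C k ≤_) (sym (count-edges-inside S k)) (C-monoˡ k (≤⇒≤′ big)))
    a≤M : 2 * q + q * 4 * n ≤ M
    a≤M = ≤-trans (a≤count {Data.Fin.Subset.⊤} (subst (⌈ n /2⌉ ≤_) (sym (Subset.∣⊤∣≡n n)) (⌈n/2⌉≤n n)))
      (count≤length (E[K] n k) _)
    open Winning (≤-trans (m≤m+n (2 * q) _) a≤M)
      (Initial.Φ-initial R family (E[K] n k) q 1≤q n 1≤n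
        (≤-trans (length-filter big? (allSubsets n)) (≤-reflexive (length-allSubsets n))) a≤M
        (λ {S} S∈ → a≤count {S} (proj₂ (∈-filter⁻ big? {xs = allSubsets n} S∈))))
    true⇒⊆ : ∀ {A S} → R S A ≡ true → A ⊆ₛ S
    true⇒⊆ {A} {S} eq with A ⊆? S
    ... | yes A⊆S = A⊆S
    true⇒⊆ () | no _
    forces : ForcesNonTwoColourable n k q strategy
    forces {client} h fol = nonTwoColourable
      (λ A∈ → subst (2 ≤_) (sym (∈-E[K]⁻ (proj₂ (client⊆board h) A∈))) 2≤k)
      (halves-hit⇒¬2-colourable λ S big →
        let A , A∈ , RSA = hits-all h fol (∈-filter⁺ big? (∈-allSubsets S) big)
        in A , A∈ , true⇒⊆ {A} {S} RSA)

-- From the real thresholds to inequalities of integers.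

module Thresholds where

  open import Data.Nat.Base as ℕ using (ℕ; zero; suc)
  import Data.Nat.Properties as ℕ
  open import Data.Integer.Base using (+_)
  open import Data.Rational.Base using (ℚ; 0ℚ; 1ℚ; ½; _/_; _+_; _*_; _-_; -_; _≤_; _<_; nonNegative; ∣_∣)
  open import Data.Rational.Properties
  open import Data.Rational.Solver using (module +-*-Solver)
  open import Data.Product using (_,_)
  open import Relation.Nullary using (yes; no; contradiction)
  open import Relation.Nullary.Decidable using (from-yes)
  open import Relation.Binary.PropositionalEquality
  open import Defs
  open Arithmetic
  open Inverses
  open Dyadic
  open Bisection
  open +-*-Solver using (solve; _:=_; _:+_; _:*_; _:-_; con)

  ι : ℕ → ℚ
  ι n = + n / 1

  ι-+ : ∀ m n → ι (m ℕ.+ n) ≡ ι m + ι n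
  ι-+ zero    n = sym (+-identityˡ (ι n))
  ι-+ (suc m) n = trans (/1-suc (m ℕ.+ n)) (trans (cong (λ z → 1ℚ + z) (ι-+ m n))
    (trans (sym (+-assoc 1ℚ (ι m) (ι n))) (cong (_+ ι n) (sym (/1-suc m)))))

  ι-* : ∀ m n → ι (m ℕ.* n) ≡ ι m * ι n
  ι-* zero    n = sym (*-zeroˡ (ι n))
  ι-* (suc m) n = begin
    ι (n ℕ.+ m ℕ.* n)       ≡⟨ ι-+ n (m ℕ.* n) ⟩
    ι n + ι (m ℕ.* n)       ≡⟨ cong (λ z → ι n + z) (ι-* m n) ⟩
    ι n + ι m * ι n         ≡⟨ solve 2 (λ m n → n :+ m :* n := (con 1ℚ :+ m) :* n) refl (ι m) (ι n) ⟩
    (1ℚ + ι m) * ι n        ≡⟨ cong (_* ι n) (/1-suc m) ⟨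
    ι (suc m) * ι n         ∎
    where open ≡-Reasoning

  -- Distinct integers differ by at least 1. The slack is there because `≤ᴿ` gives inequalities of
  -- terms only up to a positive error.
  ι-reflects-≤ : ∀ {m n} → ι m ≤ ι n + ½ → m ℕ.≤ n
  ι-reflects-≤ {m} {n} h with m ℕ.≤? n
  ... | yes m≤n = m≤n
  ... | no  m≰n = contradiction (begin-strict
    ι n + ½     <⟨ +-monoʳ-< (ι n) (from-yes (½ <? 1ℚ)) ⟩
    ι n + 1ℚ    ≡⟨ +-comm (ι n) 1ℚ ⟩
    1ℚ + ι n    ≡⟨ /1-suc n ⟨
    ι (suc n)   ≤⟨ /1-mono (ℕ.≰⇒> m≰n) ⟩
    ι m         ≤⟨ h ⟩
    ι n + ½     ∎) (<-irrefl refl)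
    where open ≤-Reasoning

  -- An inequality of integers survives clearing the denominator w, since the
  -- remaining error ½ is absorbed by ι-reflects-≤.
  ≤/+ε⇒*≤ : ∀ p r w → 0ℚ < w → p ≤ r * inv w + ½ * inv w → p * w ≤ r + ½
  ≤/+ε⇒*≤ p r w w>0 h = begin
    p * w                             ≤⟨ *-monoʳ-≤-nonNeg w {{nonNegative (<⇒≤ w>0)}} h ⟩
    (r * inv w + ½ * inv w) * w       ≡⟨ solve 3 (λ r i w → (r :* i :+ con ½ :* i) :* w := (r :+ con ½) :* (i :* w)) refl r (inv w) w ⟩
    (r + ½) * (inv w * w)             ≡⟨ cong ((r + ½) *_) (inv-inverse w>0) ⟩
    (r + ½) * 1ℚ                      ≡⟨ *-identityʳ (r + ½) ⟩
    r + ½                             ∎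
    where open ≤-Reasoning

  -- The induction carries the tail ½^m along: the m-th term is at most ½^(m+1), which is just what
  -- the tail loses.
  ln2≤1 : ∀ m → seq ln2 m ≤ 1ℚ
  ln2≤1 m = ≤-trans
    (subst (_≤ seq ln2 m + ½^ m) (+-identityʳ (seq ln2 m)) (+-monoʳ-≤ (seq ln2 m) (½^-nn m))) (remainder m)
    where
    open ≤-Reasoning
    remainder : ∀ m → seq ln2 m + ½^ m ≤ 1ℚ
    remainder zero    = ≤-refl
    remainder (suc m) = begin
      seq ln2 m + ln2-term m + ½^ suc m       ≤⟨ +-monoˡ-≤ (½^ suc m) (+-monoʳ-≤ (seq ln2 m)
                                                  (*-mono (from-yes (0ℚ ≤? 1ℚ)) (½^-nn (suc m))
                                                    (1/-anti {1} {suc m} (ℕ.s≤s ℕ.z≤n)) ≤-refl)) ⟩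
      seq ln2 m + 1ℚ * ½^ suc m + ½^ suc m    ≡⟨ solve 2 (λ s h → s :+ con 1ℚ :* (con ½ :* h) :+ con ½ :* h := s :+ h)
                                                  refl (seq ln2 m) (½^ m) ⟩
      seq ln2 m + ½^ m                        ≤⟨ remainder m ⟩
      1ℚ                                      ∎

  -- With L = ln 2, clearing denominators in L / (2((1 + L)n + L)) ≤ 1/(2 + 4n) leaves 2nL ≤ 2n,
  -- that is, L ≤ 1. The error is taken as ½/(2 + 4n), so that it becomes ½ after multiplication.
  waiter-threshold : ∀ n q a → .{{_ : ℕ.NonZero n}} →
    fromℕ q ≤ᴿ fromℕ a *ᴿ (ln2 /ᴿ (fromℕ 2 *ᴿ ((fromℕ 1 +ᴿ ln2) *ᴿ fromℕ n +ᴿ ln2))) →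
    q ℕ.* (2 ℕ.+ 4 ℕ.* n) ℕ.≤ a
  waiter-threshold n q a h =
    let
      N , h′ = h (½ * inv W) (*-pos ½>0 (inv-pos W>0))
      -- The empty partial sum of the series for ln 2 is 0; from index 1 on it is at least ½, which
      -- makes the denominator positive.
      m = suc N
      L = seq ln2 m
    in ι-reflects-≤ (subst (_≤ ι a + ½) (sym (ι-* q (2 ℕ.+ 4 ℕ.* n)))
         (≤/+ε⇒*≤ (ι q) (ι a) W W>0 (≤-trans (h′ m (ℕ.n≤1+n N))
           (+-monoˡ-≤ (½ * inv W) (*-monoˡ-≤-nonNeg (ι a) {{nonNegative (/1-nn a)}}
             (quotient L (L≥½ m (ℕ.s≤s ℕ.z≤n)) (ln2≤1 m)))))))
    where
    open ≤-Reasoning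
    W : ℚ
    W = ι (2 ℕ.+ 4 ℕ.* n)
    W>0 : 0ℚ < W
    W>0 = /1-pos (2 ℕ.+ 4 ℕ.* n)
    L≥½ : ∀ m → 1 ℕ.≤ m → ½ ≤ seq ln2 m
    L≥½ = Positiveᴿ.isBound ln2-positive
    W≡ : W ≡ ι 2 + ι 4 * ι n
    W≡ = trans (ι-+ 2 (4 ℕ.* n)) (cong (λ z → ι 2 + z) (ι-* 4 n))
    quotient : ∀ L → ½ ≤ L → L ≤ 1ℚ → L * inv (ι 2 * ((ι 1 + L) * ι n + L)) ≤ inv W
    quotient L L≥ L≤ = begin
      L * inv D                      ≡⟨ *-identityʳ (L * inv D) ⟨
      L * inv D * 1ℚ                 ≡⟨ cong (L * inv D *_) (inv-inverse W>0) ⟨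
      L * inv D * (inv W * W)        ≡⟨ solve 4 (λ l d i w → l :* d :* (i :* w) := (d :* i) :* (l :* w)) refl L (inv D) (inv W) W ⟩
      inv D * inv W * (L * W)        ≤⟨ *-monoˡ-≤-nonNeg (inv D * inv W) {{nonNegative (*-nn (<⇒≤ (inv-pos D>0)) (<⇒≤ (inv-pos W>0)))}} LW≤D ⟩
      inv D * inv W * D              ≡⟨ solve 3 (λ d i e → d :* i :* e := i :* (d :* e)) refl (inv D) (inv W) D ⟩
      inv W * (inv D * D)            ≡⟨ cong (inv W *_) (inv-inverse D>0) ⟩
      inv W * 1ℚ                     ≡⟨ *-identityʳ (inv W) ⟩
      inv W                          ∎
      where
      D : ℚ
      D = ι 2 * ((ι 1 + L) * ι n + L)
      L>0 : 0ℚ < L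
      L>0 = <-≤-trans ½>0 L≥
      D>0 : 0ℚ < D
      D>0 = *-pos (/1-pos 2) (subst (0ℚ <_) (+-comm L ((ι 1 + L) * ι n))
        (+-pos L>0 (*-nn (+-nn (/1-nn 1) (<⇒≤ L>0)) (/1-nn n))))
      LW≤D : L * W ≤ D
      LW≤D = begin
        L * W                                      ≡⟨ cong (L *_) W≡ ⟩
        L * (ι 2 + ι 4 * ι n)                      ≡⟨ solve 2 (λ l n → l :* (con (ι 2) :+ con (ι 4) :* n) :=
                                                       con (ι 2) :* (l :* n :+ (l :* n :+ l))) refl L (ι n) ⟩
        ι 2 * (L * ι n + (L * ι n + L))            ≤⟨ *-monoˡ-≤-nonNeg (ι 2) (+-monoˡ-≤ (L * ι n + L)
                                                       (*-monoʳ-≤-nonNeg (ι n) {{nonNegative (/1-nn n)}} L≤)) ⟩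
        ι 2 * (1ℚ * ι n + (L * ι n + L))           ≡⟨ solve 2 (λ l n → con (ι 2) :* (con 1ℚ :* n :+ (l :* n :+ l)) :=
                                                       con (ι 2) :* ((con (ι 1) :+ l) :* n :+ l)) refl L (ι n) ⟩
        D                                          ∎

  -- The upper estimates `u m`, a partial sum plus 2 · ½^m, decrease from `u 0` = 1 + 2.
  e≤3 : ∀ m → seq e m ≤ ι 3
  e≤3 m = ≤-trans (s≤u m) (u-anti {0} {m} (ℕ.≤⇒≤′ ℕ.z≤n))
    where
    open Factorial-bounds
    open Geometric {e-partial}
      (λ m → subst (_≤ e-partial (suc m)) (+-identityʳ _)
        (+-monoʳ-≤ (e-partial m) (<⇒≤ (1/n-pos (suc m ℕ.!) {{ℕ._!≢0 (suc m)}}))))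
      (λ m → +-monoʳ-≤ (e-partial m) (1/!-≤ m))

  5/2≤e : ∀ m → 2 ℕ.≤ m → + 5 / 2 ≤ seq e m
  5/2≤e (suc zero) (ℕ.s≤s ())
  5/2≤e (suc (suc zero))        _ = from-yes (+ 5 / 2 ≤? seq e 2)
  5/2≤e (suc (suc m@(suc _)))   _ = ≤-trans (5/2≤e (suc m) (ℕ.s≤s (ℕ.s≤s ℕ.z≤n)))
    (subst (_≤ e-partial (suc (suc m))) (+-identityʳ _)
      (+-monoʳ-≤ (e-partial (suc m)) (<⇒≤ (1/n-pos (suc (suc m) ℕ.!) {{ℕ._!≢0 (suc (suc m))}}))))

  -- Were the lower end point below c - δ, the upper one would be at most c, yet its square exceeds
  -- p ≥ c².
  bisect-≥ : ∀ p m c δ → 0ℚ ≤ δ → c * c ≤ p → width p m ≤ δ → c - δ ≤ bisect p m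
  bisect-≥ p m c δ δ≥0 c²≤p w≤δ with c - δ ≤? bisect p m
  ... | yes h = h
  ... | no  h = contradiction (begin-strict
    p                                                      <⟨ bisect-upper p m ⟩
    (bisect p m + width p m) * (bisect p m + width p m)    ≤⟨ *-mono (≤-trans b+w≥0 b+w≤c) b+w≥0 b+w≤c b+w≤c ⟩
    c * c                                                  ≤⟨ c²≤p ⟩
    p                                                      ∎) (<-irrefl refl)
    where
    open ≤-Reasoning
    b+w≥0 : 0ℚ ≤ bisect p m + width p m
    b+w≥0 = +-nn (bisect-nn p m) (<⇒≤ (width-pos p m))
    b+w≤c : bisect p m + width p m ≤ c
    b+w≤c = begin
      bisect p m + width p m   ≤⟨ +-mono-≤ (<⇒≤ (≰⇒> h)) w≤δ ⟩
      c - δ + δ                ≡⟨ solve 2 (λ c d → c :- d :+ d := c) refl c δ ⟩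
      c                        ∎

  ½^-anti : ∀ {m n} → m ℕ.≤′ n → ½^ n ≤ ½^ m
  ½^-anti ℕ.≤′-refl     = ≤-refl
  ½^-anti {n = suc n} (ℕ.≤′-step h) = ≤-trans (½^-step n) (½^-anti h)

  -- After nine bisections of an interval of length at most 1 + 3 the width is at most 4/512 <
  -- 1/100, here and for √e. So 1.41 and 1.51, whose squares are at most 2 and 5/2, may be used with
  -- a loss of 1/100.
  √2≥7/5 : ∀ m → 9 ℕ.≤ m → + 7 / 5 ≤ seq (√ (fromℕ 2)) m
  √2≥7/5 m 9≤m = bisect-≥ (ι 2) m (+ 141 / 100) (+ 1 / 100) (from-yes (0ℚ ≤? + 1 / 100))
    (from-yes ((+ 141 / 100) * (+ 141 / 100) ≤? ι 2))
    (≤-trans (*-monoˡ-≤-nonNeg (1ℚ + ∣ ι 2 ∣) (½^-anti (ℕ.≤⇒≤′ 9≤m))) (from-yes ((1ℚ + ∣ ι 2 ∣) * ½^ 9 ≤? + 1 / 100)))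

  √e≥3/2 : ∀ m → 9 ℕ.≤ m → + 3 / 2 ≤ seq (√ e) m
  √e≥3/2 m 9≤m = bisect-≥ (seq e m) m (+ 151 / 100) (+ 1 / 100) (from-yes (0ℚ ≤? + 1 / 100))
    (≤-trans (from-yes ((+ 151 / 100) * (+ 151 / 100) ≤? + 5 / 2)) 5/2≤)
    (≤-trans (*-mono (from-yes (0ℚ ≤? 1ℚ + ι 3)) (½^-nn m)
      (+-monoʳ-≤ 1ℚ (subst (_≤ ι 3) (sym (0≤p⇒∣p∣≡p (≤-trans (from-yes (0ℚ ≤? + 5 / 2)) 5/2≤))) (e≤3 m)))
      (½^-anti (ℕ.≤⇒≤′ 9≤m))) (from-yes ((1ℚ + ι 3) * ½^ 9 ≤? + 1 / 100)))
    where
    5/2≤ : + 5 / 2 ≤ seq e m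
    5/2≤ = 5/2≤e m (ℕ.≤-trans (ℕ.s≤s (ℕ.s≤s ℕ.z≤n)) 9≤m)

  1≤pow : ∀ x m → 1ℚ ≤ seq x m → ∀ k → 1ℚ ≤ seq (x ^ᴿ k) m
  1≤pow x m 1≤x zero    = ≤-refl
  1≤pow x m 1≤x (suc k) = *-mono {1ℚ} {seq x m} {1ℚ} (≤-trans (from-yes (0ℚ ≤? 1ℚ)) 1≤x) (from-yes (0ℚ ≤? 1ℚ)) 1≤x (1≤pow x m 1≤x k)

  pow-step : ∀ x m {c d r} k → 0ℚ ≤ c → 0ℚ ≤ d → r ≤ c * d → c ≤ seq x m → d ≤ seq (x ^ᴿ k) m →
    r ≤ seq (x ^ᴿ suc k) m
  pow-step x m k 0≤c 0≤d r≤ c≤ d≤ = ≤-trans r≤ (*-mono (≤-trans 0≤c c≤) 0≤d c≤ d≤)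

  √2^≥19/10 : ∀ k m → 9 ℕ.≤ m → + 19 / 10 ≤ seq (√ (fromℕ 2) ^ᴿ (2 ℕ.+ k)) m
  √2^≥19/10 k m 9≤m =
    pow-step √2 m {+ 7 / 5} {+ 7 / 5} (1 ℕ.+ k) (from-yes (0ℚ ≤? + 7 / 5)) (from-yes (0ℚ ≤? + 7 / 5)) (from-yes (+ 19 / 10 ≤? + 7 / 5 * (+ 7 / 5))) √2≥
    (pow-step √2 m {+ 7 / 5} {1ℚ} k (from-yes (0ℚ ≤? + 7 / 5)) (from-yes (0ℚ ≤? 1ℚ)) (from-yes (+ 7 / 5 ≤? + 7 / 5 * 1ℚ)) √2≥
    (1≤pow √2 m (≤-trans (from-yes (1ℚ ≤? + 7 / 5)) √2≥) k))
    where
    √2 : ℝ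
    √2 = √ (fromℕ 2)
    √2≥ : + 7 / 5 ≤ seq √2 m
    √2≥ = √2≥7/5 m 9≤m

  -- Four factors of at least 3/2 and k factors of at least 1. The cube 27/8 is rounded down to
  -- 10/3, so that the next product is exactly 5.
  √e^≥5 : ∀ k m → 9 ℕ.≤ m → ι 5 ≤ seq (√ e ^ᴿ (4 ℕ.+ k)) m
  √e^≥5 k m 9≤m =
    step {+ 10 / 3} {ι 5} (3 ℕ.+ k) (from-yes (0ℚ ≤? + 10 / 3)) (from-yes (ι 5 ≤? + 3 / 2 * (+ 10 / 3)))
    (step {+ 9 / 4} {+ 10 / 3} (2 ℕ.+ k) (from-yes (0ℚ ≤? + 9 / 4)) (from-yes (+ 10 / 3 ≤? + 3 / 2 * (+ 9 / 4)))
    (step {+ 3 / 2} {+ 9 / 4} (1 ℕ.+ k) (from-yes (0ℚ ≤? + 3 / 2)) (from-yes (+ 9 / 4 ≤? + 3 / 2 * (+ 3 / 2)))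
    (step {1ℚ} {+ 3 / 2} k (from-yes (0ℚ ≤? 1ℚ)) (from-yes (+ 3 / 2 ≤? + 3 / 2 * 1ℚ))
    (1≤pow (√ e) m (≤-trans (from-yes (1ℚ ≤? + 3 / 2)) √e≥) k))))
    where
    √e≥ : + 3 / 2 ≤ seq (√ e) m
    √e≥ = √e≥3/2 m 9≤m
    step : ∀ {d r} j → 0ℚ ≤ d → r ≤ + 3 / 2 * d → d ≤ seq (√ e ^ᴿ j) m → r ≤ seq (√ e ^ᴿ suc j) m
    step {d} {r} j 0≤d r≤ d≤ = pow-step (√ e) m {+ 3 / 2} {d} {r} j (from-yes (0ℚ ≤? + 3 / 2)) 0≤d r≤ √e≥ d≤

  product≥18 : ∀ {x y z} → + 19 / 10 ≤ x → ι 5 ≤ y → ι 2 ≤ z → ι 18 ≤ x * y * z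
  product≥18 {x} {y} {z} hx hy hz = begin
    ι 18                     ≤⟨ from-yes (ι 18 ≤? + 19 / 10 * ι 5 * ι 2) ⟩
    + 19 / 10 * ι 5 * ι 2    ≤⟨ *-mono {+ 19 / 10 * ι 5} {x * y} {ι 2} {z} (*-nn x≥0 y≥0) (/1-nn 2)
                                  (*-mono {+ 19 / 10} {x} {ι 5} {y} x≥0 (/1-nn 5) hx hy) hz ⟩
    x * y * z                ∎
    where
    open ≤-Reasoning
    x≥0 : 0ℚ ≤ x
    x≥0 = ≤-trans (from-yes (0ℚ ≤? + 19 / 10)) hx
    y≥0 : 0ℚ ≤ y
    y≥0 = ≤-trans (/1-nn 5) hy

  -- The powers of √2 and √e stand for 2^(k/2) and e^(k/2+1). For k ≥ 2 they and the factor k are at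
  -- least 19/10, 5 and 2, with product 19.
  client-threshold : ∀ k n q b → .{{_ : ℕ.NonZero n}} → 2 ℕ.≤ k →
    √ (fromℕ 2) ^ᴿ k *ᴿ √ e ^ᴿ (k ℕ.+ 2) *ᴿ fromℕ k *ᴿ fromℕ b /ᴿ fromℕ n ≤ᴿ fromℕ q →
    18 ℕ.* b ℕ.≤ q ℕ.* n
  client-threshold (suc zero) n q b (ℕ.s≤s ()) _
  client-threshold k@(suc (suc k′)) n q b 2≤k h =
    let
      N , h′ = h (½ * inv (ι n)) (*-pos ½>0 (inv-pos n>0))
      -- Nine further steps make the bisections for √2 and √e accurate enough.
      m = N ℕ.+ 9
    in ι-reflects-≤ (subst₂ _≤_ (sym (ι-* 18 b)) (cong (_+ ½) (sym (ι-* q n)))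
         (bound m (ℕ.m≤n+m 9 N) (h′ m (ℕ.m≤m+n N 9))))
    where
    open ≤-Reasoning
    n>0 : 0ℚ < ι n
    n>0 = /1-pos n
    18≤ : ∀ m → 9 ℕ.≤ m → ι 18 ≤ seq (√ (fromℕ 2) ^ᴿ k) m * seq (√ e ^ᴿ (k ℕ.+ 2)) m * ι k
    18≤ m 9≤m = product≥18 (√2^≥19/10 k′ m 9≤m)
      (subst (λ z → ι 5 ≤ seq (√ e ^ᴿ z) m) (ℕ.+-comm 2 k) (√e^≥5 k′ m 9≤m)) (/1-mono 2≤k)
    bound : ∀ m → 9 ℕ.≤ m → seq (√ (fromℕ 2) ^ᴿ k *ᴿ √ e ^ᴿ (k ℕ.+ 2) *ᴿ fromℕ k) m * ι b * inv (ι n) ≤ ι q + ½ * inv (ι n) →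
      ι 18 * ι b ≤ ι q * ι n + ½
    bound m 9≤m h = begin
      ι 18 * ι b                            ≤⟨ *-monoʳ-≤-nonNeg (ι b) {{nonNegative (/1-nn b)}} (18≤ m 9≤m) ⟩
      X * ι b                               ≡⟨ *-identityʳ (X * ι b) ⟨
      X * ι b * 1ℚ                          ≡⟨ cong (X * ι b *_) (inv-inverse n>0) ⟨
      X * ι b * (inv (ι n) * ι n)           ≡⟨ *-assoc (X * ι b) (inv (ι n)) (ι n) ⟨
      X * ι b * inv (ι n) * ι n             ≤⟨ *-monoʳ-≤-nonNeg (ι n) {{nonNegative (/1-nn n)}} h ⟩
      (ι q + ½ * inv (ι n)) * ι n           ≡⟨ solve 3 (λ q i n → (q :+ con ½ :* i) :* n := q :* n :+ con ½ :* (i :* n))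
                                                refl (ι q) (inv (ι n)) (ι n) ⟩
      ι q * ι n + ½ * (inv (ι n) * ι n)     ≡⟨ cong (λ z → ι q * ι n + ½ * z) (inv-inverse n>0) ⟩
      ι q * ι n + ½ * 1ℚ                    ≡⟨ cong (λ z → ι q * ι n + z) (*-identityʳ ½) ⟩
      ι q * ι n + ½                         ∎
      where
      X : ℚ
      X = seq (√ (fromℕ 2) ^ᴿ k *ᴿ √ e ^ᴿ (k ℕ.+ 2) *ᴿ fromℕ k) m

-- Seymour's theorem on expanding hypergraphs.

module Seymour where

  open import Data.Nat.Base as ℕ using (ℕ; zero; suc; s≤s; z≤n)
  import Data.Nat.Properties as ℕ
  open import Data.Integer.Base hiding (suc)
  open import Data.Integer.Properties
  open import Data.Integer.Tactic.RingSolver using (solve-∀)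
  open import Data.Bool.Base using (if_then_else_)
  open import Data.Fin.Base using (Fin; zero; suc)
  import Data.Fin.Properties as Fin
  open import Data.Fin.Subset as Subset using (Subset; inside; outside; ⋃; ⁅_⁆) renaming (_∈_ to _∈ₛ_; ∣_∣ to size)
  import Data.Fin.Subset.Properties as Subset
  open import Data.Vec.Base as Vec using (Vec; []; _∷_; lookup; head)
  open import Data.Vec.Properties using (lookup-map)
  open import Data.Vec.Base using (here; there)
  open import Data.List.Base as List using (List; []; _∷_; _++_; filter; length)
  open import Data.List.Properties using (length-map; length-++; filter-notAll)
  open import Data.List.Membership.Propositional using (_∈_; find; lose)
  open import Data.List.Membership.Propositional.Properties using (∈-map⁺; ∈-++⁺ˡ; ∈-++⁺ʳ; ∈-filter⁺)
  import Data.List.Relation.Unary.Any as Any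
  open import Data.List.Relation.Binary.Sublist.Propositional using ()
    renaming (_⊆_ to _⊑_; ⊆-trans to ⊑-trans; ⊆-refl to ⊑-refl)
  open import Data.List.Relation.Binary.Sublist.Propositional.Properties using () renaming (filter-⊆ to filter-⊑)
  open import Data.List.Relation.Binary.Permutation.Propositional.Properties using (∈-resp-↭; ↭-length)
  open import Data.Product using (∃-syntax; _×_; _,_)
  open import Data.Sum.Base using (inj₁; inj₂)
  open import Function using (_∘_)
  open import Relation.Nullary using (¬_; yes; no; Dec; contradiction; ¬?; _→-dec_)
  open import Relation.Nullary.Decidable using (decidable-stable)
  open import Relation.Binary.PropositionalEquality
  open Sums
  open Hypergraphs

  dot : ∀ {n} → Vec ℤ n → Vec ℤ n → ℤ
  dot []      []      = 0ℤ
  dot (a ∷ r) (x ∷ y) = a * x + dot r y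

  dot-zeroʳ : ∀ {n} (r : Vec ℤ n) → dot r (Vec.replicate n 0ℤ) ≡ 0ℤ
  dot-zeroʳ []      = refl
  dot-zeroʳ (a ∷ r) = trans (cong₂ _+_ (*-zeroʳ a) (dot-zeroʳ r)) refl

  dot-scale : ∀ {n} a (r y : Vec ℤ n) → dot r (Vec.map (a *_) y) ≡ a * dot r y
  dot-scale a []      []      = sym (*-zeroʳ a)
  dot-scale a (b ∷ r) (x ∷ y) = trans (cong (_+_ (b * (a * x))) (dot-scale a r y)) (factor a b x (dot r y))
    where
    factor : ∀ a b x d → b * (a * x) + a * d ≡ a * (b * x + d)
    factor = solve-∀

  -- Fraction-free Gaussian elimination of the first unknown: a times the row minus b times the
  -- pivot row `a ∷ p`, so that all entries stay integral.
  eliminate : ∀ {n} → ℤ → Vec ℤ n → Vec ℤ (suc n) → Vec ℤ n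
  eliminate a p (b ∷ s) = Vec.zipWith (λ u v → a * u - b * v) s p

  dot-eliminate : ∀ {n} a b (s p y : Vec ℤ n) →
    dot (eliminate a p (b ∷ s)) y ≡ a * dot s y - b * dot p y
  dot-eliminate a b []      []      []      = zeros a b
    where
    zeros : ∀ a b → 0ℤ ≡ a * 0ℤ - b * 0ℤ
    zeros = solve-∀
  dot-eliminate a b (u ∷ s) (v ∷ p) (x ∷ y) =
    trans (cong (_+_ ((a * u - b * v) * x)) (dot-eliminate a b s p y)) (regroup a b u v x (dot s y) (dot p y))
    where
    regroup : ∀ a b u v x d e → (a * u - b * v) * x + (a * d - b * e) ≡ a * (u * x + d) - b * (v * x + e)
    regroup = solve-∀

  kernel : ∀ {n} (rows : List (Vec ℤ n)) → length rows ℕ.< n →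
    ∃[ x ] (∃[ v ] lookup x v ≢ 0ℤ) × (∀ {r} → r ∈ rows → dot r x ≡ 0ℤ)
  kernel {suc n} rows few with Any.any? (λ r → ¬? (head r ≟ 0ℤ)) rows
  ... | no none = 1ℤ ∷ Vec.replicate n 0ℤ , (zero , λ ()) , λ {r} r∈ → vanishes r
          (decidable-stable (head r ≟ 0ℤ) (λ r₀≢0 → none (lose r∈ r₀≢0)))
    where
    vanishes : ∀ r → head r ≡ 0ℤ → dot r (1ℤ ∷ Vec.replicate n 0ℤ) ≡ 0ℤ
    vanishes (_ ∷ r) refl = trans (+-identityˡ _) (dot-zeroʳ r)
  ... | yes some with find some
  ...   | (a ∷ p) , p∈ , a≢0 with ∈⇒↭ p∈
  ...     | rest , π with kernel (List.map (eliminate a p) rest)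
                (subst (ℕ._< n) (sym (length-map (eliminate a p) rest))
                  (ℕ.≤-pred (subst (ℕ._< suc n) (↭-length π) few)))
  ...       | y , (v , yᵥ≢0) , ker = x , (suc v , nonzero) , λ r∈ → orthogonal (∈-resp-↭ π r∈)
    where
    x : Vec ℤ (suc n)
    -- Back-substitution: the pivot row would require the first entry - (p · y) / a, so the whole
    -- solution is multiplied by a.
    x = - dot p y ∷ Vec.map (a *_) y
    nonzero : lookup x (suc v) ≢ 0ℤ
    nonzero eq with i*j≡0⇒i≡0∨j≡0 a (trans (sym (lookup-map v (a *_) y)) eq)
    ... | inj₁ a≡0 = a≢0 a≡0
    ... | inj₂ y≡0 = yᵥ≢0 y≡0
    pivot : ∀ a d → a * - d + a * d ≡ 0ℤ
    pivot = solve-∀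
    other : ∀ a b d e → b * - d + a * e ≡ a * e - b * d
    other = solve-∀
    orthogonal : ∀ {r} → r ∈ (a ∷ p) ∷ rest → dot r x ≡ 0ℤ
    orthogonal (Any.here refl) = trans (cong (_+_ (a * - dot p y)) (dot-scale a p y)) (pivot a (dot p y))
    orthogonal {b ∷ s} (Any.there r∈) = trans (cong (_+_ (b * - dot p y)) (dot-scale a s y))
      (trans (other a b (dot p y) (dot s y)) (trans (sym (dot-eliminate a b s p y)) (ker (∈-map⁺ (eliminate a p) r∈))))

  incidence : ∀ {n} → Subset n → Vec ℤ n
  incidence = Vec.map (λ s → if s then 1ℤ else 0ℤ)

  nonneg-on⇒0≤dot : ∀ {n} (A : Subset n) x → (∀ {v} → v ∈ₛ A → 0ℤ ≤ lookup x v) → 0ℤ ≤ dot (incidence A) x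
  nonneg-on⇒0≤dot []            []      _ = ≤-refl
  nonneg-on⇒0≤dot (inside ∷ A)  (a ∷ x) h = +-mono-≤ (subst (0ℤ ≤_) (sym (*-identityˡ a)) (h here))
    (nonneg-on⇒0≤dot A x (h ∘ there))
  nonneg-on⇒0≤dot (outside ∷ A) (a ∷ x) h = subst (0ℤ ≤_) (sym (+-identityˡ _)) (nonneg-on⇒0≤dot A x (h ∘ there))

  lookup≤dot : ∀ {n} (A : Subset n) x → (∀ {v} → v ∈ₛ A → 0ℤ ≤ lookup x v) →
    ∀ {v} → v ∈ₛ A → lookup x v ≤ dot (incidence A) x
  lookup≤dot (inside ∷ A)  (a ∷ x) h here = ≤-trans (≤-reflexive (trans (sym (*-identityˡ a)) (sym (+-identityʳ _))))
    (+-monoʳ-≤ (1ℤ * a) (nonneg-on⇒0≤dot A x (h ∘ there)))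
  lookup≤dot (inside ∷ A)  (a ∷ x) h (there {i = v} v∈A) = ≤-trans (≤-reflexive (sym (+-identityˡ (lookup x v))))
    (+-mono-≤ (subst (0ℤ ≤_) (sym (*-identityˡ a)) (h here)) (lookup≤dot A x (h ∘ there) v∈A))
  lookup≤dot (outside ∷ A) (a ∷ x) h (there v∈A) = ≤-trans (lookup≤dot A x (h ∘ there) v∈A)
    (≤-reflexive (sym (+-identityˡ _)))

  -- The product with an incidence row is the sum of the entries over the edge, and non-negative
  -- numbers with sum 0 all vanish.
  nonneg-on⇒zero-on : ∀ {n} (A : Subset n) x → dot (incidence A) x ≡ 0ℤ →
    (∀ {v} → v ∈ₛ A → 0ℤ ≤ lookup x v) → ∀ {v} → v ∈ₛ A → lookup x v ≡ 0ℤ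
  nonneg-on⇒zero-on A x eq h {v} v∈A = ≤-antisym (subst (lookup x v ≤_) eq (lookup≤dot A x h v∈A)) (h v∈A)

  nonpos-on⇒zero-on : ∀ {n} (A : Subset n) x → dot (incidence A) x ≡ 0ℤ →
    (∀ {v} → v ∈ₛ A → lookup x v ≤ 0ℤ) → ∀ {v} → v ∈ₛ A → lookup x v ≡ 0ℤ
  nonpos-on⇒zero-on A x eq h {v} v∈A = neg-zero (trans (sym (lookup-neg v)) (nonneg-on⇒zero-on A (Vec.map (-1ℤ *_) x)
    (trans (dot-scale -1ℤ (incidence A) x) (trans (cong (-1ℤ *_) eq) (*-zeroʳ -1ℤ)))
    (λ {u} u∈A → subst (0ℤ ≤_) (sym (lookup-neg u)) (neg-mono-≤ (h u∈A))) v∈A))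
    where
    lookup-neg : ∀ u → lookup (Vec.map (-1ℤ *_) x) u ≡ - lookup x u
    lookup-neg u = trans (lookup-map u (-1ℤ *_) x) (-1*i≡-i (lookup x u))
    neg-zero : ∀ {i} → - i ≡ 0ℤ → i ≡ 0ℤ
    neg-zero {i} eq = trans (sym (neg-involutive i)) (cong -_ eq)

  -- Used as additional rows of the linear system, these force a kernel vector to vanish off `U`.
  singletonsOutside : ∀ {n} → Subset n → List (Subset n)
  singletonsOutside []            = []
  singletonsOutside (inside ∷ U)  = List.map (outside ∷_) (singletonsOutside U)
  singletonsOutside (outside ∷ U) = (inside ∷ Subset.⊥) ∷ List.map (outside ∷_) (singletonsOutside U)

  size-singletonsOutside : ∀ {n} (U : Subset n) → length (singletonsOutside U) ℕ.+ size U ≡ n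
  size-singletonsOutside []            = refl
  size-singletonsOutside (inside ∷ U)  = trans (ℕ.+-suc _ (size U)) (cong suc
    (trans (cong (ℕ._+ size U) (length-map _ (singletonsOutside U))) (size-singletonsOutside U)))
  size-singletonsOutside (outside ∷ U) = cong suc
    (trans (cong (ℕ._+ size U) (length-map _ (singletonsOutside U))) (size-singletonsOutside U))

  ∈-singletonsOutside : ∀ {n} (U : Subset n) {v} → ¬ v ∈ₛ U → ⁅ v ⁆ ∈ singletonsOutside U
  ∈-singletonsOutside (inside ∷ U)  {zero}  v∉U = contradiction here v∉U
  ∈-singletonsOutside (outside ∷ U) {zero}  v∉U = Any.here refl
  ∈-singletonsOutside (inside ∷ U)  {suc v} v∉U = ∈-map⁺ (outside ∷_) (∈-singletonsOutside U (v∉U ∘ there))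
  ∈-singletonsOutside (outside ∷ U) {suc v} v∉U = Any.there (∈-map⁺ (outside ∷_) (∈-singletonsOutside U (v∉U ∘ there)))

  ∈-⋃⁻ : ∀ {n} (T : List (Subset n)) {v} → v ∈ₛ ⋃ T → ∃[ A ] A ∈ T × v ∈ₛ A
  ∈-⋃⁻ []      v∈ = contradiction v∈ Subset.∉⊥
  ∈-⋃⁻ (A ∷ T) v∈ with Subset.x∈p∪q⁻ A (⋃ T) v∈
  ... | inj₁ v∈A = A , Any.here refl , v∈A
  ... | inj₂ v∈T with ∈-⋃⁻ T v∈T
  ...   | B , B∈T , v∈B = B , Any.there B∈T , v∈B

  -- The singletons outside the union complete the system to fewer than n equations and confine the
  -- non-zero entry to a vertex of some edge. The vector then does not vanish on that edge, so the
  -- induction in Seymour's theorem makes progress.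
  kernel-on-⋃ : ∀ {n} (T : List (Subset n)) → length T ℕ.< size (⋃ T) →
    ∃[ x ] (∃[ v ] v ∈ₛ ⋃ T × lookup x v ≢ 0ℤ) × (∀ {A} → A ∈ T → dot (incidence A) x ≡ 0ℤ)
  kernel-on-⋃ {n} T few with kernel (List.map incidence (T ++ singletonsOutside (⋃ T))) count
    where
    open ℕ.≤-Reasoning
    count : length (List.map incidence (T ++ singletonsOutside (⋃ T))) ℕ.< n
    count = begin-strict
      length (List.map incidence (T ++ singletonsOutside (⋃ T)))   ≡⟨ length-map incidence (T ++ singletonsOutside (⋃ T)) ⟩
      length (T ++ singletonsOutside (⋃ T))                        ≡⟨ length-++ T ⟩
      length T ℕ.+ length (singletonsOutside (⋃ T))                <⟨ ℕ.+-monoˡ-< _ few ⟩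
      size (⋃ T) ℕ.+ length (singletonsOutside (⋃ T))              ≡⟨ ℕ.+-comm (size (⋃ T)) _ ⟩
      length (singletonsOutside (⋃ T)) ℕ.+ size (⋃ T)              ≡⟨ size-singletonsOutside (⋃ T) ⟩
      n                                                            ∎
  ... | x , (v , xᵥ≢0) , ker = x , (v , decidable-stable (v Subset.∈? ⋃ T) inside-⋃ , xᵥ≢0)
                               , λ A∈ → ker (∈-map⁺ incidence (∈-++⁺ˡ A∈))
    where
    dot≡0⇒zero : dot (incidence ⁅ v ⁆) x ≡ 0ℤ → lookup x v ≡ 0ℤ
    dot≡0⇒zero eq with ≤-total 0ℤ (lookup x v)
    ... | inj₁ h = nonneg-on⇒zero-on ⁅ v ⁆ x eq (λ u∈ → subst (λ u → 0ℤ ≤ lookup x u) (sym (Subset.x∈⁅y⁆⇒x≡y v u∈)) h) (Subset.x∈⁅x⁆ v)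
    ... | inj₂ h = nonpos-on⇒zero-on ⁅ v ⁆ x eq (λ u∈ → subst (λ u → lookup x u ≤ 0ℤ) (sym (Subset.x∈⁅y⁆⇒x≡y v u∈)) h) (Subset.x∈⁅x⁆ v)
    inside-⋃ : ¬ ¬ v ∈ₛ ⋃ T
    inside-⋃ v∉ = xᵥ≢0 (dot≡0⇒zero (ker (∈-map⁺ incidence (∈-++⁺ʳ T (∈-singletonsOutside (⋃ T) v∉)))))

  zero-on? : ∀ {n} (x : Vec ℤ n) (A : Subset n) → Dec (∀ v → v ∈ₛ A → lookup x v ≡ 0ℤ)
  zero-on? x A = Fin.all? (λ v → (v Subset.∈? A) →-dec (lookup x v ≟ 0ℤ))

  signColour : ℤ → Fin 2 → Fin 2
  signColour +[1+ _ ] _ = zero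
  signColour -[1+ _ ] _ = suc zero
  signColour +0       c = c

  -- Stated for sublists, so that it passes to a filtered list by transitivity.
  Expanding : ∀ {n} → List (Subset n) → Set
  Expanding F = ∀ {T} → T ⊑ F → T ≢ [] → length T ℕ.< size (⋃ T)

  -- Seymour: vertices where a kernel vector of the incidence matrix is non-zero
  -- are coloured by its sign, and the edges on which it vanishes by induction.
  expanding⇒2-colourable : ∀ {n} m (F : List (Subset n)) → length F ℕ.≤ m → Expanding F →
    ∃[ φ ] Proper {r = 2} F φ
  expanding⇒2-colourable m       []        _         _    = (λ _ → zero) , λ _ ()
  expanding⇒2-colourable {n} (suc m) F@(_ ∷ _) (s≤s |F|≤) expd with kernel-on-⋃ F (expd ⊑-refl (λ ()))
  ... | x , (v , v∈ , xᵥ≢0) , ker with expanding⇒2-colourable m F₀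
            (ℕ.≤-pred (ℕ.≤-trans (filter-notAll (zero-on? x) F some-nonvanishing) (s≤s |F|≤)))
            (λ T⊑F₀ → expd (⊑-trans T⊑F₀ (filter-⊑ (zero-on? x) F)))
    where
    F₀ : List (Subset n)
    F₀ = filter (zero-on? x) F
    some-nonvanishing : Any.Any (λ A → ¬ (∀ u → u ∈ₛ A → lookup x u ≡ 0ℤ)) F
    some-nonvanishing with ∈-⋃⁻ F v∈
    ... | A , A∈F , v∈A = lose A∈F (λ vanish → xᵥ≢0 (vanish v v∈A))
  ... | ψ , ψ-proper = φ , proper
    where
    φ : Fin n → Fin 2
    φ u = signColour (lookup x u) (ψ u)
    vanishing⇒¬mono : ∀ i {A} → A ∈ F → (∀ {u} → u ∈ₛ A → φ u ≡ i) → ¬ (∀ {u} → u ∈ₛ A → lookup x u ≡ 0ℤ)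
    vanishing⇒¬mono i A∈ mono vanish = ψ-proper i (∈-filter⁺ (zero-on? x) A∈ (λ u → vanish))
      (λ {u} u∈A → trans (cong (λ z → signColour z (ψ u)) (sym (vanish u∈A))) (mono u∈A))
    colour-0 : ∀ z c → signColour z c ≡ zero → 0ℤ ≤ z
    colour-0 (+ _)    _ _  = +≤+ z≤n
    colour-0 -[1+ _ ] _ ()
    colour-1 : ∀ z c → signColour z c ≡ suc zero → z ≤ 0ℤ
    colour-1 +0       _ _  = ≤-refl
    colour-1 +[1+ _ ] _ ()
    colour-1 -[1+ _ ] _ _  = -≤+
    -- On a monochromatic edge x takes no values of one of the two signs, and these values sum to 0,
    -- so x vanishes there. Then `φ` agrees with `ψ` on the edge, which is not monochromatic under
    -- `ψ`.
    proper : Proper F φ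
    proper zero       {A} A∈ mono = vanishing⇒¬mono zero A∈ mono
      (nonneg-on⇒zero-on A x (ker A∈) (λ {u} u∈A → colour-0 _ (ψ u) (mono u∈A)))
    proper (suc zero) {A} A∈ mono = vanishing⇒¬mono (suc zero) A∈ mono
      (nonpos-on⇒zero-on A x (ker A∈) (λ {u} u∈A → colour-1 _ (ψ u) (mono u∈A)))

-- Client's potential: never claiming a whole set of a family.

module ClientGame where

  open import Data.Bool.Base using (if_then_else_)
  open import Data.Nat.Base
  open import Data.Nat.Properties
  open import Data.Nat.Tactic.RingSolver using (solve-∀)
  open import Data.List.Base using (List; []; _∷_; _++_; length)
  open import Data.List.Properties using (++-identityʳ)
  open import Data.List.Membership.Propositional using (_∈_; _∉_)
  open import Data.List.Membership.Propositional.Properties using (∈-++⁺ˡ; ∈-++⁺ʳ)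
  open import Data.List.Relation.Binary.Subset.Propositional using (_⊆_)
  open import Data.List.Relation.Unary.Any using (here; there)
  open import Data.List.Relation.Unary.All using ([]; _∷_)
  open import Data.List.Relation.Unary.All.Properties using (¬Any⇒All¬; All¬⇒¬Any)
  open import Data.List.Relation.Unary.Unique.Propositional using (Unique; []; _∷_)
  open import Data.List.Relation.Unary.Unique.Propositional.Properties using (Unique[x∷xs]⇒x∉xs)
  open import Data.List.Relation.Binary.Permutation.Propositional using (_↭_; ↭-sym; ↭-trans; ↭⇒↭ₛ)
  open import Data.List.Relation.Binary.Permutation.Propositional.Properties using (++⁺ʳ; ∈-resp-↭; shift; ++-assoc)
  import Data.List.Relation.Binary.Permutation.Setoid.Properties as PermSetoid
  open import Data.Product using (∃-syntax; _×_; _,_; proj₁; proj₂)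
  open import Function using (_∘_)
  open import Relation.Nullary using (¬_; yes; no; does; contradiction)
  open import Relation.Binary using (DecidableEquality)
  open import Relation.Binary.PropositionalEquality
  open import Defs
  open Sums
  open WaiterGame using (indicator)

  Unique-resp-↭ : ∀ {A : Set} {xs ys : List A} → xs ↭ ys → Unique xs → Unique ys
  Unique-resp-↭ p = PermSetoid.Unique-resp-↭ (setoid _) (↭⇒↭ₛ p)

  unique-++ʳ : ∀ {A : Set} (xs : List A) {ys} → Unique (xs ++ ys) → Unique ys
  unique-++ʳ []       u       = u
  unique-++ʳ (_ ∷ xs) (_ ∷ u) = unique-++ʳ xs u

  unique-++ˡ : ∀ {A : Set} (xs : List A) {ys} → Unique (xs ++ ys) → Unique xs
  unique-++ˡ []       u       = []
  unique-++ˡ (x ∷ xs) (a ∷ u) = ¬Any⇒All¬ xs (All¬⇒¬Any a ∘ ∈-++⁺ˡ) ∷ unique-++ˡ xs u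

  unique-++-disjoint : ∀ {A : Set} (xs : List A) {ys x} → Unique (xs ++ ys) → x ∈ xs → x ∉ ys
  unique-++-disjoint (x ∷ xs) (a ∷ _) (here refl) x∈ys = All¬⇒¬Any a (∈-++⁺ʳ xs x∈ys)
  unique-++-disjoint (_ ∷ xs) (_ ∷ u) (there x∈)  x∈ys = unique-++-disjoint xs u x∈ x∈ys

  argmin : ∀ {A : Set} (f : A → ℕ) xs → 1 ≤ length xs → ∃[ x ] x ∈ xs × (∀ {y} → y ∈ xs → f x ≤ f y)
  argmin f (x ∷ [])          _ = x , here refl , λ { (here refl) → ≤-refl }
  argmin f (x ∷ xs@(_ ∷ _)) _ with argmin f xs (s≤s z≤n)
  ... | y , y∈ , min with f x ≤? f y
  ...   | yes fx≤fy = x , here refl , λ { (here refl) → ≤-refl ; (there z∈) → ≤-trans fx≤fy (min z∈) }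
  ...   | no  fx≰fy = y , there y∈ , λ { (here refl) → <⇒≤ (≰⇒> fx≰fy) ; (there z∈) → min z∈ }

  -- A set T has weight (q + 1)^(M - |T| + j), where j is the number of its elements
  -- held by Client, and weight 0 once Waiter holds one of its elements.  Averaged
  -- over Client's q + 1 possible answers, the potential does not increase.
  module Avoidance {X : Set} (_≟ₓ_ : DecidableEquality X) (board : List X) (unique-board : Unique board)
    (q : ℕ) (family : List (List X)) (unique-sets : ∀ {T} → T ∈ family → Unique T) (M : ℕ) where

    open import Data.List.Membership.DecPropositional _≟ₓ_ using (_∈?_)

    Q : ℕ
    Q = suc q

    factor : (free client : List X) → X → ℕ
    factor free client y = if does (y ∈? client) then Q else indicator (does (y ∈? free))

    ∏ : (free client T : List X) → ℕ
    ∏ free client []      = 1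
    ∏ free client (y ∷ T) = factor free client y * ∏ free client T

    weight : (free client T : List X) → ℕ
    weight free client T = Q ^ (M ∸ length T) * ∏ free client T

    Φ : (free client : List X) → ℕ
    Φ free client = ∑ (weight free client) family

    factor-mono : ∀ {rem free client y} → (y ∈ rem → y ∈ free) → factor rem client y ≤ factor free client y
    factor-mono {rem} {free} {client} {y} sub with y ∈? client
    ... | yes _ = ≤-refl
    ... | no  _ with y ∈? rem | y ∈? free
    ...   | yes y∈ | no y∉ = contradiction (sub y∈) y∉
    ...   | yes _  | yes _ = ≤-refl
    ...   | no _   | _     = z≤n

    factor-∷ : ∀ {free client x y} → y ≢ x → factor free (x ∷ client) y ≤ factor free client y
    factor-∷ {free} {client} {x} {y} y≢x with y ≟ₓ x | y ∈? client
    ... | yes y≡x | _     = contradiction y≡x y≢x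
    ... | no _    | yes _ = ≤-refl
    ... | no _    | no _  = ≤-refl

    factor-client : ∀ {free client y} → y ∈ client → factor free client y ≡ Q
    factor-client {free} {client} {y} y∈ with y ∈? client
    ... | yes _ = refl
    ... | no y∉ = contradiction y∈ y∉

    factor-free : ∀ {free client y} → y ∉ client → y ∈ free → factor free client y ≡ 1
    factor-free {free} {client} {y} y∉ y∈ with y ∈? client
    ... | yes y∈c = contradiction y∈c y∉
    ... | no _ with y ∈? free
    ...   | yes _  = refl
    ...   | no y∉f = contradiction y∈ y∉f

    factor-waiter : ∀ {free client y} → y ∉ client → y ∉ free → factor free client y ≡ 0
    factor-waiter {free} {client} {y} y∉ y∉f with y ∈? client
    ... | yes y∈c = contradiction y∈c y∉
    ... | no _ with y ∈? free
    ...   | yes y∈ = contradiction y∈ y∉f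
    ...   | no _   = refl

    ∏-mono : ∀ {free client free′ client′} T → (∀ {y} → y ∈ T → factor free client y ≤ factor free′ client′ y) →
      ∏ free client T ≤ ∏ free′ client′ T
    ∏-mono []      _ = ≤-refl
    ∏-mono (y ∷ T) h = *-mono-≤ (h (here refl)) (∏-mono T (h ∘ there))

    ∏-client : ∀ {free client} T → T ⊆ client → ∏ free client T ≡ Q ^ length T
    ∏-client []      _   = refl
    ∏-client {free} {client} (y ∷ T) T⊆ = cong₂ _*_ (factor-client {free} {client} (T⊆ (here refl))) (∏-client T (T⊆ ∘ there))

    module Round {free client O rem : List X} (π : free ↭ O ++ rem) (|O| : length O ≡ Q)
      (unique : Unique (O ++ rem ++ client)) where

      rem⊆free : rem ⊆ free
      rem⊆free y∈ = ∈-resp-↭ (↭-sym π) (∈-++⁺ʳ O y∈)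

      factor-step : ∀ {x y} → y ≢ x → factor rem (x ∷ client) y ≤ factor free client y
      factor-step y≢x = ≤-trans (factor-∷ {rem} {client} y≢x) (factor-mono {rem} {free} {client} rem⊆free)

      -- If an offered element `y` lies in the set, every other answer gives `y` to Waiter and kills
      -- the set; the answer `y` replaces the factor 1 by Q and increases no other factor. Elements
      -- that are not offered only contribute a common factor.
      ∑-∏ : ∀ T → Unique T → ∑ (λ x → ∏ rem (x ∷ client) T) O ≤ Q * ∏ free client T
      ∑-∏ []      _           = ≤-reflexive (trans (sym (length≡∑ O)) (trans |O| (sym (*-identityʳ Q))))
      ∑-∏ (y ∷ T) (y∉T ∷ uT) with y ∈? O
      ... | no  y∉O = begin
        ∑ (λ x → factor rem (x ∷ client) y * ∏ rem (x ∷ client) T) O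
          ≤⟨ ∑-mono O (λ {x} x∈O → *-monoˡ-≤ (∏ rem (x ∷ client) T)
               (factor-step (λ { refl → y∉O x∈O }))) ⟩
        ∑ (λ x → factor free client y * ∏ rem (x ∷ client) T) O
          ≡⟨ ∑-*ˡ (factor free client y) (λ x → ∏ rem (x ∷ client) T) O ⟩
        factor free client y * ∑ (λ x → ∏ rem (x ∷ client) T) O
          ≤⟨ *-monoʳ-≤ (factor free client y) (∑-∏ T uT) ⟩
        factor free client y * (Q * ∏ free client T)
          ≡⟨ exchange (factor free client y) Q (∏ free client T) ⟩
        Q * (factor free client y * ∏ free client T) ∎
        where
        open ≤-Reasoning
        exchange : ∀ a b c → a * (b * c) ≡ b * (a * c)
        exchange = solve-∀
      ... | yes y∈O with ∈⇒↭ y∈O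
      ...   | O′ , ρ = begin
        ∑ f O
          ≡⟨ ∑-↭ f ρ ⟩
        f y + ∑ f O′
          ≡⟨ cong (f y +_) (trans (∑-cong O′ (λ {x} x∈ → cong (_* ∏ rem (x ∷ client) T)
               (factor-waiter {rem} {x ∷ client} (y∉x∷client x∈) y∉rem))) (∑-zero O′)) ⟩
        f y + 0
          ≡⟨ +-identityʳ (f y) ⟩
        factor rem (y ∷ client) y * ∏ rem (y ∷ client) T
          ≤⟨ *-mono-≤ (≤-reflexive (factor-client {rem} {y ∷ client} (here refl)))
               (∏-mono T (λ z∈T → factor-step (λ { refl → All¬⇒¬Any y∉T z∈T }))) ⟩
        Q * ∏ free client T
          ≡⟨ cong (Q *_) (trans (sym (*-identityˡ _)) (cong (_* ∏ free client T)
               (sym (factor-free {free} {client} y∉client (∈-resp-↭ (↭-sym π) (∈-++⁺ˡ y∈O)))))) ⟩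
        Q * (factor free client y * ∏ free client T) ∎
        where
        open ≤-Reasoning
        f : X → ℕ
        f x = factor rem (x ∷ client) y * ∏ rem (x ∷ client) T
        y∉rem : y ∉ rem
        y∉rem y∈ = unique-++-disjoint O unique y∈O (∈-++⁺ˡ y∈)
        y∉client : y ∉ client
        y∉client y∈ = unique-++-disjoint O unique y∈O (∈-++⁺ʳ rem y∈)
        y∉x∷client : ∀ {x} → x ∈ O′ → y ∉ x ∷ client
        y∉x∷client x∈ (here refl) = Unique[x∷xs]⇒x∉xs (Unique-resp-↭ ρ (unique-++ˡ O unique)) x∈
        y∉x∷client x∈ (there y∈)  = y∉client y∈

      ∑-Φ : ∑ (λ x → Φ rem (x ∷ client)) O ≤ Q * Φ free client
      ∑-Φ = begin
        ∑ (λ x → ∑ (weight rem (x ∷ client)) family) O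
          ≡⟨ ∑-swap (λ x T → weight rem (x ∷ client) T) O family ⟩
        ∑ (λ T → ∑ (λ x → weight rem (x ∷ client) T) O) family
          ≤⟨ ∑-mono family (λ {T} T∈ → begin
               ∑ (λ x → weight rem (x ∷ client) T) O              ≡⟨ ∑-*ˡ (Q ^ (M ∸ length T)) (λ x → ∏ rem (x ∷ client) T) O ⟩
               Q ^ (M ∸ length T) * ∑ (λ x → ∏ rem (x ∷ client) T) O ≤⟨ *-monoʳ-≤ (Q ^ (M ∸ length T)) (∑-∏ T (unique-sets T∈)) ⟩
               Q ^ (M ∸ length T) * (Q * ∏ free client T)         ≡⟨ exchange (Q ^ (M ∸ length T)) Q (∏ free client T) ⟩
               Q * weight free client T                           ∎) ⟩
        ∑ (λ T → Q * weight free client T) family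
          ≡⟨ ∑-*ˡ Q (weight free client) family ⟩
        Q * Φ free client ∎
        where
        open ≤-Reasoning
        exchange : ∀ a b c → a * (b * c) ≡ b * (a * c)
        exchange = solve-∀

      minimum-≤ : ∀ {x} → (∀ {y} → y ∈ O → Φ rem (x ∷ client) ≤ Φ rem (y ∷ client)) →
        Φ rem (x ∷ client) ≤ Φ free client
      minimum-≤ {x} min = *-cancelˡ-≤ Q (≤-trans (≤-trans
        (≤-reflexive (cong (_* Φ rem (x ∷ client)) (trans (sym |O|) (length≡∑ O))))
        (≤-trans (≤-reflexive (sym (∑-*ʳ (Φ rem (x ∷ client)) (λ _ → 1) O)))
          (∑-mono O (λ y∈ → ≤-trans (≤-reflexive (*-identityˡ _)) (min y∈))))) ∑-Φ)

    answer : ∀ {free} (client : List X) (o : Offer board q free) →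
      ∃[ x ] x ∈ offered o × (∀ {y} → y ∈ offered o → Φ (remaining o) (x ∷ client) ≤ Φ (remaining o) (y ∷ client))
    answer client o = argmin (λ x → Φ (remaining o) (x ∷ client)) (offered o)
      (subst (1 ≤_) (sym (quantity o)) (s≤s z≤n))

    strategy : ClientStrategy board q
    strategy {free} {client} _ o = proj₁ (answer client o) , proj₁ (proj₂ (answer client o))

    -- Freedom from repetition is carried along because `Round` needs an offered element to be
    -- neither left over nor already Client's.
    invariant : ∀ {free client} (h : History board q free client) → ClientFollows board q strategy h →
      Unique (free ++ client) × Φ free client ≤ Φ board []
    invariant start _ = subst Unique (sym (++-identityʳ board)) unique-board , ≤-refl
    invariant (last {free} {client} h _ _) fol with invariant h fol
    ... | u , Φ≤ = unique-++ʳ free u , ≤-trans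
            (∑-mono family (λ {T} _ → *-monoʳ-≤ (Q ^ (M ∸ length T))
              (∏-mono T (λ {y} _ → factor-mono {[]} {free} {client} (λ ()))))) Φ≤
    invariant (round {free} {client} h o {x} x∈) (fol , eq) with invariant h fol
    ... | u , Φ≤ = Unique-resp-↭ (↭-sym (shift x (remaining o) client))
                     (¬Any⇒All¬ _ (unique-++-disjoint (offered o) u′ x∈) ∷ unique-++ʳ (offered o) u′)
                 , ≤-trans (Round.minimum-≤ (split o) (quantity o) u′ (min (cong proj₁ eq))) Φ≤
      where
      u′ : Unique (offered o ++ remaining o ++ client)
      u′ = Unique-resp-↭ (↭-trans (++⁺ʳ client (split o)) (++-assoc (offered o) (remaining o) client)) u
      min : x ≡ proj₁ (answer client o) →
        ∀ {y} → y ∈ offered o → Φ (remaining o) (x ∷ client) ≤ Φ (remaining o) (y ∷ client)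
      min refl = proj₂ (proj₂ (answer client o))

    -- A set wholly claimed by Client has weight Q^M, more than the potential ever reaches. The
    -- argument applies to every partial play.
    avoids : Φ board [] < Q ^ M → ∀ {free client} (h : History board q free client) → ClientFollows board q strategy h →
      ∀ {T} → T ∈ family → length T ≤ M → ¬ T ⊆ client
    avoids Φ< {free} {client} h fol {T} T∈ |T|≤M T⊆ = <-irrefl refl (begin-strict
      Q ^ M                                   ≡⟨ cong (Q ^_) (m∸n+n≡m |T|≤M) ⟨
      Q ^ (M ∸ length T + length T)           ≡⟨ ^-distribˡ-+-* Q (M ∸ length T) (length T) ⟩
      Q ^ (M ∸ length T) * Q ^ length T       ≡⟨ cong (Q ^ (M ∸ length T) *_) (∏-client {free} {client} T T⊆) ⟨
      weight free client T                    ≤⟨ term≤∑ (weight free client) T∈ ⟩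
      Φ free client                           ≤⟨ proj₂ (invariant h fol) ⟩
      Φ board []                              <⟨ Φ< ⟩
      Q ^ M                                   ∎)
      where open ≤-Reasoning

    Φ-board : (∀ {T} → T ∈ family → T ⊆ board) → Φ board [] ≡ ∑ (λ T → Q ^ (M ∸ length T)) family
    Φ-board sub = ∑-cong family (λ {T} T∈ → trans (cong (Q ^ (M ∸ length T) *_) (∏-one T (sub T∈))) (*-identityʳ _))
      where
      ∏-one : ∀ T → T ⊆ board → ∏ board [] T ≡ 1
      ∏-one []      _  = refl
      ∏-one (y ∷ T) T⊆ = cong₂ _*_ (factor-free {board} {[]} (λ ()) (T⊆ (here refl))) (∏-one T (T⊆ ∘ there))

-- Counting t edges within t vertices, and Client's win.

module ClientWins where

  import Data.Bool.Properties as Bool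
  open import Data.Nat.Base
  open import Data.Nat.Properties
  open import Data.Nat.Combinatorics using (_C_; nCk+nC[k+1]≡[n+1]C[k+1]; nC1≡n)
  open import Data.Nat.Tactic.RingSolver using (solve-∀)
  open import Data.Fin.Subset as Subset using (Subset; ⋃; ⊤) renaming (_⊆_ to _⊆ₛ_; ∣_∣ to size)
  open import Data.Fin.Subset.Properties as Subset using (_⊆?_)
  open import Data.Vec.Properties using (≡-dec)
  open import Data.List.Base using (List; []; _∷_; _++_; map; filter; length; take; concatMap)
  open import Data.List.Properties using (length-map; length-++; length-take)
  open import Data.List.Membership.Propositional using (_∈_; find; lose)
  open import Data.List.Membership.Propositional.Properties using (∈-map⁺; ∈-map⁻; ∈-++⁺ˡ; ∈-++⁺ʳ; ∈-++⁻; ∈-filter⁺; ∈-filter⁻; ∈-concatMap⁺; ∈-concatMap⁻)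
  open import Data.List.Relation.Unary.Any using (here; there)
  open import Data.List.Relation.Unary.All as All using (All; []; _∷_)
  open import Data.List.Relation.Unary.Unique.Propositional using (Unique; []; _∷_)
  open import Data.List.Relation.Binary.Sublist.Propositional using ([]; _∷_; _∷ʳ_; lookup)
    renaming (_⊆_ to _⊑_; ⊆-trans to ⊑-trans)
  open import Data.List.Relation.Binary.Sublist.Propositional.Properties using (All-resp-⊆)
    renaming (filter-⊆ to filter-⊑; take-⊆ to take-⊑)
  open import Data.Product using (Σ-syntax; _×_; _,_; proj₁; proj₂)
  open import Data.Sum.Base using (inj₁; inj₂)
  open import Function using (_∘_)
  open import Relation.Nullary using (yes; no; does; contradiction)
  open import Relation.Nullary.Decidable using (dec-true)
  open import Relation.Unary using (Decidable)
  open import Relation.Binary using (DecidableEquality)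
  open import Relation.Binary.PropositionalEquality
  open import Defs
  open Sums
  open WaiterGame using (indicator; bernoulli)
  open Hypergraphs
  open WaiterWins using (*-distrib-^)
  open Seymour using (Expanding; expanding⇒2-colourable)
  open ClientGame

  private variable
    A : Set

  -- A discrete form of exp(x) ≤ 1 + x + x² on [0, 1] with x = m/t, multiplied by t^(m+2). At m = t
  -- the right-hand side supplies the constant 3.
  truncated-exponential : ∀ t m → m ≤ t → t * t * suc t ^ m ≤ t ^ m * (t * t + m * t + m * m)
  truncated-exponential t zero    _   = ≤-reflexive (p t)
    where
    p : ∀ t → t * t * 1 ≡ 1 * (t * t + 0 * t + 0 * 0)
    p = solve-∀
  truncated-exponential t (suc m) m<t = begin
    t * t * (suc t * suc t ^ m)                            ≡⟨ p₁ t (suc t ^ m) ⟩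
    suc t * (t * t * suc t ^ m)                            ≤⟨ *-monoʳ-≤ (suc t) (truncated-exponential t m (<⇒≤ m<t)) ⟩
    suc t * (t ^ m * (t * t + m * t + m * m))              ≡⟨ p₂ t m (t ^ m) ⟩
    t ^ m * (t * (t * t + m * t + m * m + t + m) + m * m)  ≤⟨ *-monoʳ-≤ (t ^ m) (+-monoʳ-≤ _ (*-mono-≤ (<⇒≤ m<t) (n≤1+n m))) ⟩
    t ^ m * (t * (t * t + m * t + m * m + t + m) + t * suc m) ≡⟨ p₃ t m (t ^ m) ⟩
    t * t ^ m * (t * t + suc m * t + suc m * suc m)        ∎
    where
    open ≤-Reasoning
    p₁ : ∀ t x → t * t * (suc t * x) ≡ suc t * (t * t * x)
    p₁ = solve-∀
    p₂ : ∀ t m x → suc t * (x * (t * t + m * t + m * m)) ≡ x * (t * (t * t + m * t + m * m + t + m) + m * m)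
    p₂ = solve-∀
    p₃ : ∀ t m x → x * (t * (t * t + m * t + m * m + t + m) + t * suc m) ≡ t * x * (t * t + suc m * t + suc m * suc m)
    p₃ = solve-∀

  [1+t]^t≤3t^t : ∀ t → suc t ^ t ≤ 3 * t ^ t
  [1+t]^t≤3t^t zero        = s≤s z≤n
  [1+t]^t≤3t^t t@(suc _) = *-cancelˡ-≤ (t * t) (≤-trans (truncated-exponential t t ≤-refl) (≤-reflexive (p t (t ^ t))))
    where
    p : ∀ t x → x * (t * t + t * t + t * t) ≡ t * t * (3 * x)
    p = solve-∀

  -- Consecutive values of t^t / t! have quotient (1 + 1/t)^t, which is at most 3.
  t^t≤3^t*t! : ∀ t → t ^ t ≤ 3 ^ t * t !
  t^t≤3^t*t! zero    = ≤-refl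
  t^t≤3^t*t! (suc t) = begin
    suc t * suc t ^ t            ≤⟨ *-monoʳ-≤ (suc t) ([1+t]^t≤3t^t t) ⟩
    suc t * (3 * t ^ t)          ≤⟨ *-monoʳ-≤ (suc t) (*-monoʳ-≤ 3 (t^t≤3^t*t! t)) ⟩
    suc t * (3 * (3 ^ t * t !))  ≡⟨ p (suc t) (3 ^ t) (t !) ⟩
    3 * 3 ^ t * (suc t * t !)    ∎
    where
    open ≤-Reasoning
    p : ∀ a x y → a * (3 * (x * y)) ≡ 3 * x * (a * y)
    p = solve-∀

  -- Pascal's rule reduces the induction step to (k + 1) n^k + n^(k+1) ≤ (n + 1)^(k+1), an instance
  -- of `bernoulli`.
  k!*nCk≤n^k : ∀ n k → k ! * (n C k) ≤ n ^ k
  k!*nCk≤n^k n       zero    = ≤-refl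
  k!*nCk≤n^k zero    (suc k) = ≤-reflexive (*-zeroʳ (suc k !))
  k!*nCk≤n^k (suc n) (suc k) = begin
    suc k ! * (suc n C suc k)                    ≡⟨ cong (suc k ! *_) (nCk+nC[k+1]≡[n+1]C[k+1] n k) ⟨
    suc k * k ! * (n C k + n C suc k)            ≡⟨ p₁ (suc k) (k !) (n C k) (n C suc k) ⟩
    suc k * (k ! * (n C k)) + suc k ! * (n C suc k) ≤⟨ +-mono-≤ (*-monoʳ-≤ (suc k) (k!*nCk≤n^k n k)) (k!*nCk≤n^k n (suc k)) ⟩
    suc k * n ^ k + n * n ^ k                    ≡⟨ p₂ (suc k) n (n ^ k) ⟩
    n ^ k * (n + suc k)                          ≤⟨ bernoulli n k ⟩
    suc n ^ suc k                                ∎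
    where
    open ≤-Reasoning
    p₁ : ∀ a f x y → a * f * (x + y) ≡ a * (f * x) + a * f * y
    p₁ = solve-∀
    p₂ : ∀ a n x → a * x + n * x ≡ x * (n + a)
    p₂ = solve-∀

  absorption : ∀ n k → suc k * (suc n C suc k) ≡ suc n * (n C k)
  absorption zero    zero    = refl
  absorption zero    (suc k) = trans (cong (suc (suc k) *_) (sym (nCk+nC[k+1]≡[n+1]C[k+1] 0 (suc k)))) (*-zeroʳ (suc (suc k)))
  absorption (suc n) zero    = trans (*-identityˡ _) (trans (nC1≡n (suc (suc n))) (sym (*-identityʳ _)))
  absorption (suc n) (suc k) = begin
    suc (suc k) * (suc (suc n) C suc (suc k))
      ≡⟨ cong (suc (suc k) *_) (nCk+nC[k+1]≡[n+1]C[k+1] (suc n) (suc k)) ⟨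
    suc (suc k) * (suc n C suc k + suc n C suc (suc k))
      ≡⟨ p₁ (suc k) (suc n C suc k) (suc n C suc (suc k)) ⟩
    suc n C suc k + (suc k * (suc n C suc k) + suc (suc k) * (suc n C suc (suc k)))
      ≡⟨ cong (suc n C suc k +_) (cong₂ _+_ (absorption n k) (absorption n (suc k))) ⟩
    suc n C suc k + (suc n * (n C k) + suc n * (n C suc k))
      ≡⟨ cong (suc n C suc k +_) (trans (sym (*-distribˡ-+ (suc n) (n C k) (n C suc k)))
           (cong (suc n *_) (nCk+nC[k+1]≡[n+1]C[k+1] n k))) ⟩
    suc (suc n) * (suc n C suc k) ∎
    where
    open ≡-Reasoning
    p₁ : ∀ a x y → suc a * (x + y) ≡ x + (a * x + suc a * y)
    p₁ = solve-∀

  C-ratio : ∀ {t n} k → t ≤ n → (t C suc k) * n ≤ (n C suc k) * t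
  C-ratio k z≤n = z≤n
  C-ratio {suc t} {suc n} k (s≤s t≤n) = *-cancelˡ-≤ (suc k) (begin
    suc k * ((suc t C suc k) * suc n)    ≡⟨ p (suc k) (suc t C suc k) (suc n) ⟩
    suc k * (suc t C suc k) * suc n      ≡⟨ cong (_* suc n) (absorption t k) ⟩
    suc t * (t C k) * suc n              ≤⟨ *-monoˡ-≤ (suc n) (*-monoʳ-≤ (suc t) (C-monoˡ k (≤⇒≤′ t≤n))) ⟩
    suc t * (n C k) * suc n              ≡⟨ p₂ (suc t) (n C k) (suc n) ⟩
    suc n * (n C k) * suc t              ≡⟨ cong (_* suc t) (absorption n k) ⟨
    suc k * (suc n C suc k) * suc t      ≡⟨ p (suc k) (suc n C suc k) (suc t) ⟨
    suc k * ((suc n C suc k) * suc t)    ∎)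
    where
    open ≤-Reasoning
    p : ∀ a x y → a * (x * y) ≡ a * x * y
    p = solve-∀
    p₂ : ∀ a x y → a * x * y ≡ y * x * a
    p₂ = solve-∀

  -- Absorption lowers both indices and removes one factor t/n; what is left follows from `C-ratio`
  -- and monotonicity. The square is what later cancels the t^t from each of the two binomial
  -- coefficients, and it is where edges of size at least 2 matter.
  C-ratio² : ∀ {t n} k → t ≤ n → (t C (2 + k)) * (n * n) ≤ (n C (2 + k)) * (t * t)
  C-ratio² k z≤n = z≤n
  C-ratio² {suc t} {suc n} k (s≤s t≤n) = *-cancelˡ-≤ (2 + k) (begin
    (2 + k) * ((suc t C (2 + k)) * (suc n * suc n))   ≡⟨ p (2 + k) (suc t C (2 + k)) (suc n) ⟩
    (2 + k) * (suc t C (2 + k)) * suc n * suc n       ≡⟨ cong (λ z → z * suc n * suc n) (absorption t (1 + k)) ⟩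
    suc t * (t C (1 + k)) * suc n * suc n             ≡⟨ p₂ (suc t) (t C (1 + k)) n ⟩
    suc t * suc n * ((t C (1 + k)) * n + t C (1 + k)) ≤⟨ *-monoʳ-≤ (suc t * suc n)
                                                          (+-mono-≤ (C-ratio k t≤n) (C-monoˡ (1 + k) (≤⇒≤′ t≤n))) ⟩
    suc t * suc n * ((n C (1 + k)) * t + n C (1 + k)) ≡⟨ p₃ (suc n) (n C (1 + k)) t ⟩
    suc n * (n C (1 + k)) * suc t * suc t             ≡⟨ cong (λ z → z * suc t * suc t) (absorption n (1 + k)) ⟨
    (2 + k) * (suc n C (2 + k)) * suc t * suc t       ≡⟨ p (2 + k) (suc n C (2 + k)) (suc t) ⟨
    (2 + k) * ((suc n C (2 + k)) * (suc t * suc t))   ∎)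
    where
    open ≤-Reasoning
    p : ∀ a x y → a * (x * (y * y)) ≡ a * x * y * y
    p = solve-∀
    p₂ : ∀ a x n → a * x * suc n * suc n ≡ a * suc n * (x * n + x)
    p₂ = solve-∀
    p₃ : ∀ b x t → suc t * b * (x * t + x) ≡ b * x * suc t * suc t
    p₃ = solve-∀

  sublists : ℕ → List A → List (List A)
  sublists zero    _        = [] ∷ []
  sublists (suc t) []       = []
  sublists (suc t) (x ∷ xs) = map (x ∷_) (sublists t xs) ++ sublists (suc t) xs

  length-sublists : ∀ t (xs : List A) → length (sublists t xs) ≡ length xs C t
  length-sublists zero    xs       = refl
  length-sublists (suc t) []       = refl
  length-sublists (suc t) (x ∷ xs) = trans (length-++ (map (x ∷_) (sublists t xs)))
    (trans (cong₂ _+_ (trans (length-map (x ∷_) (sublists t xs)) (length-sublists t xs)) (length-sublists (suc t) xs))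
      (nCk+nC[k+1]≡[n+1]C[k+1] (length xs) t))

  ∈-sublists⁺ : ∀ {T xs : List A} → T ⊑ xs → T ∈ sublists (length T) xs
  ∈-sublists⁺ []                          = here refl
  ∈-sublists⁺ {T = []}    (y ∷ʳ T⊑)       = here refl
  ∈-sublists⁺ {T = x ∷ T} (y ∷ʳ T⊑)       = ∈-++⁺ʳ (map (y ∷_) (sublists (length T) _)) (∈-sublists⁺ T⊑)
  ∈-sublists⁺ {T = x ∷ T} (refl ∷ T⊑)     = ∈-++⁺ˡ (∈-map⁺ (x ∷_) (∈-sublists⁺ T⊑))

  []⊑ : ∀ (xs : List A) → [] ⊑ xs
  []⊑ []       = []
  []⊑ (x ∷ xs) = x ∷ʳ []⊑ xs

  ∈-sublists⁻ : ∀ t {T xs : List A} → T ∈ sublists t xs → T ⊑ xs × length T ≡ t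
  ∈-sublists⁻ zero    {xs = xs}     (here refl) = []⊑ xs , refl
  ∈-sublists⁻ (suc t) {xs = x ∷ xs} T∈ with ∈-++⁻ (map (x ∷_) (sublists t xs)) T∈
  ... | inj₂ T∈ʳ = let T⊑ , |T| = ∈-sublists⁻ (suc t) T∈ʳ in x ∷ʳ T⊑ , |T|
  ... | inj₁ T∈ˡ with ∈-map⁻ (x ∷_) T∈ˡ
  ...   | _ , T′∈ , refl = let T′⊑ , |T′| = ∈-sublists⁻ t T′∈ in refl ∷ T′⊑ , cong suc |T′|

  unique-⊑ : ∀ {T xs : List A} → T ⊑ xs → Unique xs → Unique T
  unique-⊑ []          []      = []
  unique-⊑ (y ∷ʳ T⊑)   (_ ∷ u) = unique-⊑ T⊑ u
  unique-⊑ (refl ∷ T⊑) (a ∷ u) = All-resp-⊆ T⊑ a ∷ unique-⊑ T⊑ u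

  ⊑-filter : ∀ {P : A → Set} (P? : Decidable P) {T xs} → T ⊑ xs → All P T → T ⊑ filter P? xs
  ⊑-filter P? []                   []        = []
  ⊑-filter P? (y ∷ʳ T⊑)            ps with P? y
  ... | yes _ = y ∷ʳ ⊑-filter P? T⊑ ps
  ... | no _  = ⊑-filter P? T⊑ ps
  ⊑-filter P? {x ∷ _} (refl ∷ T⊑)  (p ∷ ps) with P? x
  ... | yes _ = refl ∷ ⊑-filter P? T⊑ ps
  ... | no ¬p = contradiction p ¬p

  length-filter≡∑ : ∀ {P : A → Set} (P? : Decidable P) xs →
    length (filter P? xs) ≡ ∑ (λ x → indicator (does (P? x))) xs
  length-filter≡∑ P? xs = trans (length≡∑ (filter P? xs))
    (trans (∑-filter P? (λ _ → 1) xs) (∑-cong xs (λ _ → *-identityʳ _)))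

  length-concatMap : ∀ {B : Set} (f : A → List B) xs → length (concatMap f xs) ≡ ∑ (length ∘ f) xs
  length-concatMap f []       = refl
  length-concatMap f (x ∷ xs) = trans (length-++ (f x)) (cong (length (f x) +_) (length-concatMap f xs))

  length-E[K] : ∀ n k → length (E[K] n k) ≡ n C k
  length-E[K] n k = begin
    length (E[K] n k)                                   ≡⟨ length≡∑ (E[K] n k) ⟩
    ∑ (λ _ → 1) (E[K] n k)                              ≡⟨ ∑-cong (E[K] n k) (λ {A} _ →
                                                             cong indicator (dec-true (A ⊆? ⊤) Subset.⊆⊤)) ⟨
    ∑ (λ A → indicator (does (A ⊆? ⊤))) (E[K] n k)      ≡⟨ count-edges-inside (⊤ {n}) k ⟩
    size (⊤ {n}) C k                                    ≡⟨ cong (_C k) (Subset.∣⊤∣≡n n) ⟩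
    n C k                                               ∎
    where open ≡-Reasoning

  ⊆-⋃ : ∀ {n} {T : List (Subset n)} {A} → A ∈ T → A ⊆ₛ ⋃ T
  ⊆-⋃ {T = A ∷ T} (here refl) = Subset.p⊆p∪q (⋃ T)
  ⊆-⋃ {T = B ∷ T} (there A∈)  = Subset.⊆-trans (⊆-⋃ A∈) (Subset.q⊆p∪q B (⋃ T))

  module _ (n k q : ℕ) where

    edgesInside : Subset n → List (Subset n)
    edgesInside S = filter (_⊆? S) (E[K] n k)

    -- Each T is listed once for every t-set S around it, so the length is exactly the count of the
    -- union bound.
    tight : ℕ → List (List (Subset n))
    tight t = concatMap (λ S → sublists t (edgesInside S)) (E[K] n t)

    -- The sizes start at 1: the empty configuration is contained in every list of Client and could
    -- not be avoided.
    tight≤ : ℕ → List (List (Subset n))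
    tight≤ zero    = []
    tight≤ (suc m) = tight (suc m) ++ tight≤ m

    length-tight : ∀ t → length (tight t) ≡ (n C t) * ((t C k) C t)
    length-tight t = begin
      length (tight t)                                       ≡⟨ length-concatMap (λ S → sublists t (edgesInside S)) (E[K] n t) ⟩
      ∑ (λ S → length (sublists t (edgesInside S))) (E[K] n t) ≡⟨ ∑-cong (E[K] n t) (λ {S} S∈ →
          trans (length-sublists t (edgesInside S)) (trans (cong (_C t)
            (trans (length-filter≡∑ (_⊆? S) (E[K] n k)) (trans (count-edges-inside S k) (cong (_C k) (∈-E[K]⁻ S∈)))))
            (sym (*-identityˡ _)))) ⟩
      ∑ (λ _ → 1 * ((t C k) C t)) (E[K] n t)                 ≡⟨ ∑-*ʳ ((t C k) C t) (λ _ → 1) (E[K] n t) ⟩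
      ∑ (λ _ → 1) (E[K] n t) * ((t C k) C t)                 ≡⟨ cong (_* ((t C k) C t)) (trans (sym (length≡∑ (E[K] n t))) (length-E[K] n t)) ⟩
      (n C t) * ((t C k) C t)                                ∎
      where open ≡-Reasoning

    ∈-tight⁻ : ∀ t {T} → T ∈ tight t → T ⊑ E[K] n k × length T ≡ t
    ∈-tight⁻ t {T} T∈ with find (∈-concatMap⁻ (λ S → sublists t (edgesInside S)) {xs = E[K] n t} T∈)
    ... | S , _ , T∈S with ∈-sublists⁻ t T∈S
    ...   | T⊑ , |T| = ⊑-trans T⊑ (filter-⊑ (_⊆? S) (E[K] n k)) , |T|

    ∈-tight⁺ : ∀ S {T} → T ⊑ E[K] n k → All (_⊆ₛ S) T → length T ≡ size S → T ∈ tight (size S)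
    ∈-tight⁺ S T⊑ T⊆S |T| = ∈-concatMap⁺ (λ S′ → sublists (size S) (edgesInside S′))
      (lose (∈-E[K]⁺ S) (subst (λ t → _ ∈ sublists t (edgesInside S)) |T| (∈-sublists⁺ (⊑-filter (_⊆? S) T⊑ T⊆S))))

    ∈-tight≤⁻ : ∀ m {T} → T ∈ tight≤ m → T ⊑ E[K] n k × length T ≤ m
    ∈-tight≤⁻ (suc m) T∈ with ∈-++⁻ (tight (suc m)) T∈
    ... | inj₁ T∈t = let T⊑ , |T| = ∈-tight⁻ (suc m) T∈t in T⊑ , ≤-reflexive |T|
    ... | inj₂ T∈m = let T⊑ , |T| = ∈-tight≤⁻ m T∈m in T⊑ , m≤n⇒m≤1+n |T|

    ∈-tight≤⁺ : ∀ {t m T} → 1 ≤ t → t ≤′ m → T ∈ tight t → T ∈ tight≤ m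
    ∈-tight≤⁺ {suc t} _   ≤′-refl           T∈ = ∈-++⁺ˡ T∈
    ∈-tight≤⁺         1≤t (≤′-step {m} t≤m) T∈ = ∈-++⁺ʳ (tight (suc m)) (∈-tight≤⁺ 1≤t t≤m T∈)

    module _ (2≤k : 2 ≤ k) (1≤n : 1 ≤ n) (threshold : 18 * (n C k) ≤ q * n) where

      Q : ℕ
      Q = suc q

      -- Passing from n to t vertices shrinks the number of edges by at least (t/n)², so the
      -- threshold at n controls every smaller t.
      edges-density : ∀ {t} → t ≤ n → 18 * (n * (t C k)) ≤ q * (t * t)
      edges-density {t} t≤n = *-cancelʳ-≤ _ _ (n * n) {{m*n≢0 n n {{>-nonZero 1≤n}} {{>-nonZero 1≤n}}}} (begin
        18 * (n * (t C k)) * (n * n)    ≡⟨ p₁ n (t C k) ⟩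
        18 * n * ((t C k) * (n * n))    ≤⟨ *-monoʳ-≤ (18 * n) (ratio 2≤k) ⟩
        18 * n * ((n C k) * (t * t))    ≡⟨ p₂ n (n C k) t ⟩
        n * (t * t) * (18 * (n C k))    ≤⟨ *-monoʳ-≤ (n * (t * t)) threshold ⟩
        n * (t * t) * (q * n)           ≡⟨ p₃ n t q ⟩
        q * (t * t) * (n * n)           ∎)
        where
        open ≤-Reasoning
        ratio : ∀ {k} → 2 ≤ k → (t C k) * (n * n) ≤ (n C k) * (t * t)
        ratio (s≤s (s≤s {n = k} z≤n)) = C-ratio² k t≤n
        p₁ : ∀ n x → 18 * (n * x) * (n * n) ≡ 18 * n * (x * (n * n))
        p₁ = solve-∀
        p₂ : ∀ n x t → 18 * n * (x * (t * t)) ≡ n * (t * t) * (18 * x)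
        p₂ = solve-∀
        p₃ : ∀ n t q → n * (t * t) * (q * n) ≡ q * (t * t) * (n * n)
        p₃ = solve-∀

      -- In 18 = 2 · 3 · 3 each 3 comes from the factorial in one of the two binomial coefficients,
      -- and the 2 is left for the geometric decay.
      few-tight : ∀ t → 1 ≤ t → t ≤ n → 2 ^ t * length (tight t) ≤ Q ^ t
      few-tight t 1≤t t≤n = *-cancelʳ-≤ _ _ (t ^ t * t ^ t) {{m*n≢0 (t ^ t) (t ^ t) {{nz}} {{nz}}}} (begin
        2 ^ t * N * (t ^ t * t ^ t)                      ≤⟨ *-monoʳ-≤ (2 ^ t * N) (*-mono-≤ (t^t≤3^t*t! t) (t^t≤3^t*t! t)) ⟩
        2 ^ t * N * (3 ^ t * t ! * (3 ^ t * t !))        ≡⟨ cong (λ z → 2 ^ t * z * (3 ^ t * t ! * (3 ^ t * t !))) (length-tight t) ⟩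
        2 ^ t * ((n C t) * (c C t)) * (3 ^ t * t ! * (3 ^ t * t !)) ≡⟨ p (2 ^ t) (n C t) (c C t) (3 ^ t) (t !) ⟩
        2 ^ t * 3 ^ t * 3 ^ t * (t ! * (n C t) * (t ! * (c C t))) ≤⟨ *-monoʳ-≤ (2 ^ t * 3 ^ t * 3 ^ t)
                                                              (*-mono-≤ (k!*nCk≤n^k n t) (k!*nCk≤n^k c t)) ⟩
        2 ^ t * 3 ^ t * 3 ^ t * (n ^ t * c ^ t)          ≡⟨ cong₂ _*_ (trans (cong (_* 3 ^ t) (*-distrib-^ 2 3 t)) (*-distrib-^ 6 3 t))
                                                              (*-distrib-^ n c t) ⟩
        18 ^ t * (n * c) ^ t                             ≡⟨ *-distrib-^ 18 (n * c) t ⟩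
        (18 * (n * c)) ^ t                               ≤⟨ ^-monoˡ-≤ t (≤-trans (edges-density t≤n) (*-monoˡ-≤ (t * t) (n≤1+n q))) ⟩
        (Q * (t * t)) ^ t                                ≡⟨ trans (cong (Q ^ t *_) (*-distrib-^ t t t)) (*-distrib-^ Q (t * t) t) ⟨
        Q ^ t * (t ^ t * t ^ t)                          ∎)
        where
        open ≤-Reasoning
        N c : ℕ
        N = length (tight t)
        c = t C k
        nz : NonZero (t ^ t)
        nz = m^n≢0 t t {{>-nonZero 1≤t}}
        p : ∀ a x y b f → a * (x * y) * (b * f * (b * f)) ≡ a * b * b * (f * x * (f * y))
        p = solve-∀

      total : ℕ → ℕ
      total m = ∑ (λ T → Q ^ (m ∸ length T)) (tight≤ m)

      total-suc : ∀ m → total (suc m) ≡ length (tight (suc m)) + Q * total m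
      total-suc m = trans (∑-++ (λ T → Q ^ (suc m ∸ length T)) (tight (suc m)) (tight≤ m)) (cong₂ _+_
        (trans (∑-cong (tight (suc m)) (λ {T} T∈ → cong (Q ^_) (trans (cong (suc m ∸_) (proj₂ (∈-tight⁻ (suc m) T∈))) (n∸n≡0 (suc m)))))
          (sym (length≡∑ (tight (suc m)))))
        (trans (∑-cong (tight≤ m) (λ {T} T∈ → cong (Q ^_) (+-∸-assoc 1 (proj₂ (∈-tight≤⁻ m T∈)))))
          (∑-*ˡ Q (λ T → Q ^ (m ∸ length T)) (tight≤ m))))

      -- The geometric sum 1/2 + ... + 1/2^m = 1 - 1/2^m, cleared of denominators. Keeping the
      -- remainder `Q ^ m` closes the induction and makes `total<Q^n` strict.
      total-bound : ∀ m → m ≤ n → 2 ^ m * total m + Q ^ m ≤ 2 ^ m * Q ^ m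
      total-bound zero    _   = ≤-refl
      total-bound (suc m) m<n = begin
        2 * 2 ^ m * total (suc m) + Q * Q ^ m               ≡⟨ cong (λ z → 2 * 2 ^ m * z + Q * Q ^ m) (total-suc m) ⟩
        2 * 2 ^ m * (N + Q * total m) + Q * Q ^ m           ≡⟨ p₁ (2 ^ m) N (total m) (Q ^ m) Q ⟩
        2 * 2 ^ m * N + (2 * Q * (2 ^ m * total m) + Q * Q ^ m) ≤⟨ +-monoˡ-≤ _ (few-tight (suc m) (s≤s z≤n) m<n) ⟩
        Q * Q ^ m + (2 * Q * (2 ^ m * total m) + Q * Q ^ m) ≡⟨ p₂ (2 ^ m) (total m) (Q ^ m) Q ⟩
        2 * Q * (2 ^ m * total m + Q ^ m)                   ≤⟨ *-monoʳ-≤ (2 * Q) (total-bound m (<⇒≤ m<n)) ⟩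
        2 * Q * (2 ^ m * Q ^ m)                             ≡⟨ p₃ (2 ^ m) (Q ^ m) Q ⟩
        2 * 2 ^ m * (Q * Q ^ m)                             ∎
        where
        open ≤-Reasoning
        N : ℕ
        N = length (tight (suc m))
        p₁ : ∀ a N s x Q → 2 * a * (N + Q * s) + Q * x ≡ 2 * a * N + (2 * Q * (a * s) + Q * x)
        p₁ = solve-∀
        p₂ : ∀ a s x Q → Q * x + (2 * Q * (a * s) + Q * x) ≡ 2 * Q * (a * s + x)
        p₂ = solve-∀
        p₃ : ∀ a x Q → 2 * Q * (a * x) ≡ 2 * a * (Q * x)
        p₃ = solve-∀

      total<Q^n : total n < Q ^ n
      total<Q^n = *-cancelˡ-< (2 ^ n) _ _ (<-≤-trans (m<m+n (2 ^ n * total n) (m^n>0 Q n)) (total-bound n ≤-refl))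

      _≟ₑ_ : DecidableEquality (Subset n)
      _≟ₑ_ = ≡-dec Bool._≟_

      open Avoidance _≟ₑ_ (E[K] n k) (E[K]-unique n k) q (tight≤ n)
        (λ T∈ → unique-⊑ (proj₁ (∈-tight≤⁻ n T∈)) (E[K]-unique n k)) n
        hiding (Q)
      open import Data.List.Membership.DecPropositional _≟ₑ_ using (_∈?_)

      Φ<Q^n : Φ (E[K] n k) [] < Q ^ n
      Φ<Q^n = subst (_< Q ^ n) (sym (Φ-board (λ T∈ → lookup (proj₁ (∈-tight≤⁻ n T∈))))) total<Q^n

      keeps-colourable : ∀ {free client} (h : History (E[K] n k) q free client) →
        ClientFollows (E[K] n k) q strategy h → Colourable client 2
      -- Client's list is in order of play, whereas the configurations are sublists of the board; it
      -- is therefore replaced by the sublist of the board with the same members.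
      keeps-colourable {free} {client} h fol = colourable-anti
        (λ A∈ → ∈-filter⁺ (_∈? client) (proj₂ (client⊆board h) A∈) A∈)
        (expanding⇒2-colourable _ (filter (_∈? client) (E[K] n k)) ≤-refl expanding)
        where
        expanding : Expanding (filter (_∈? client) (E[K] n k))
        expanding {[]}    _  T≢[] = contradiction refl T≢[]
        -- A violating `T` may have more edges than its union has vertices; its first `size (⋃ T)`
        -- edges already form a forbidden configuration inside S = `⋃ T`.
        expanding {T@(A ∷ _)} T⊑ _ = ≰⇒> λ few → avoids Φ<Q^n h fol
          (∈-tight≤⁺ 1≤size (≤⇒≤′ (Subset.∣p∣≤n (⋃ T))) (∈-tight⁺ (⋃ T) T′⊑ T′⊆⋃
            (trans (length-take (size (⋃ T)) T) (m≤n⇒m⊓n≡m few))))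
          (≤-trans (≤-reflexive (trans (length-take (size (⋃ T)) T) (m≤n⇒m⊓n≡m few))) (Subset.∣p∣≤n (⋃ T)))
          (λ B∈ → proj₂ (∈-filter⁻ (_∈? client) {xs = E[K] n k} (lookup T⊑ (lookup (take-⊑ (size (⋃ T)) T) B∈))))
          where
          T⊑E : T ⊑ E[K] n k
          T⊑E = ⊑-trans T⊑ (filter-⊑ (_∈? client) (E[K] n k))
          T′⊑ : take (size (⋃ T)) T ⊑ E[K] n k
          T′⊑ = ⊑-trans (take-⊑ (size (⋃ T)) T) T⊑E
          T′⊆⋃ : All (_⊆ₛ ⋃ T) (take (size (⋃ T)) T)
          T′⊆⋃ = All.tabulate (λ B∈ → ⊆-⋃ (lookup (take-⊑ (size (⋃ T)) T) B∈))
          1≤size : 1 ≤ size (⋃ T)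
          1≤size = ≤-trans (≤-trans (n≤1+n 1) 2≤k) (subst (_≤ size (⋃ T)) (∈-E[K]⁻ (lookup T⊑E (here refl)))
            (Subset.p⊆q⇒∣p∣≤∣q∣ (⊆-⋃ {T = T} (here refl))))

      client-wins : Σ[ τ ∈ ClientStrategy (E[K] n k) q ] KeepsTwoColourable n k q τ
        × WinningForClient (E[K] n k) q (NC₂ n k) τ
      client-wins = strategy
        , (λ h fol → twoColourable (keeps-colourable h fol))
        , (λ h fol → twoColourable⇒noWinningSet (keeps-colourable h fol))

open import Data.Nat.Base using (ℕ; _+_; _*_; _≤_; NonZero; >-nonZero⁻¹; ⌈_/2⌉)
open import Data.Nat.Combinatorics using (_C_)
open import Data.Nat.Tactic.RingSolver using (solve-∀)
open import Data.Product using (∃-syntax; Σ-syntax; _×_; _,_)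
open import Relation.Binary.PropositionalEquality using (_≡_; subst)
open import Defs
open WaiterWins using (waiter-wins)
open ClientWins using (client-wins)
open Thresholds using (waiter-threshold; client-threshold)

theorem1p1 : ∀ (k : ℕ) → 2 ≤ k →
    ∃[ n₀ ] ∀ (n : ℕ) → .{{_ : NonZero n}} → n₀ ≤ n → ∀ (q : ℕ) → 1 ≤ q →
    (fromℕ q ≤ᴿ fromℕ (⌈ n /2⌉ C k) *ᴿ
    (ln2 /ᴿ (fromℕ 2 *ᴿ ((fromℕ 1 +ᴿ ln2) *ᴿ fromℕ n +ᴿ ln2))) →
    Σ[ σ ∈ WaiterStrategy (E[K] n k) q ] ForcesNonTwoColourable n k q σ
    × WinningForWaiter (E[K] n k) q (NC₂ n k) σ)
    ×
    (√ (fromℕ 2) ^ᴿ k *ᴿ √ e ^ᴿ (k + 2) *ᴿ fromℕ k *ᴿ fromℕ (n C k) /ᴿ fromℕ n ≤ᴿ fromℕ q →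
    Σ[ τ ∈ ClientStrategy (E[K] n k) q ] KeepsTwoColourable n k q τ
    × WinningForClient (E[K] n k) q (NC₂ n k) τ)
-- The witness is 0 since the estimates above are uniform in n ≥ 1.
theorem1p1 k 2≤k = 0 , λ n _ q 1≤q →
  (λ h → waiter-wins n k q 2≤k (>-nonZero⁻¹ n) 1≤q
    (subst (_≤ ⌈ n /2⌉ C k) (regroup q n) (waiter-threshold n q (⌈ n /2⌉ C k) h))) ,
  (λ h → client-wins n k q 2≤k (>-nonZero⁻¹ n) (client-threshold k n q (n C k) 2≤k h))
  where
  regroup : ∀ q n → q * (2 + 4 * n) ≡ 2 * q + q * 4 * n
  regroup = solve-∀
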